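{- Fix a field $K$. The class $\mathcal M_{QG}$ of matroids whose toric ideal has a Gr\"obner basis (with respect to some monomial order) consisting of quadratic binomials, and the class $\mathcal M_Q$ of matroids whose toric ideal is generated by quadratic binomials, are each closed under series connections, parallel connections and 2-sums: if $M_1$ and $M_2$ are matroids in the class with $E_1\cap E_2=\{c\}$, then $S(M_1,M_2)$ and $P(M_1,M_2)$ belong to the class, and, when $c$ is neither a loop nor a coloop of $M_1$ or of $M_2$, so does $M_1\oplus_2M_2$.
   Context: For a matroid $M$ on $E$ with bases $B_1,\dots,B_n$, the toric ideal is $J_M=\ker\big(K[x_1,\dots,x_n]\to K[s_e:e\in E],\ x_j\mapsto\prod_{e\in B_j}s_e\big)$. A loop is an element in no basis; a coloop is an element in every basis. Deletion $M\setminus c$: the matroid on $E\setminus\{c\}$ with bases $\{B\setminus\{c\}\}$ if $c$ is a coloop, and $\{B: c\notin B\}$ otherwise; dual $M^*$ has bases $E\setminus B$; contraction $M/c=(M^*\setminus c)^*$. Direct sum $M_1\oplus M_2$ (disjoint ground sets) has bases $B\cup D$. Let $M_1$, $M_2$ be matroids on $E_1,E_2$ with $E_1\cap E_2=\{c\}$. If $c$ is neither a loop nor a coloop of $M_1$ and of $M_2$: the series connection $S(M_1,M_2)$ is the matroid on $E_1\cup E_2$ with bases $\{B\cup D: B\in\mathcal B(M_1),D\in\mathcal B(M_2),B\cap D=\emptyset\}$, and the parallel connection $P(M_1,M_2)$ has bases $\{B\cup D: c\in B\cap D\}\cup\{(B\cup D)\setminus\{c\}: c \text{ lies in exactly one of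 } B,D\}$. If $c$ is a loop of $M_1$: $P(M_1,M_2)=M_1\oplus(M_2/c)$, $S(M_1,M_2)=(M_1/c)\oplus M_2$. If $c$ is a coloop of $M_1$: $P(M_1,M_2)=(M_1\setminus c)\oplus M_2$, $S(M_1,M_2)=M_1\oplus(M_2\setminus c)$; symmetrically with the roles of $M_1,M_2$ exchanged when $c$ is a loop or coloop of $M_2$. The 2-sum is $M_1\oplus_2M_2=S(M_1,M_2)/c=P(M_1,M_2)\setminus c$, defined when $c$ is neither a loop nor a coloop of $M_1$ or $M_2$. -}

module Defs where

open import Level using (Level; _⊔_) renaming (suc to lsuc)
open import Algebra.Bundles using (CommutativeRing)
open import Data.Bool using (Bool; true; false; _∧_; _∨_; not; if_then_else_)
open import Data.Nat as ℕ using (ℕ; zero; suc)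
open import Data.Fin using (Fin)
open import Data.Fin.Subset using (Subset; ⁅_⁆; _∪_; _∩_; _─_; _-_; _⊆_; _∈_; _∉_; ⊥; ∁)
open import Data.Fin.Subset.Properties using (_⊆?_; _∈?_)
open import Data.Vec as Vec using (Vec; []; _∷_)
open import Data.Vec.Properties using (≡-dec)
open import Data.Vec.Relation.Binary.Pointwise.Inductive using (Pointwise)
open import Data.List as List using (List; []; _∷_; _++_; length; filterᵇ; concatMap)
open import Data.Bool.ListAction using (any; all)
open import Data.List.Membership.Propositional as LM using ()
open import Data.List.Relation.Unary.All using (All)
open import Data.Product using (Σ; ∃; ∃-syntax; _×_; _,_; proj₁; proj₂)
open import Data.Sum using (_⊎_)
open import Relation.Binary.PropositionalEquality using (_≡_)
open import Relation.Binary.Structures using (IsStrictTotalOrder)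
open import Relation.Nullary using (¬_)
open import Relation.Nullary.Decidable using (⌊_⌋)
import Data.Bool.Properties as BoolP
import Data.Nat.Properties as ℕP

record Field (c ℓ : Level) : Set (lsuc (c ⊔ ℓ)) where
  field
    commutativeRing : CommutativeRing c ℓ
  open CommutativeRing commutativeRing public
  field
    0≉1     : ¬ (0# ≈ 1#)
    inverse : ∀ x → ¬ (x ≈ 0#) → ∃[ y ] (x * y ≈ 1#)

record SetSystem (N : ℕ) : Set where
  constructor ⟨_,_⟩
  field
    E       : Subset N
    isBasis : Subset N → Bool
open SetSystem public

IsBasis : ∀ {N} → SetSystem N → Subset N → Set
IsBasis M X = isBasis M X ≡ true

record IsMatroid {N : ℕ} (M : SetSystem N) : Set where
  field
    nonempty : ∃[ B ] IsBasis M B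
    ⊆ground  : ∀ B → IsBasis M B → B ⊆ E M
    exchange : ∀ B₁ B₂ → IsBasis M B₁ → IsBasis M B₂ →
               ∀ x → x ∈ B₁ → x ∉ B₂ →
               ∃[ y ] (y ∈ B₂ × y ∉ B₁ × IsBasis M ((B₁ - x) ∪ ⁅ y ⁆))

_⊆ᵇ_ : ∀ {N} → Subset N → Subset N → Bool
X ⊆ᵇ Y = ⌊ X ⊆? Y ⌋

_∈ᵇ_ : ∀ {N} → Fin N → Subset N → Bool
x ∈ᵇ X = ⌊ x ∈? X ⌋

_==_ : ∀ {N} → Subset N → Subset N → Bool
X == Y = ⌊ ≡-dec BoolP._≟_ X Y ⌋

allSubsets : ∀ N → List (Subset N)
allSubsets zero    = [] ∷ []
allSubsets (suc N) = List.map (false ∷_) (allSubsets N) ++ List.map (true ∷_) (allSubsets N)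

bases : ∀ {N} → SetSystem N → List (Subset N)
bases {N} M = filterᵇ (isBasis M) (allSubsets N)

isLoopᵇ : ∀ {N} → SetSystem N → Fin N → Bool
isLoopᵇ M c = (c ∈ᵇ E M) ∧ not (any (c ∈ᵇ_) (bases M))

isColoopᵇ : ∀ {N} → SetSystem N → Fin N → Bool
isColoopᵇ M c = (c ∈ᵇ E M) ∧ all (c ∈ᵇ_) (bases M)

IsLoop IsColoop : ∀ {N} → SetSystem N → Fin N → Set
IsLoop M c = isLoopᵇ M c ≡ true
IsColoop M c = isColoopᵇ M c ≡ true

dual : ∀ {N} → SetSystem N → SetSystem N
dual M = ⟨ E M , (λ X → (X ⊆ᵇ E M) ∧ isBasis M (E M ─ X)) ⟩

delete : ∀ {N} → SetSystem N → Fin N → SetSystem N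
delete M c = ⟨ E M - c , isB ⟩
  where
  isB : _ → Bool
  isB X with isColoopᵇ M c
  ... | true  = not (c ∈ᵇ X) ∧ isBasis M (X ∪ ⁅ c ⁆)
  ... | false = not (c ∈ᵇ X) ∧ isBasis M X

contract : ∀ {N} → SetSystem N → Fin N → SetSystem N
contract M c = dual (delete (dual M) c)

-- direct sum (ground sets assumed disjoint)
_⊕_ : ∀ {N} → SetSystem N → SetSystem N → SetSystem N
M₁ ⊕ M₂ = ⟨ E M₁ ∪ E M₂ ,
            (λ X → (X ⊆ᵇ (E M₁ ∪ E M₂)) ∧ isBasis M₁ (X ∩ E M₁) ∧ isBasis M₂ (X ∩ E M₂)) ⟩

seriesGen : ∀ {N} → SetSystem N → SetSystem N → SetSystem N
seriesGen M₁ M₂ = ⟨ E M₁ ∪ E M₂ ,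
  (λ X → any (λ B → any (λ D → ((B ∩ D) == ⊥) ∧ (X == (B ∪ D))) (bases M₂)) (bases M₁)) ⟩

parallelGen : ∀ {N} → SetSystem N → SetSystem N → Fin N → SetSystem N
parallelGen M₁ M₂ c = ⟨ E M₁ ∪ E M₂ ,
  (λ X → any (λ B → any (λ D → ok X B D) (bases M₂)) (bases M₁)) ⟩
  where
  ok : _ → _ → _ → Bool
  ok X B D with c ∈ᵇ B | c ∈ᵇ D
  ... | true  | true  = X == (B ∪ D)
  ... | true  | false = X == ((B ∪ D) - c)
  ... | false | true  = X == ((B ∪ D) - c)
  ... | false | false = false

series : ∀ {N} → SetSystem N → SetSystem N → Fin N → SetSystem N
series M₁ M₂ c with isLoopᵇ M₁ c | isColoopᵇ M₁ c | isLoopᵇ M₂ c | isColoopᵇ M₂ c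
... | true  | _     | _     | _     = contract M₁ c ⊕ M₂
... | false | true  | _     | _     = M₁ ⊕ delete M₂ c
... | false | false | true  | _     = M₁ ⊕ contract M₂ c
... | false | false | false | true  = delete M₁ c ⊕ M₂
... | false | false | false | false = seriesGen M₁ M₂

parallel : ∀ {N} → SetSystem N → SetSystem N → Fin N → SetSystem N
parallel M₁ M₂ c with isLoopᵇ M₁ c | isColoopᵇ M₁ c | isLoopᵇ M₂ c | isColoopᵇ M₂ c
... | true  | _     | _     | _     = M₁ ⊕ contract M₂ c
... | false | true  | _     | _     = delete M₁ c ⊕ M₂
... | false | false | true  | _     = contract M₁ c ⊕ M₂
... | false | false | false | true  = M₁ ⊕ delete M₂ c
... | false | false | false | false = parallelGen M₁ M₂ c

-- 2-sum M₁ ⊕₂ M₂ = S(M₁,M₂)/c  (only used when c is neither a loop nor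
-- a coloop of M₁ or M₂)
twoSum : ∀ {N} → SetSystem N → SetSystem N → Fin N → SetSystem N
twoSum M₁ M₂ c = contract (series M₁ M₂ c) c

-- Polynomials over a field in n variables, as formal finite sums of
-- terms (coefficient, exponent vector); equality is coefficientwise.

module Poly {c ℓ} (K : Field c ℓ) where
  open Field K

  Mon : ℕ → Set
  Mon n = Vec ℕ n

  Pol : ℕ → Set c
  Pol n = List (Carrier × Mon n)

  _+ᵐ_ : ∀ {n} → Mon n → Mon n → Mon n
  _+ᵐ_ = Vec.zipWith ℕ._+_

  0ᵐ : ∀ {n} → Mon n
  0ᵐ = Vec.replicate _ 0

  deg : ∀ {n} → Mon n → ℕ
  deg = Vec.sum

  _∣ᵐ_ : ∀ {n} → Mon n → Mon n → Set
  _∣ᵐ_ = Pointwise ℕ._≤_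

  coeff : ∀ {n} → Pol n → Mon n → Carrier
  coeff []            m = 0#
  coeff ((a , u) ∷ p) m with ≡-dec ℕP._≟_ u m
  ... | Relation.Nullary.yes _ = a + coeff p m
  ... | Relation.Nullary.no  _ = coeff p m

  _≈ₚ_ : ∀ {n} → Pol n → Pol n → Set ℓ
  p ≈ₚ q = ∀ m → coeff p m ≈ coeff q m

  0ₚ : ∀ {n} → Pol n
  0ₚ = []

  _+ₚ_ : ∀ {n} → Pol n → Pol n → Pol n
  _+ₚ_ = _++_

  _*ₚ_ : ∀ {n} → Pol n → Pol n → Pol n
  p *ₚ q = concatMap (λ { (a , u) → List.map (λ { (b , v) → (a * b , u +ᵐ v) }) q }) p

  binom : ∀ {n} → Mon n → Mon n → Pol n
  binom u v = (1# , u) ∷ (- 1# , v) ∷ []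

  _∈⟨_⟩ : ∀ {n} → Pol n → List (Pol n) → Set (c ⊔ ℓ)
  p ∈⟨ G ⟩ = ∃[ hs ] (All (λ hg → proj₂ hg LM.∈ G) hs ×
                       p ≈ₚ List.foldr (λ hg acc → (proj₁ hg *ₚ proj₂ hg) +ₚ acc) 0ₚ hs)

  record MonomialOrder (n : ℕ) : Set₁ where
    field
      _≺_        : Mon n → Mon n → Set
      isSTO      : IsStrictTotalOrder _≡_ _≺_
      compatible : ∀ u v w → u ≺ v → (u +ᵐ w) ≺ (v +ᵐ w)
      one-least  : ∀ u → u ≡ 0ᵐ ⊎ 0ᵐ ≺ u

  IsLeading : ∀ {n} → MonomialOrder n → Pol n → Mon n → Set ℓ
  IsLeading O f m = ¬ (coeff f m ≈ 0#) ×
                    (∀ m' → ¬ (coeff f m' ≈ 0#) → m' ≡ m ⊎ m' ≺ m)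
    where open MonomialOrder O

  module _ {N : ℕ} (M : SetSystem N) where
    nvars : ℕ
    nvars = length (bases M)

    χ : Subset N → Mon N
    χ = Vec.map (λ b → if b then 1 else 0)

    -- exponent of φ(x^a) = ∏_j (∏_{e ∈ B_j} s_e)^{a_j}
    image : Mon nvars → Mon N
    image a = Vec.foldr _ _+ᵐ_ 0ᵐ
                (Vec.tabulate (λ j → Vec.map (Vec.lookup a j ℕ.*_) (χ (List.lookup (bases M) j))))

    φ : Pol nvars → Pol N
    φ = List.map (λ { (a , u) → (a , image u) })

    _∈J : Pol nvars → Set ℓ
    p ∈J = φ p ≈ₚ 0ₚ

    QuadraticPairs : Set
    QuadraticPairs = List (Mon nvars × Mon nvars)

    IsQuadratic : QuadraticPairs → Set
    IsQuadratic G = All (λ uv → deg (proj₁ uv) ≡ 2 × deg (proj₂ uv) ≡ 2) G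

    binoms : QuadraticPairs → List (Pol nvars)
    binoms = List.map (λ uv → binom (proj₁ uv) (proj₂ uv))

    InMQ : Set (c ⊔ ℓ)
    InMQ = ∃[ G ] (IsQuadratic G ×
                   (∀ p → (p ∈J → p ∈⟨ binoms G ⟩) × (p ∈⟨ binoms G ⟩ → p ∈J)))

    IsGroebner : MonomialOrder nvars → List (Pol nvars) → Set (c ⊔ ℓ)
    IsGroebner O G = All _∈J G ×
                     (∀ f → f ∈J → ∀ m → IsLeading O f m →
                        ∃[ g ] (g LM.∈ G × ∃[ m' ] (IsLeading O g m' × m' ∣ᵐ m)))

    InMQG : Set (lsuc Level.zero ⊔ c ⊔ ℓ)
    InMQG = ∃[ O ] ∃[ G ] (IsQuadratic G × IsGroebner O (binoms G))

-- A class 𝓒 of matroids is closed under series connections, parallel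
-- connections and 2-sums.  (Membership in the class includes being a
-- matroid, hence the IsMatroid components of the conclusions.)

ClosedUnderConnections : ∀ {p} → (∀ {N} → SetSystem N → Set p) → Set p
ClosedUnderConnections 𝓒 =
  ∀ {N} (M₁ M₂ : SetSystem N) (e : Fin N) →
  IsMatroid M₁ → IsMatroid M₂ → (E M₁ ∩ E M₂) ≡ ⁅ e ⁆ →
  𝓒 M₁ → 𝓒 M₂ →
  (IsMatroid (series M₁ M₂ e) × 𝓒 (series M₁ M₂ e)) ×
  (IsMatroid (parallel M₁ M₂ e) × 𝓒 (parallel M₁ M₂ e)) ×
  (¬ IsLoop M₁ e → ¬ IsColoop M₁ e → ¬ IsLoop M₂ e → ¬ IsColoop M₂ e →
     IsMatroid (twoSum M₁ M₂ e) × 𝓒 (twoSum M₁ M₂ e))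

-- Write u ∼ v if two monomials in the variables x_B have the same degree and the same image, and call the classes
-- fibres.  For a matroid of positive rank, the toric ideal is generated by quadrics iff every fibre is connected by
-- quadratic moves, and has a quadratic Gröbner basis for ≺ iff every monomial that is not least in its fibre is
-- divisible by the larger term x of a quadratic binomial x - y with x ∼ y.  (A matroid of rank 0 has the ideal (x - 1)
-- and lies in neither class, so ranks must be followed.)
--
-- Deletions, contractions, direct sums, series and parallel connections all have as bases the sets X with
-- χ(X) + κ χ(c) = χ(B) + χ(D), κ ∈ {0,1}, where (B , D) ranges over the pairs of bases allowed by a condition
-- t₁(B) ≤ t₂(D) on the membership of c.  As bases are equicardinal, u ∼ v iff both projections satisfy this, so that
-- the variables and fibres of the composite form a fibre product.  A quadratic move of a projection preserves the
-- multiset of values t, hence lifts.  Monomials with equal projections are connected by the swaps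
-- (B , D) (B′ , D′) → (B , D′) (B′ , D), which can be directed so as to sort the pairs and lower a weight.  The monomial
-- order compares the first projections, then the second ones, then the weights.
module Submission where

open import Defs
import Level
open import Data.Bool using (Bool; true; false; _∧_; _∨_; not; if_then_else_)
import Data.Bool.Properties as BoolP
open import Data.Nat using (ℕ; zero; suc; _+_; _*_; _∸_; _≤_; _<_; z≤n; s≤s)
open import Data.Nat.Properties as ℕP using (+-comm; +-assoc; +-identityʳ; +-cancelʳ-≡; +-cancelˡ-≡; +-0-commutativeMonoid; ≤-refl; ≤-trans)
open import Data.Nat.Tactic.RingSolver using (solve-∀)
open import Data.Fin using (Fin; zero; suc; toℕ)
import Data.Fin.Properties as FinP
open import Data.Fin.Subset as FS using (Subset; ⁅_⁆; _∪_; _∩_; _─_; _-_; _⊆_; _∈_; _∉_)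
import Data.Fin.Subset.Properties as FSP
open import Data.Bool.ListAction using (any; all)
open import Data.Vec as Vec using (Vec; []; _∷_; lookup; tabulate; replicate; zipWith)
import Data.Vec.Properties as VecP
open import Data.Vec.Relation.Binary.Pointwise.Inductive as PW using (Pointwise; []; _∷_)
open import Data.List as List using (List; []; _∷_; _++_)
open import Data.List.Membership.Propositional as LM using ()
import Data.List.Membership.Propositional.Properties as LMP
open import Data.List.Relation.Unary.All as All using (All; []; _∷_)
open import Data.List.Relation.Unary.Any as Any using (Any; here; there)
import Data.List.Relation.Unary.Any.Properties as AnyP
import Data.List.Relation.Unary.All.Properties as AllP
import Data.List.Properties as ListP
import Algebra.Properties.Ring
import Relation.Binary.Reasoning.Setoid
open import Data.List.Relation.Unary.Unique.Propositional using (Unique; []; _∷_)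
import Data.List.Relation.Unary.Unique.Propositional.Properties as UniqueP
open import Data.Product using (Σ; ∃; ∃-syntax; _×_; _,_; proj₁; proj₂)
open import Data.Sum as Sum using (_⊎_; inj₁; inj₂; [_,_]′)
open import Data.Empty using (⊥; ⊥-elim)
open import Function using (_∘_; id)
import Function
open import Relation.Nullary using (¬_; Dec; yes; no; contradiction)
open import Relation.Nullary.Decidable using (⌊_⌋; _×-dec_)
open import Relation.Binary.Core using (Rel)
open import Relation.Binary.Definitions using (Tri; tri<; tri≈; tri>)
open import Relation.Binary.Structures using (IsStrictTotalOrder)
open import Relation.Binary.Structures.Biased using (isStrictTotalOrderᶜ)
open import Relation.Binary.PropositionalEquality
import Relation.Binary.Construct.Closure.ReflexiveTransitive as Star
open import Relation.Binary.Construct.Closure.ReflexiveTransitive using (Star; ε; _◅_; _◅◅_; gmap)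
open import Algebra.Bundles using (CommutativeMonoid)
import Algebra.Properties.CommutativeMonoid.Sum +-0-commutativeMonoid as ∑

-- Monomials

-- The pairs with `t₁ i ≤ t₂ j` fill a table except for one rectangle, marked rows against unmarked
-- columns. Once this rectangle is moved to the corner of last rows and last columns, the allowed
-- cells form a down-set: if two of them are ordered strictly in both directions, the other two
-- corners of their rectangle are allowed as well. The opposite replacement may leave the table, so
-- sorting has only one possible direction. For a minor, the second factor is the matroid whose only
-- basis is empty. It has rank 0 and lies outside both classes, so closure is proved for two
-- fibrewise properties that it does have, and a lower bound on the rank travels beside them. The
-- shared element c is the one place where ground sets do not separate the factors. The equation at
-- c gives only a sum there, and the share of each factor is recovered from a total: a basis, or the
-- image of a monomial of known degree, is determined at c by its values elsewhere.

Mon : ℕ → Set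
Mon = Vec ℕ

infixl 6 _⊞_

_⊞_ : ∀ {n} → Mon n → Mon n → Mon n
_⊞_ = zipWith _+_

𝟎 : ∀ {n} → Mon n
𝟎 = replicate _ 0

⊞-commutativeMonoid : ℕ → CommutativeMonoid _ _
⊞-commutativeMonoid n = record
  { Carrier = Mon n ; _≈_ = _≡_ ; _∙_ = _⊞_ ; ε = 𝟎
  ; isCommutativeMonoid = record
    { isMonoid = record
      { isSemigroup = record
        { isMagma = record { isEquivalence = isEquivalence ; ∙-cong = cong₂ _⊞_ }
        ; assoc = VecP.zipWith-assoc +-assoc }
      ; identity = VecP.zipWith-identityˡ (λ _ → refl) , VecP.zipWith-identityʳ +-identityʳ }
    ; comm = VecP.zipWith-comm +-comm } }

module _ {n : ℕ} where
  open CommutativeMonoid (⊞-commutativeMonoid n) public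
    using () renaming (assoc to ⊞-assoc; comm to ⊞-comm; identityˡ to ⊞-identityˡ; identityʳ to ⊞-identityʳ)

lookup-ext : ∀ {A : Set} {n} {u v : Vec A n} → (∀ i → lookup u i ≡ lookup v i) → u ≡ v
lookup-ext {u = u} {v} h =
  trans (sym (VecP.tabulate∘lookup u)) (trans (VecP.tabulate-cong h) (VecP.tabulate∘lookup v))

lookup-⊞ : ∀ {n} i (u v : Mon n) → lookup (u ⊞ v) i ≡ lookup u i + lookup v i
lookup-⊞ = VecP.lookup-zipWith _+_

⊞-cancelʳ : ∀ {n} (w : Mon n) {u v} → u ⊞ w ≡ v ⊞ w → u ≡ v
⊞-cancelʳ w {u} {v} h = lookup-ext λ i → +-cancelʳ-≡ (lookup w i) _ _
  (trans (sym (lookup-⊞ i u w)) (trans (cong (λ z → lookup z i) h) (lookup-⊞ i v w)))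

unit : ∀ {n} → Fin n → Mon n
unit zero    = 1 ∷ 𝟎
unit (suc i) = 0 ∷ unit i

δ : ∀ {n} → Fin n → Fin n → ℕ
δ i j = lookup (unit i) j

δ-same : ∀ {n} (i : Fin n) → δ i i ≡ 1
δ-same zero    = refl
δ-same (suc i) = δ-same i

δ-diff : ∀ {n} {i j : Fin n} → i ≢ j → δ i j ≡ 0
δ-diff {i = zero}  {zero}  h = ⊥-elim (h refl)
δ-diff {i = zero}  {suc j} h = VecP.lookup-replicate j 0
δ-diff {i = suc i} {zero}  h = refl
δ-diff {i = suc i} {suc j} h = δ-diff (h ∘ cong suc)

δ≢0⇒≡ : ∀ {n} {i j : Fin n} → δ i j ≢ 0 → i ≡ j
δ≢0⇒≡ {i = i} {j} h with i FinP.≟ j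
... | yes p = p
... | no ¬p = ⊥-elim (h (δ-diff ¬p))

-- The additive extension of `f` from variables to monomials. Degree, exponents of a projection,
-- multiplicities of ground elements and the sorting weight are all of this form.
wt : ∀ {n} → (Fin n → ℕ) → Mon n → ℕ
wt f u = ∑.sum (λ i → lookup u i * f i)

wt-⊞ : ∀ {n} (f : Fin n → ℕ) u v → wt f (u ⊞ v) ≡ wt f u + wt f v
wt-⊞ f u v = trans
  (∑.sum-cong-≗ λ i → trans (cong (_* f i) (lookup-⊞ i u v)) (ℕP.*-distribʳ-+ (f i) (lookup u i) _))
  (∑.∑-distrib-+ (λ i → lookup u i * f i) _)

wt-cong : ∀ {n} {f g : Fin n → ℕ} → (∀ i → f i ≡ g i) → ∀ u → wt f u ≡ wt g u
wt-cong h u = ∑.sum-cong-≗ λ i → cong (lookup u i *_) (h i)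

wt-𝟎 : ∀ {n} (f : Fin n → ℕ) → wt f 𝟎 ≡ 0
wt-𝟎 {zero}  f = refl
wt-𝟎 {suc n} f = wt-𝟎 (f ∘ suc)

wt-unit : ∀ {n} (f : Fin n → ℕ) i → wt f (unit i) ≡ f i
wt-unit f zero    = trans (cong₂ _+_ (+-identityʳ (f zero)) (wt-𝟎 (f ∘ suc))) (+-identityʳ _)
wt-unit f (suc i) = wt-unit (f ∘ suc) i

wt-units : ∀ {n} (f : Fin n → ℕ) i j → wt f (unit i ⊞ unit j) ≡ f i + f j
wt-units f i j = trans (wt-⊞ f (unit i) (unit j)) (cong₂ _+_ (wt-unit f i) (wt-unit f j))

-- A nonzero sum has a nonzero summand. With `f` constant 1 this peels off some variable; with `f`
-- an indicator it peels off a variable lying over a prescribed one.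
wt-pos : ∀ {n} (f : Fin n → ℕ) u → wt f u ≢ 0 → ∃[ a ] ∃[ i ] (u ≡ a ⊞ unit i × f i ≢ 0)
wt-pos f [] h = ⊥-elim (h refl)
wt-pos f (x ∷ u) h with x * f zero in eq
... | zero  = let a , i , e , fi = wt-pos (f ∘ suc) u h in
  x ∷ a , suc i , cong₂ _∷_ (sym (+-identityʳ x)) e , fi
wt-pos f (suc x ∷ u) h | suc m =
  x ∷ u , zero , cong₂ _∷_ (+-comm 1 x) (sym (⊞-identityʳ u)) ,
  λ z → contradiction (trans (sym eq) (trans (cong (suc x *_) z) (ℕP.*-zeroʳ (suc x)))) λ ()

deg : ∀ {n} → Mon n → ℕ
deg = wt λ _ → 1

deg≡sum : ∀ {n} (u : Mon n) → deg u ≡ Vec.sum u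
deg≡sum []      = refl
deg≡sum (x ∷ u) = cong₂ _+_ (ℕP.*-identityʳ x) (deg≡sum u)

deg-pos : ∀ {n d} (u : Mon n) → deg u ≡ suc d → ∃[ a ] ∃[ i ] (u ≡ a ⊞ unit i × deg a ≡ d)
deg-pos u h with wt-pos _ u (λ z → contradiction (trans (sym h) z) λ ())
... | a , i , refl , _ = a , i , refl ,
  +-cancelʳ-≡ 1 _ _ (trans (sym (trans (wt-⊞ _ a (unit i)) (cong (deg a +_) (wt-unit _ i))))
                       (trans h (+-comm 1 _)))

deg-zero : ∀ {n} (u : Mon n) → deg u ≡ 0 → u ≡ 𝟎
deg-zero []         h = refl
deg-zero (zero ∷ u) h = cong (0 ∷_) (deg-zero u h)

deg-two : ∀ {n} (u : Mon n) → deg u ≡ 2 → ∃[ i ] ∃[ j ] u ≡ unit i ⊞ unit j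
deg-two u h with deg-pos u h
... | a , j , refl , h₁ with deg-pos a h₁
... | b , i , refl , h₀ with deg-zero b h₀
... | refl = i , j , cong (_⊞ unit j) (⊞-identityˡ (unit i))

contains : ∀ {n} (u : Mon n) i → lookup u i ≢ 0 → ∃[ a ] u ≡ a ⊞ unit i
contains (zero ∷ u)  zero    h = ⊥-elim (h refl)
contains (suc x ∷ u) zero    h = x ∷ u , cong₂ _∷_ (+-comm 1 x) (sym (⊞-identityʳ u))
contains (x ∷ u)     (suc i) h =
  let a , e = contains u i h in x ∷ a , cong₂ _∷_ (sym (+-identityʳ x)) e

mon-ind : ∀ {p n} (P : Mon n → Set p) → P 𝟎 → (∀ u i → P u → P (u ⊞ unit i)) → ∀ u → P u
mon-ind P p₀ p₊ u = go _ u refl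
  where
  go : ∀ d u → deg u ≡ d → P u
  go zero    u h = subst P (sym (deg-zero u h)) p₀
  go (suc d) u h with deg-pos u h
  ... | a , i , refl , h′ = p₊ a i (go d a h′)

-- Exponents after the substitution that sends the variable `k` to the variable `p k`.
push : ∀ {n m} → (Fin n → Fin m) → Mon n → Mon m
push p u = tabulate λ i → wt (λ k → δ (p k) i) u

module _ {n m} (p : Fin n → Fin m) where
  private
    lookup-push : ∀ u i → lookup (push p u) i ≡ wt (λ k → δ (p k) i) u
    lookup-push u = VecP.lookup∘tabulate (λ i → wt (λ k → δ (p k) i) u)

  push-⊞ : ∀ u v → push p (u ⊞ v) ≡ push p u ⊞ push p v
  push-⊞ u v = lookup-ext λ i → begin
    lookup (push p (u ⊞ v)) i                ≡⟨ lookup-push (u ⊞ v) i ⟩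
    wt (λ k → δ (p k) i) (u ⊞ v)             ≡⟨ wt-⊞ _ u v ⟩
    wt _ u + wt _ v                          ≡⟨ cong₂ _+_ (lookup-push u i) (lookup-push v i) ⟨
    lookup (push p u) i + lookup (push p v) i ≡⟨ lookup-⊞ i (push p u) _ ⟨
    lookup (push p u ⊞ push p v) i           ∎
    where open ≡-Reasoning

  push-unit : ∀ k → push p (unit k) ≡ unit (p k)
  push-unit k = lookup-ext λ i → trans (lookup-push (unit k) i) (wt-unit _ k)

  push-units : ∀ k l → push p (unit k ⊞ unit l) ≡ unit (p k) ⊞ unit (p l)
  push-units k l = trans (push-⊞ (unit k) (unit l)) (cong₂ _⊞_ (push-unit k) (push-unit l))

  push-𝟎 : push p 𝟎 ≡ 𝟎
  push-𝟎 = lookup-ext λ i → trans (lookup-push 𝟎 i) (trans (wt-𝟎 (λ k → δ (p k) i)) (sym (VecP.lookup-replicate i 0)))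

  push-⊞unit : ∀ u k → push p (u ⊞ unit k) ≡ push p u ⊞ unit (p k)
  push-⊞unit u k = trans (push-⊞ u (unit k)) (cong (push p u ⊞_) (push-unit k))

  wt-push : ∀ f u → wt f (push p u) ≡ wt (f ∘ p) u
  wt-push f = mon-ind _ (trans (cong (wt f) push-𝟎) (trans (wt-𝟎 f) (sym (wt-𝟎 (f ∘ p)))))
    λ u i ih → begin
      wt f (push p (u ⊞ unit i))          ≡⟨ cong (wt f) (push-⊞unit u i) ⟩
      wt f (push p u ⊞ unit (p i))        ≡⟨ wt-⊞ f (push p u) _ ⟩
      wt f (push p u) + wt f (unit (p i)) ≡⟨ cong₂ _+_ ih (trans (wt-unit f (p i)) (sym (wt-unit (f ∘ p) i))) ⟩
      wt (f ∘ p) u + wt (f ∘ p) (unit i)  ≡⟨ wt-⊞ (f ∘ p) u (unit i) ⟨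
      wt (f ∘ p) (u ⊞ unit i)             ∎
    where open ≡-Reasoning

  deg-push : ∀ u → deg (push p u) ≡ deg u
  deg-push = wt-push _

  -- The exponent of `i` downstairs counts the factors lying over `i`, so a factor of the projection
  -- comes from a factor of `u`.
  push-contains : ∀ u {a i} → push p u ≡ a ⊞ unit i → ∃[ b ] ∃[ k ] (u ≡ b ⊞ unit k × p k ≡ i × push p b ≡ a)
  push-contains u {a} {i} h with wt-pos (λ k → δ (p k) i) u pos
    where
    pos : wt (λ k → δ (p k) i) u ≢ 0
    pos z = contradiction
      (begin
        0                                   ≡⟨ z ⟨
        wt (λ k → δ (p k) i) u              ≡⟨ lookup-push u i ⟨
        lookup (push p u) i                 ≡⟨ cong (λ w → lookup w i) h ⟩
        lookup (a ⊞ unit i) i               ≡⟨ lookup-⊞ i a _ ⟩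
        lookup a i + δ i i                  ≡⟨ cong (lookup a i +_) (δ-same i) ⟩
        lookup a i + 1                      ≡⟨ +-comm _ 1 ⟩
        suc (lookup a i)                    ∎) λ ()
      where open ≡-Reasoning
  ... | b , k , refl , d with δ≢0⇒≡ {i = p k} {i} d
  ... | refl = b , k , refl , refl , ⊞-cancelʳ (unit (p k)) (trans (sym (push-⊞unit b k)) h)

-- Quadratic moves on fibre products

-- The shapes of `u` and `v` are equations rather than indices because `_⊞_` is not a constructor
-- and unification against it gets stuck.
data Move {n} (R : Rel (Mon n) Level.zero) : Rel (Mon n) Level.zero where
  move : ∀ a i i′ k k′ → R (unit i ⊞ unit i′) (unit k ⊞ unit k′) →
         ∀ {u v} → u ≡ a ⊞ (unit i ⊞ unit i′) → v ≡ a ⊞ (unit k ⊞ unit k′) → Move R u v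

data Reducible {n} (_≺_ R : Rel (Mon n) Level.zero) : Mon n → Set where
  reduce : ∀ a i i′ k k′ → R (unit i ⊞ unit i′) (unit k ⊞ unit k′) →
           (unit k ⊞ unit k′) ≺ (unit i ⊞ unit i′) →
           ∀ {u} → u ≡ a ⊞ (unit i ⊞ unit i′) → Reducible _≺_ R u

QuadraticallyConnected : ∀ {n} → Rel (Mon n) Level.zero → Set
QuadraticallyConnected R = ∀ u v → R u v → Star (Move R) u v

-- Stated for one projection and an abstract set `Ok` of allowed pairs, so that the same argument
-- serves the second projection with the roles exchanged.
module Lift {n n₁ n₂} (p₁ : Fin n → Fin n₁) (p₂ : Fin n → Fin n₂)
  (Ok : Fin n₁ → Fin n₂ → Set)
  (ok : ∀ k → Ok (p₁ k) (p₂ k))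
  (pair : ∀ i j → Ok i j → ∃[ k ] (p₁ k ≡ i × p₂ k ≡ j))
  (t : Fin n₁ → Bool)
  (resp : ∀ {i k j} → t i ≡ t k → Ok i j → Ok k j)
  (R₁ : Rel (Mon n₁) Level.zero)
  (match : ∀ {i i′ k k′} → R₁ (unit i ⊞ unit i′) (unit k ⊞ unit k′) →
           (t i ≡ t k × t i′ ≡ t k′) ⊎ (t i ≡ t k′ × t i′ ≡ t k))
  where

  -- The second components `p₂ x`, `p₂ x′` are kept and the first ones replaced by `k`, `k′`. By
  -- `match` this can be arranged so that each first component keeps its mark, and `resp` then makes
  -- the new pairs allowed.
  lift : ∀ u {a i i′ k k′} → R₁ (unit i ⊞ unit i′) (unit k ⊞ unit k′) →
    push p₁ u ≡ a ⊞ (unit i ⊞ unit i′) →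
    ∃[ b ] ∃[ x ] ∃[ x′ ] ∃[ y ] ∃[ y′ ]
      (u ≡ b ⊞ (unit x ⊞ unit x′) × push p₁ b ≡ a ×
       push p₁ (unit x ⊞ unit x′) ≡ unit i ⊞ unit i′ ×
       push p₁ (unit y ⊞ unit y′) ≡ unit k ⊞ unit k′ ×
       push p₂ (unit y ⊞ unit y′) ≡ push p₂ (unit x ⊞ unit x′))
  lift u {a} {i} {i′} {k} {k′} r h
    with push-contains p₁ u (trans h (sym (⊞-assoc a (unit i) (unit i′))))
  ... | b₁ , x′ , refl , refl , h₁ with push-contains p₁ b₁ h₁
  ... | b , x , refl , refl , h₀ = found (match r)
    where
    found : (t i ≡ t k × t i′ ≡ t k′) ⊎ (t i ≡ t k′ × t i′ ≡ t k) → _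
    found (inj₁ (e , e′)) with pair k (p₂ x) (resp e (ok x)) | pair k′ (p₂ x′) (resp e′ (ok x′))
    ... | y , y₁ , y₂ | y′ , y₁′ , y₂′ =
      b , x , x′ , y , y′ , ⊞-assoc b _ _ , h₀ , push-units p₁ x x′ ,
      trans (push-units p₁ y y′) (cong₂ (λ l l′ → unit l ⊞ unit l′) y₁ y₁′) ,
      trans (push-units p₂ y y′) (trans (cong₂ (λ l l′ → unit l ⊞ unit l′) y₂ y₂′) (sym (push-units p₂ x x′)))
    -- The marks match crosswise, so `k′` goes with `x` and `k` with `x′`; the second projections
    -- agree only after commuting the two factors.
    found (inj₂ (e , e′)) with pair k′ (p₂ x) (resp e (ok x)) | pair k (p₂ x′) (resp e′ (ok x′))
    ... | y′ , y₁′ , y₂′ | y , y₁ , y₂ =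
      b , x , x′ , y , y′ , ⊞-assoc b _ _ , h₀ , push-units p₁ x x′ ,
      trans (push-units p₁ y y′) (cong₂ (λ l l′ → unit l ⊞ unit l′) y₁ y₁′) ,
      trans (push-units p₂ y y′) (trans (cong₂ (λ l l′ → unit l ⊞ unit l′) y₂ y₂′)
        (trans (⊞-comm (unit (p₂ x′)) _) (sym (push-units p₂ x x′))))

  module _ {R : Rel (Mon n) Level.zero}
    (glue : ∀ {u v} → R₁ (push p₁ u) (push p₁ v) → push p₂ v ≡ push p₂ u → R u v) where

    lift-star : ∀ u {w w′} → push p₁ u ≡ w → Star (Move R₁) w w′ →
      ∃[ v ] (Star (Move R) u v × push p₁ v ≡ w′ × push p₂ v ≡ push p₂ u)
    lift-star u h ε = u , ε , h , refl
    lift-star u h (move a i i′ k k′ r refl refl ◅ ms) =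
      let b , x , x′ , y , y′ , eu , eb , ex , ey , e₂ = lift u r h
          v = b ⊞ (unit y ⊞ unit y′)
          v′ , ms′ , h₁ , h₂ = lift-star v (trans (push-⊞ p₁ b _) (cong₂ _⊞_ eb ey)) ms
      in v′ , move b x x′ y y′ (glue (subst₂ R₁ (sym ex) (sym ey) r) e₂) eu refl ◅ ms′ , h₁ ,
         trans h₂ (trans (push-⊞ p₂ b _) (trans (cong (push p₂ b ⊞_) e₂)
           (trans (sym (push-⊞ p₂ b _)) (cong (push p₂) (sym eu)))))

    -- The lifted quadrics have equal second projections, so a drop in the first projection is a
    -- drop upstairs as soon as `_≺_` follows `_≺₁_` on such monomials.
    lift-reducible : ∀ {_≺₁_ _≺_} →
      (∀ {u v} → push p₁ u ≺₁ push p₁ v → push p₂ u ≡ push p₂ v → u ≺ v) →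
      ∀ u → Reducible _≺₁_ R₁ (push p₁ u) → Reducible _≺_ R u
    lift-reducible {_≺₁_} mono u (reduce a i i′ k k′ r lt h) =
      let b , x , x′ , y , y′ , eu , eb , ex , ey , e₂ = lift u r h
      in reduce b x x′ y y′ (glue (subst₂ R₁ (sym ex) (sym ey) r) e₂)
           (mono (subst₂ _≺₁_ (sym ey) (sym ex) lt) e₂) eu

-- Sorting monomials with given marginals by swaps

Optimal : ∀ {n} → Rel (Fin n) Level.zero → Mon n → Fin n → Set
Optimal _≲_ u i = lookup u i ≢ 0 × ∀ j → lookup u j ≢ 0 → i ≲ j

module _ {n} (_≲_ : Rel (Fin n) Level.zero) (total : ∀ i j → i ≲ j ⊎ j ≲ i)
  (≲-trans : ∀ {i j k} → i ≲ j → j ≲ k → i ≲ k) where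

  optimal : ∀ (u : Mon n) → u ≢ 𝟎 → ∃ (Optimal _≲_ u)
  optimal = mon-ind _ (λ h → ⊥-elim (h refl)) λ u i ih _ → extend u i ih
    where
    support : ∀ u i j → lookup (u ⊞ unit i) j ≢ 0 → lookup u j ≢ 0 ⊎ i ≡ j
    support u i j h with i FinP.≟ j
    ... | yes p = inj₂ p
    ... | no ¬p = inj₁ λ z → h (trans (lookup-⊞ j u (unit i)) (cong₂ _+_ z (δ-diff ¬p)))
    supportˡ : ∀ u i j → lookup u j ≢ 0 → lookup (u ⊞ unit i) j ≢ 0
    supportˡ u i j h z = h (ℕP.m+n≡0⇒m≡0 _ (trans (sym (lookup-⊞ j u (unit i))) z))
    supportʳ : ∀ u i → lookup (u ⊞ unit i) i ≢ 0
    supportʳ u i z = contradiction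
      (trans (sym (δ-same i)) (ℕP.m+n≡0⇒n≡0 (lookup u i) (trans (sym (lookup-⊞ i u (unit i))) z))) λ ()
    ≲-refl : ∀ i → i ≲ i
    ≲-refl i = [ id , id ]′ (total i i)
    extend : ∀ u i → (u ≢ 𝟎 → ∃ (Optimal _≲_ u)) → ∃ (Optimal _≲_ (u ⊞ unit i))
    extend u i ih with VecP.≡-dec ℕP._≟_ u 𝟎
    ... | yes refl = i , supportʳ 𝟎 i , λ j h →
      [ (λ z → ⊥-elim (z (VecP.lookup-replicate j 0))) , (λ { refl → ≲-refl i }) ]′ (support 𝟎 i j h)
    ... | no u≢𝟎 with ih u≢𝟎
    ... | m , m∈ , least with total i m
    ... | inj₁ i≲m = i , supportʳ u i , λ j h →
      [ (λ z → ≲-trans i≲m (least j z)) , (λ { refl → ≲-refl i }) ]′ (support u i j h)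
    ... | inj₂ m≲i = m , supportˡ u i m m∈ , λ j h →
      [ least j , (λ { refl → m≲i }) ]′ (support u i j h)

-- Position in a list that puts the indices with `t` false first. The offset `n` exceeds every
-- `toℕ j`, which makes positions injective and the mark monotone in them.
rank : ∀ {n} → (Fin n → Bool) → Fin n → ℕ
rank {n} t i = if t i then n + toℕ i else toℕ i

rank-mono : ∀ {n} (t : Fin n → Bool) i j → rank t i ≤ rank t j → t i ≡ true → t j ≡ true
rank-mono {n} t i j h ti with t i | t j
... | true  | true  = refl
... | true  | false = ⊥-elim (ℕP.<⇒≱ (FinP.toℕ<n j) (ℕP.m+n≤o⇒m≤o n h))
rank-mono t i j h () | false | _

rank-not-anti : ∀ {n} (t : Fin n → Bool) i j → rank (not ∘ t) i ≤ rank (not ∘ t) j → t j ≡ true → t i ≡ true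
rank-not-anti t i j h tj = BoolP.¬-not λ ti →
  contradiction (trans (sym (rank-mono (not ∘ t) i j h (cong not ti))) (cong not tj)) λ ()

rank-inj : ∀ {n} (t : Fin n → Bool) i j → rank t i ≡ rank t j → i ≡ j
rank-inj {n} t i j h with t i | t j
... | true  | true  = FinP.toℕ-injective (+-cancelˡ-≡ n _ _ h)
... | false | false = FinP.toℕ-injective h
... | true  | false = ⊥-elim (ℕP.<⇒≱ (FinP.toℕ<n j) (ℕP.m+n≤o⇒m≤o n (ℕP.≤-reflexive h)))
... | false | true  = ⊥-elim (ℕP.<⇒≱ (FinP.toℕ<n i) (ℕP.m+n≤o⇒m≤o n (ℕP.≤-reflexive (sym h))))

rank-≤⇒≡⊎< : ∀ {n} (t : Fin n → Bool) i j → rank t i ≤ rank t j → i ≡ j ⊎ rank t i < rank t j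
rank-≤⇒≡⊎< t i j h with ℕP.m≤n⇒m<n∨m≡n h
... | inj₁ lt = inj₂ lt
... | inj₂ eq = inj₁ (rank-inj t i j eq)

-- The sides differ by `(c - a) * (d - b)`, which becomes `(1 + m) * (1 + n)` once the strict
-- inequalities are written with explicit gaps.
rearrangement : ∀ {a b c d} → a < c → b < d → a * d + c * b < a * b + c * d
rearrangement {a} {b} {c} {d} a<c b<d with ℕP.m≤n⇒∃[o]m+o≡n a<c | ℕP.m≤n⇒∃[o]m+o≡n b<d
... | m , refl | n , refl =
  subst (suc (a * (suc b + n) + (suc a + m) * b) ≤_) (sym (identity a b m n)) (ℕP.m≤m+n _ _)
  where
  identity : ∀ a b m n → a * b + (suc a + m) * (suc b + n)
                       ≡ suc (a * (suc b + n) + (suc a + m) * b) + (m + n + m * n)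
  identity = solve-∀

-- The last three fields make `k` ↦ (`p₁ k` , `p₂ k`) a bijection onto the allowed cells of an `n₁`
-- by `n₂` table. The forbidden cells are those in a marked row and an unmarked column.
record Gluing (n n₁ n₂ : ℕ) : Set where
  field
    p₁ : Fin n → Fin n₁
    p₂ : Fin n → Fin n₂
    t₁ : Fin n₁ → Bool
    t₂ : Fin n₂ → Bool
    compatible : ∀ k → t₁ (p₁ k) ≡ true → t₂ (p₂ k) ≡ true
    pair : ∀ i j → (t₁ i ≡ true → t₂ j ≡ true) → ∃[ k ] (p₁ k ≡ i × p₂ k ≡ j)
    joint-inj : ∀ k l → p₁ k ≡ p₁ l → p₂ k ≡ p₂ l → k ≡ l

module SameMarginals {n n₁ n₂} (G : Gluing n n₁ n₂) where
  open Gluing G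

  -- Marked rows come last and unmarked columns last, so that sorting two pairs keeps them compatible; sorted
  -- means that large s₁ is paired with small s₂, which minimises the weight.
  s₁ : Fin n₁ → ℕ
  s₁ = rank t₁

  s₂ : Fin n₂ → ℕ
  s₂ = rank (not ∘ t₂)

  weight : Fin n → ℕ
  weight k = s₁ (p₁ k) * s₂ (p₂ k)

  -- A monomial is a contingency table on the allowed cells, and its two projections are the row and
  -- column sums.
  record SameMarginals (u v : Mon n) : Set where
    constructor marginals
    field
      first  : push p₁ u ≡ push p₁ v
      second : push p₂ u ≡ push p₂ v

  -- A swap is recorded by its effects on the quadratic parts, equal marginals and a strict drop of
  -- weight, instead of the rectangle it came from; connectedness and minimality are argued from
  -- these effects.
  data Swap : Rel (Mon n) Level.zero where
    swapping : ∀ b x y x′ y′ →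
      SameMarginals (unit x ⊞ unit y) (unit x′ ⊞ unit y′) →
      wt weight (unit x′ ⊞ unit y′) < wt weight (unit x ⊞ unit y) →
      ∀ {u v} → u ≡ b ⊞ (unit x ⊞ unit y) → v ≡ b ⊞ (unit x′ ⊞ unit y′) → Swap u v

  SameMarginals-⊞ : ∀ b {u v} → SameMarginals u v → SameMarginals (b ⊞ u) (b ⊞ v)
  SameMarginals-⊞ b {u} {v} (marginals e₁ e₂) = marginals (cong-⊞ p₁ e₁) (cong-⊞ p₂ e₂)
    where
    cong-⊞ : ∀ {m} (p : Fin n → Fin m) → push p u ≡ push p v → push p (b ⊞ u) ≡ push p (b ⊞ v)
    cong-⊞ p e = trans (push-⊞ p b u) (trans (cong (push p b ⊞_) e) (sym (push-⊞ p b v)))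

  Swap⇒SameMarginals : ∀ {u v} → Swap u v → SameMarginals u v
  Swap⇒SameMarginals (swapping b _ _ _ _ same _ refl refl) = SameMarginals-⊞ b same

  Swap⇒wt< : ∀ {u v} → Swap u v → wt weight v < wt weight u
  Swap⇒wt< (swapping b _ _ _ _ _ lt refl refl) =
    subst₂ _<_ (sym (wt-⊞ weight b _)) (sym (wt-⊞ weight b _)) (ℕP.+-monoʳ-< (wt weight b) lt)

  Swap-⊞ : ∀ w {u v} → Swap u v → Swap (u ⊞ w) (v ⊞ w)
  Swap-⊞ w (swapping b x y x′ y′ same lt refl refl) =
    swapping (b ⊞ w) x y x′ y′ same lt (right-comm b _ w) (right-comm b _ w)
    where
    right-comm : ∀ a b c → a ⊞ b ⊞ c ≡ a ⊞ c ⊞ b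
    right-comm a b c = trans (⊞-assoc a b c) (trans (cong (a ⊞_) (⊞-comm b c)) (sym (⊞-assoc a c b)))

  -- `x` and `y` are opposite corners of a rectangle, `y` being later in both orders. Allowed cells
  -- are closed downwards, so the other two corners are allowed because `y` is; the rearrangement
  -- inequality gives the drop of weight.
  swap : ∀ b x y → s₁ (p₁ x) < s₁ (p₁ y) → s₂ (p₂ x) < s₂ (p₂ y) →
    ∃[ x′ ] ∃[ y′ ] (p₁ x′ ≡ p₁ x × p₂ x′ ≡ p₂ y × Swap (b ⊞ (unit x ⊞ unit y)) (b ⊞ (unit x′ ⊞ unit y′)))
  swap b x y lt₁ lt₂ = swapped (pair (p₁ x) (p₂ y) ok-x) (pair (p₁ y) (p₂ x) ok-y)
    where
    ok-x : t₁ (p₁ x) ≡ true → t₂ (p₂ y) ≡ true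
    ok-x h = compatible y (rank-mono t₁ _ _ (ℕP.<⇒≤ lt₁) h)
    ok-y : t₁ (p₁ y) ≡ true → t₂ (p₂ x) ≡ true
    ok-y h = rank-not-anti t₂ _ _ (ℕP.<⇒≤ lt₂) (compatible y h)
    swapped : ∃[ k ] (p₁ k ≡ p₁ x × p₂ k ≡ p₂ y) → ∃[ k ] (p₁ k ≡ p₁ y × p₂ k ≡ p₂ x) → _
    swapped (x′ , e₁ , e₂) (y′ , e₁′ , e₂′) = x′ , y′ , e₁ , e₂ , swapping b x y x′ y′
      (marginals
        (trans (push-units p₁ x y) (sym (trans (push-units p₁ x′ y′) (cong₂ (λ l l′ → unit l ⊞ unit l′) e₁ e₁′))))
        (trans (push-units p₂ x y) (trans (⊞-comm (unit (p₂ x)) _)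
          (sym (trans (push-units p₂ x′ y′) (cong₂ (λ l l′ → unit l ⊞ unit l′) e₂ e₂′))))))
      (subst₂ _<_ (sym (trans (wt-units weight x′ y′)
                   (cong₂ _+_ (cong₂ (λ k l → s₁ k * s₂ l) e₁ e₂) (cong₂ (λ k l → s₁ k * s₂ l) e₁′ e₂′))))
                 (sym (wt-units weight x y)) (rearrangement lt₁ lt₂))
      refl refl

  _≼₁_ : Rel (Fin n₁) Level.zero
  i ≼₁ j = s₁ i ≤ s₁ j

  _≽₂_ : Rel (Fin n₂) Level.zero
  i ≽₂ j = s₂ j ≤ s₂ i

  -- The target cell lies in the first row and the last column that occur. Take a factor `k` in that
  -- row and a factor `l` in that column: if they share a row or a column, one of them is the
  -- target; otherwise `k` precedes `l` in both orders and one swap creates it.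
  front : ∀ u {i j} → Optimal _≼₁_ (push p₁ u) i → Optimal _≽₂_ (push p₂ u) j →
    ∃[ k ] ∃[ c ] (p₁ k ≡ i × p₂ k ≡ j × (u ≡ c ⊞ unit k ⊎ Swap u (c ⊞ unit k)))
  front u {i} {j} (i∈ , i-min) (j∈ , j-max)
    with contains (push p₁ u) i i∈
  ... | _ , e₁ with push-contains p₁ u e₁
  ... | b , k , refl , refl , _ with contains (push p₂ (b ⊞ unit k)) j j∈
  ... | _ , e₂ with push-contains p₂ (b ⊞ unit k) e₂
  ... | b′ , l , e , refl , _ = go (rank-≤⇒≡⊎< t₁ (p₁ k) (p₁ l) (i-min (p₁ l) (occurs p₁ (b′ , e))))
                                   (rank-≤⇒≡⊎< (not ∘ t₂) (p₂ k) (p₂ l) (j-max (p₂ k) (occurs p₂ (b , refl))))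
    where
    occurs : ∀ {m} (p : Fin n → Fin m) {k u} → ∃[ b ] (u ≡ b ⊞ unit k) → lookup (push p u) (p k) ≢ 0
    occurs p {k} (b , refl) z = contradiction (trans (sym (δ-same (p k)))
      (ℕP.m+n≡0⇒n≡0 (lookup (push p b) (p k)) (trans (sym (lookup-⊞ (p k) (push p b) (unit (p k))))
        (trans (cong (λ w → lookup w (p k)) (sym (push-⊞unit p b k))) z)))) λ ()
    rest : k ≢ l → ∃[ c ] b′ ≡ c ⊞ unit k
    rest k≢l = contains b′ k λ z → contradiction
      (begin
        0                      ≡⟨ cong₂ _+_ z (δ-diff (k≢l ∘ sym)) ⟨
        lookup b′ k + δ l k    ≡⟨ lookup-⊞ k b′ (unit l) ⟨
        lookup (b′ ⊞ unit l) k ≡⟨ cong (λ w → lookup w k) e ⟨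
        lookup (b ⊞ unit k) k  ≡⟨ lookup-⊞ k b (unit k) ⟩
        lookup b k + δ k k     ≡⟨ cong (lookup b k +_) (δ-same k) ⟩
        lookup b k + 1         ≡⟨ +-comm _ 1 ⟩
        suc (lookup b k)       ∎) λ ()
      where open ≡-Reasoning
    go : p₁ k ≡ p₁ l ⊎ s₁ (p₁ k) < s₁ (p₁ l) → p₂ k ≡ p₂ l ⊎ s₂ (p₂ k) < s₂ (p₂ l) →
      ∃[ m ] ∃[ c ] (p₁ m ≡ p₁ k × p₂ m ≡ p₂ l × (b ⊞ unit k ≡ c ⊞ unit m ⊎ Swap (b ⊞ unit k) (c ⊞ unit m)))
    go (inj₁ e₁) _         = l , b′ , sym e₁ , refl , inj₁ e
    go (inj₂ _)  (inj₁ e₂) = k , b , refl , e₂ , inj₁ refl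
    -- Being in different rows, `k` and `l` are different variables, so both can be split off from
    -- the same monomial.
    go (inj₂ lt₁) (inj₂ lt₂) with rest (λ { refl → ℕP.<-irrefl refl lt₁ })
    ... | c , refl with swap c k l lt₁ lt₂
    ... | k′ , l′ , e₁′ , e₂′ , sw = k′ , c ⊞ unit l′ , e₁′ , e₂′ ,
      inj₂ (subst₂ Swap (trans (sym (⊞-assoc c _ _)) (sym e))
              (trans (cong (c ⊞_) (⊞-comm (unit k′) _)) (sym (⊞-assoc c _ _))) sw)

  -- The first row and the last column depend on the marginals only, so both monomials have the same
  -- target cell, which by `joint-inj` is a single variable. Cancelling it leaves equal marginals in
  -- a smaller degree; the inductions below run on this.
  common-front : ∀ {d} u v → deg u ≡ suc d → SameMarginals u v →
    ∃[ k ] ∃[ a ] ∃[ b ] (deg a ≡ d × SameMarginals a b ×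
      (u ≡ a ⊞ unit k ⊎ Swap u (a ⊞ unit k)) × (v ≡ b ⊞ unit k ⊎ Swap v (b ⊞ unit k)))
  common-front {d} u v du (marginals e₁ e₂)
    with optimal _≼₁_ (λ i j → ℕP.≤-total (s₁ i) (s₁ j)) ≤-trans (push p₁ u) (nonzero p₁)
       | optimal _≽₂_ (λ i j → ℕP.≤-total (s₂ j) (s₂ i)) (λ h h′ → ≤-trans h′ h) (push p₂ u) (nonzero p₂)
    where
    nonzero : ∀ {m} (p : Fin n → Fin m) → push p u ≢ 𝟎
    nonzero {m} p z = contradiction (trans (sym du) (trans (sym (deg-push p u)) (trans (cong deg z) (wt-𝟎 {n = m} (λ _ → 1))))) λ ()
  ... | i , oi | j , oj
    with front u oi oj | front v (subst (λ w → Optimal _≼₁_ w i) e₁ oi) (subst (λ w → Optimal _≽₂_ w j) e₂ oj)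
  ... | k , a , k₁ , k₂ , su | l , b , l₁ , l₂ , sv
    with joint-inj l k (trans l₁ (sym k₁)) (trans l₂ (sym k₂))
  ... | refl = k , a , b , da , marginals (cancel p₁ u₁ v₁ e₁) (cancel p₂ u₂ v₂ e₂) , su , sv
    where
    to-marginals : ∀ {w w′} → w ≡ w′ ⊎ Swap w w′ → SameMarginals w w′
    to-marginals (inj₁ refl) = marginals refl refl
    to-marginals (inj₂ sw)   = Swap⇒SameMarginals sw
    open SameMarginals (to-marginals su) renaming (first to u₁; second to u₂)
    open SameMarginals (to-marginals sv) renaming (first to v₁; second to v₂)
    cancel : ∀ {m} (p : Fin n → Fin m) →
      push p u ≡ push p (a ⊞ unit k) → push p v ≡ push p (b ⊞ unit k) → push p u ≡ push p v →
      push p a ≡ push p b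
    cancel p f g e = ⊞-cancelʳ (unit (p k))
      (trans (sym (push-⊞unit p a k)) (trans (sym f) (trans e (trans g (push-⊞unit p b k)))))
    da : deg a ≡ d
    da = ℕP.suc-injective (begin
      suc (deg a)             ≡⟨ +-comm 1 _ ⟩
      deg a + 1               ≡⟨ cong (deg a +_) (wt-unit _ k) ⟨
      deg a + deg (unit k)    ≡⟨ wt-⊞ _ a (unit k) ⟨
      deg (a ⊞ unit k)        ≡⟨ deg-push p₁ (a ⊞ unit k) ⟨
      deg (push p₁ (a ⊞ unit k)) ≡⟨ cong deg u₁ ⟨
      deg (push p₁ u)         ≡⟨ deg-push p₁ u ⟩
      deg u                   ≡⟨ du ⟩
      suc d                   ∎)
      where open ≡-Reasoning

  SameMarginals⇒deg : ∀ {u v} → SameMarginals u v → deg u ≡ deg v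
  SameMarginals⇒deg {u} {v} (marginals e _) = trans (sym (deg-push p₁ u)) (trans (cong deg e) (deg-push p₁ v))

  Swap⇔ : Rel (Mon n) Level.zero
  Swap⇔ u v = Swap u v ⊎ Swap v u

  swap-connected : ∀ u v → SameMarginals u v → Star Swap⇔ u v
  swap-connected u v = go _ u v refl
    where
    to : ∀ {u v} → u ≡ v ⊎ Swap u v → Star Swap⇔ u v
    to (inj₁ refl) = ε
    to (inj₂ s)    = inj₁ s ◅ ε
    from : ∀ {u v} → u ≡ v ⊎ Swap u v → Star Swap⇔ v u
    from (inj₁ refl) = ε
    from (inj₂ s)    = inj₂ s ◅ ε
    Swap⇔-⊞ : ∀ {u v} k → Swap⇔ u v → Swap⇔ (u ⊞ unit k) (v ⊞ unit k)
    Swap⇔-⊞ k = Sum.map (Swap-⊞ (unit k)) (Swap-⊞ (unit k))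
    go : ∀ d u v → deg u ≡ d → SameMarginals u v → Star Swap⇔ u v
    go zero u v du s = subst (Star Swap⇔ u)
      (trans (deg-zero u du) (sym (deg-zero v (trans (sym (SameMarginals⇒deg s)) du)))) ε
    go (suc d) u v du s = let k , a , b , da , s′ , su , sv = common-front u v du s in
      to su ◅◅ gmap {U = Swap⇔} (_⊞ unit k) (λ {a} {b} → Swap⇔-⊞ {a} {b} k) (go d a b da s′) ◅◅ from sv

  -- A monomial admitting no swap is the unique weight minimum among those with its marginals.
  minimal-or-swap : ∀ u v → SameMarginals u v → u ≡ v ⊎ wt weight u < wt weight v ⊎ ∃ (Swap u)
  minimal-or-swap u v = go _ u v refl
    where
    Result : Rel (Mon n) Level.zero
    Result u v = u ≡ v ⊎ wt weight u < wt weight v ⊎ ∃ (Swap u)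
    bound : ∀ {v v′} → v ≡ v′ ⊎ Swap v v′ → wt weight v′ ≤ wt weight v
    bound (inj₁ refl) = ≤-refl
    bound (inj₂ sw)   = ℕP.<⇒≤ (Swap⇒wt< sw)
    extend : ∀ k {a b u v} → Result a b →
      u ≡ a ⊞ unit k ⊎ Swap u (a ⊞ unit k) → v ≡ b ⊞ unit k ⊎ Swap v (b ⊞ unit k) → Result u v
    extend k _ (inj₂ sw) _ = inj₂ (inj₂ (_ , sw))
    extend k (inj₁ refl) (inj₁ refl) (inj₁ e)  = inj₁ (sym e)
    extend k (inj₁ refl) (inj₁ refl) (inj₂ sw) = inj₂ (inj₁ (Swap⇒wt< sw))
    extend k {a} {b} (inj₂ (inj₁ lt)) (inj₁ refl) sv = inj₂ (inj₁ (ℕP.<-≤-trans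
      (subst₂ _<_ (sym (wt-⊞ weight a _)) (sym (wt-⊞ weight b _)) (ℕP.+-monoˡ-< _ lt)) (bound sv)))
    extend k (inj₂ (inj₂ (w , sw))) (inj₁ refl) _ = inj₂ (inj₂ (w ⊞ unit k , Swap-⊞ (unit k) sw))
    go : ∀ d u v → deg u ≡ d → SameMarginals u v → Result u v
    go zero u v du s = inj₁ (trans (deg-zero u du) (sym (deg-zero v (trans (sym (SameMarginals⇒deg s)) du))))
    go (suc d) u v du s = let k , a , b , da , s′ , su , sv = common-front u v du s in
      extend k (go d a b da s′) su sv

-- The combinatorial form of a toric fibre product: by `project` and `glue`, `R` is the pullback of
-- `R₁` and `R₂` along the two projections.
record FibreProduct {n n₁ n₂} (G : Gluing n n₁ n₂)
  (R : Rel (Mon n) Level.zero) (R₁ : Rel (Mon n₁) Level.zero) (R₂ : Rel (Mon n₂) Level.zero) : Set where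
  open Gluing G
  field
    refl₁   : ∀ {u} → R₁ u u
    refl₂   : ∀ {u} → R₂ u u
    project : ∀ {u v} → R u v → R₁ (push p₁ u) (push p₁ v) × R₂ (push p₂ u) (push p₂ v)
    glue    : ∀ {u v} → R₁ (push p₁ u) (push p₁ v) → R₂ (push p₂ u) (push p₂ v) → R u v
    match₁  : ∀ {i i′ k k′} → R₁ (unit i ⊞ unit i′) (unit k ⊞ unit k′) →
              (t₁ i ≡ t₁ k × t₁ i′ ≡ t₁ k′) ⊎ (t₁ i ≡ t₁ k′ × t₁ i′ ≡ t₁ k)
    match₂  : ∀ {i i′ k k′} → R₂ (unit i ⊞ unit i′) (unit k ⊞ unit k′) →
              (t₂ i ≡ t₂ k × t₂ i′ ≡ t₂ k′) ⊎ (t₂ i ≡ t₂ k′ × t₂ i′ ≡ t₂ k)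

  open SameMarginals G public

  glue₁ : ∀ {u v} → R₁ (push p₁ u) (push p₁ v) → push p₂ v ≡ push p₂ u → R u v
  glue₁ r e = glue r (subst (R₂ _) (sym e) refl₂)

  glue₂ : ∀ {u v} → R₂ (push p₂ u) (push p₂ v) → push p₁ v ≡ push p₁ u → R u v
  glue₂ r e = glue (subst (R₁ _) (sym e) refl₁) r

  same⇒R : ∀ {u v} → SameMarginals u v → R u v
  same⇒R (marginals e₁ e₂) = glue₁ (subst (R₁ _) e₁ refl₁) (sym e₂)

  pair-flipped : ∀ j i → (t₁ i ≡ true → t₂ j ≡ true) → ∃[ k ] (p₂ k ≡ j × p₁ k ≡ i)
  pair-flipped j i ok = let k , e , e′ = pair i j ok in k , e′ , e

  module L₁ = Lift p₁ p₂ (λ i j → t₁ i ≡ true → t₂ j ≡ true) compatible pair t₁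
    (λ e ok h → ok (trans e h)) R₁ match₁
  module L₂ = Lift p₂ p₁ (λ j i → t₁ i ≡ true → t₂ j ≡ true) compatible
    pair-flipped t₂
    (λ e ok h → trans (sym e) (ok h)) R₂ match₂

  -- The path corrects the first projection with the second held fixed, then the second with the
  -- first held fixed; what remains is a difference between monomials with the same marginals.
  quadraticallyConnected : QuadraticallyConnected R₁ → QuadraticallyConnected R₂ → QuadraticallyConnected R
  quadraticallyConnected conn₁ conn₂ u v r =
    let r₁ , r₂ = project r
        u′ , ms₁ , e₁ , e₂ = L₁.lift-star glue₁ u refl (conn₁ _ _ r₁)
        u″ , ms₂ , e₂′ , e₁′ = L₂.lift-star glue₂ u′ e₂ (conn₂ _ _ r₂)
    in ms₁ ◅◅ ms₂ ◅◅ gmap id from-swap (swap-connected u″ v (marginals (trans e₁′ e₁) e₂′))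
    where
    from-swap : ∀ {u v} → Swap⇔ u v → Move R u v
    from-swap (inj₁ (swapping b x y x′ y′ same _ eu ev)) = move b x y x′ y′ (same⇒R same) eu ev
    from-swap (inj₂ (swapping b x y x′ y′ (marginals e₁ e₂) _ eu ev)) =
      move b x′ y′ x y (same⇒R (marginals (sym e₁) (sym e₂))) ev eu

-- Monomial orders

module Orders {a ℓ} (K : Field a ℓ) where
  open Poly K public using (MonomialOrder)

  record Additive {n m} (f : Mon n → Mon m) : Set where
    field
      ⊞-homo : ∀ u v → f (u ⊞ v) ≡ f u ⊞ f v
      𝟎-homo : f 𝟎 ≡ 𝟎

  -- Pullback of a lexicographic product along `f` and `g`. Additivity transports compatibility and
  -- the position of 1; joint injectivity turns two ties into an equality, which gives totality.
  lexicographic : ∀ {n m l} {f : Mon n → Mon m} {g : Mon n → Mon l} → Additive f → Additive g →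
    (∀ {u v} → f u ≡ f v → g u ≡ g v → u ≡ v) → MonomialOrder m → MonomialOrder l → MonomialOrder n
  lexicographic {n} {f = f} {g} add-f add-g inj O₁ O₂ = record
    { _≺_ = _≺_
    ; isSTO = isStrictTotalOrderᶜ record
      { isEquivalence = isEquivalence ; trans = ≺-trans ; compare = compare }
    ; compatible = compat
    ; one-least = least }
    where
    module F = Additive add-f
    module G = Additive add-g
    module O₁ = MonomialOrder O₁
    module O₂ = MonomialOrder O₂
    module S₁ = IsStrictTotalOrder O₁.isSTO
    module S₂ = IsStrictTotalOrder O₂.isSTO
    _≺_ : Rel (Mon n) Level.zero
    u ≺ v = f u O₁.≺ f v ⊎ (f u ≡ f v × g u O₂.≺ g v)
    ≺-trans : ∀ {u v w} → u ≺ v → v ≺ w → u ≺ w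
    ≺-trans (inj₁ p) (inj₁ q) = inj₁ (S₁.trans p q)
    ≺-trans {u} (inj₁ p) (inj₂ (e , _)) = inj₁ (subst (f u O₁.≺_) e p)
    ≺-trans {w = w} (inj₂ (e , _)) (inj₁ q) = inj₁ (subst (O₁._≺ f w) (sym e) q)
    ≺-trans (inj₂ (e , p)) (inj₂ (e′ , q)) = inj₂ (trans e e′ , S₂.trans p q)
    compare : ∀ u v → Tri (u ≺ v) (u ≡ v) (v ≺ u)
    compare u v with S₁.compare (f u) (f v)
    ... | tri< p ¬e ¬q = tri< (inj₁ p) (λ { refl → ¬e refl }) [ ¬q , (λ (e , _) → ¬e (sym e)) ]′
    ... | tri> ¬p ¬e q = tri> [ ¬p , (λ (e , _) → ¬e e) ]′ (λ { refl → ¬e refl }) (inj₁ q)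
    ... | tri≈ ¬p e ¬q with S₂.compare (g u) (g v)
    ... | tri< p ¬e ¬q′ = tri< (inj₂ (e , p)) (λ { refl → ¬e refl }) [ ¬q , (λ (_ , q) → ¬q′ q) ]′
    ... | tri≈ ¬p′ e′ ¬q′ = tri≈ [ ¬p , (λ (_ , p) → ¬p′ p) ]′ (inj e e′) [ ¬q , (λ (_ , q) → ¬q′ q) ]′
    ... | tri> ¬p′ ¬e q = tri> [ ¬p , (λ (_ , p) → ¬p′ p) ]′ (λ { refl → ¬e refl }) (inj₂ (sym e , q))
    compat : ∀ u v w → u ≺ v → (u ⊞ w) ≺ (v ⊞ w)
    compat u v w (inj₁ p) =
      inj₁ (subst₂ O₁._≺_ (sym (F.⊞-homo u w)) (sym (F.⊞-homo v w)) (O₁.compatible _ _ (f w) p))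
    compat u v w (inj₂ (e , p)) =
      inj₂ (trans (F.⊞-homo u w) (trans (cong (_⊞ f w) e) (sym (F.⊞-homo v w))) ,
            subst₂ O₂._≺_ (sym (G.⊞-homo u w)) (sym (G.⊞-homo v w)) (O₂.compatible _ _ (g w) p))
    least : ∀ u → u ≡ 𝟎 ⊎ 𝟎 ≺ u
    least u with O₁.one-least (f u) | O₂.one-least (g u)
    ... | inj₂ p | _      = inj₂ (inj₁ (subst (O₁._≺ f u) (sym F.𝟎-homo) p))
    ... | inj₁ e | inj₂ p = inj₂ (inj₂ (trans F.𝟎-homo (sym e) , subst (O₂._≺ g u) (sym G.𝟎-homo) p))
    ... | inj₁ e | inj₁ e′ = inj₁ (inj (trans e (sym F.𝟎-homo)) (trans e′ (sym G.𝟎-homo)))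

  univariate : MonomialOrder 1
  univariate = record
    { _≺_ = λ u v → Vec.head u < Vec.head v
    ; isSTO = isStrictTotalOrderᶜ record
      { isEquivalence = isEquivalence
      ; trans = ℕP.<-trans
      ; compare = λ { (x ∷ []) (y ∷ []) → compare x y } }
    ; compatible = λ { (x ∷ []) (y ∷ []) (z ∷ []) → ℕP.+-monoˡ-< z }
    ; one-least = λ { (zero ∷ []) → inj₁ refl ; (suc x ∷ []) → inj₂ (s≤s z≤n) } }
    where
    compare : ∀ x y → Tri (x < y) (x ∷ [] ≡ y ∷ []) (y < x)
    compare x y with ℕP.<-cmp x y
    ... | tri< p ¬e ¬q = tri< p (¬e ∘ cong Vec.head) ¬q
    ... | tri≈ ¬p e ¬q = tri≈ ¬p (cong (_∷ []) e) ¬q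
    ... | tri> ¬p ¬e q = tri> ¬p (¬e ∘ cong Vec.head) q

  lex : ∀ n → MonomialOrder n
  lex zero = record
    { _≺_ = λ _ _ → ⊥
    ; isSTO = isStrictTotalOrderᶜ record
      { isEquivalence = isEquivalence
      ; trans = λ ()
      ; compare = λ { [] [] → tri≈ (λ ()) refl (λ ()) } }
    ; compatible = λ _ _ _ ()
    ; one-least = λ { [] → inj₁ refl } }
  lex (suc n) = lexicographic {f = λ u → Vec.head u ∷ []} {g = Vec.tail}
    (record { ⊞-homo = λ { (x ∷ u) (y ∷ v) → refl } ; 𝟎-homo = refl })
    (record { ⊞-homo = λ { (x ∷ u) (y ∷ v) → refl } ; 𝟎-homo = refl })
    (λ { {x ∷ u} {y ∷ v} refl refl → refl }) univariate (lex n)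

  ReducesFibres : ∀ {n} → MonomialOrder n → Rel (Mon n) Level.zero → Set
  ReducesFibres O R = ∀ u v → R u v → v ≺ u → Reducible _≺_ R u
    where open MonomialOrder O

  push-additive : ∀ {n m} (p : Fin n → Fin m) → Additive (push p)
  push-additive p = record { ⊞-homo = push-⊞ p ; 𝟎-homo = push-𝟎 p }

  id-additive : ∀ {n} → Additive {n} id
  id-additive = record { ⊞-homo = λ _ _ → refl ; 𝟎-homo = refl }

  module _ {n n₁ n₂} {G : Gluing n n₁ n₂} {R R₁ R₂} (FP : FibreProduct G R R₁ R₂)
    (O₁ : MonomialOrder n₁) (O₂ : MonomialOrder n₂) where
    open Gluing G
    open FibreProduct FP
    private
      module O₁ = MonomialOrder O₁
      module O₂ = MonomialOrder O₂

    -- Equal weight does not mean equal monomials, so `lex` decides the ties. Among monomials with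
    -- the same marginals, one that admits no swap has strictly least weight.
    weightOrder : MonomialOrder n
    weightOrder = lexicographic {f = λ u → wt weight u ∷ []} {g = id}
      (record { ⊞-homo = λ u v → cong (_∷ []) (wt-⊞ weight u v) ; 𝟎-homo = cong (_∷ []) (wt-𝟎 weight) })
      id-additive (λ _ e → e) univariate (lex n)

    secondOrder : MonomialOrder n
    secondOrder = lexicographic (push-additive p₂) id-additive (λ _ e → e) O₂ weightOrder

    glueOrder : MonomialOrder n
    glueOrder = lexicographic (push-additive p₁) id-additive (λ _ e → e) O₁ secondOrder

    open MonomialOrder glueOrder

    -- The cases follow the level at which `v` is smaller. A drop in a projection makes that
    -- projection reducible, and the lifted quadrics agree in the other one, so they differ at the
    -- same level. With both projections tied, `u` is not the weight minimum of its marginals and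
    -- admits a swap.
    reducesFibres : ReducesFibres O₁ R₁ → ReducesFibres O₂ R₂ → ReducesFibres glueOrder R
    reducesFibres red₁ red₂ u v r (inj₁ lt) =
      L₁.lift-reducible glue₁ {O₁._≺_} {_≺_} (λ lt _ → inj₁ lt) u (red₁ _ _ (proj₁ (project r)) lt)
    reducesFibres red₁ red₂ u v r (inj₂ (_ , inj₁ lt)) =
      L₂.lift-reducible glue₂ {O₂._≺_} {_≺_} (λ lt e → inj₂ (e , inj₁ lt)) u (red₂ _ _ (proj₂ (project r)) lt)
    reducesFibres red₁ red₂ u v r (inj₂ (e₁ , inj₂ (e₂ , lt))) =
      from-minimality (minimal-or-swap u v (marginals (sym e₁) (sym e₂)))
      where
      module W = IsStrictTotalOrder (MonomialOrder.isSTO weightOrder)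
      from-minimality : u ≡ v ⊎ wt weight u < wt weight v ⊎ ∃ (Swap u) → Reducible _≺_ R u
      from-minimality (inj₁ e) = ⊥-elim (W.irrefl (sym e) lt)
      from-minimality (inj₂ (inj₁ lt′)) = ⊥-elim (W.asym lt (inj₁ lt′))
      from-minimality (inj₂ (inj₂ (_ , swapping b x y x′ y′ same@(marginals f₁ f₂) lt′ eu _))) =
        reduce b x y x′ y′ (same⇒R same) (inj₂ (sym f₁ , inj₂ (sym f₂ , inj₁ lt′))) eu

-- Matroids

bit : Bool → ℕ
bit b = if b then 1 else 0

bit-inj : ∀ {a b} → bit a ≡ bit b → a ≡ b
bit-inj {false} {false} _ = refl
bit-inj {true}  {true}  _ = refl

lookup-⁅⁆ : ∀ {n} (i j : Fin n) → bit (lookup ⁅ i ⁆ j) ≡ δ i j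
lookup-⁅⁆ zero    zero    = refl
lookup-⁅⁆ zero    (suc j) = trans (cong bit (VecP.lookup-replicate j false)) (sym (VecP.lookup-replicate j 0))
lookup-⁅⁆ (suc i) zero    = refl
lookup-⁅⁆ (suc i) (suc j) = lookup-⁅⁆ i j

lookup-⁅⁆-true : ∀ {n} {i j : Fin n} → lookup ⁅ i ⁆ j ≡ true → i ≡ j
lookup-⁅⁆-true {i = i} {j} h = δ≢0⇒≡ λ z → contradiction (trans (sym (trans (sym (lookup-⁅⁆ i j)) (cong bit h))) z) λ ()

lookup-⁅⁆-same : ∀ {n} (i : Fin n) → lookup ⁅ i ⁆ i ≡ true
lookup-⁅⁆-same i = bit-inj (trans (lookup-⁅⁆ i i) (δ-same i))

lookup-⁅⁆-diff : ∀ {n} {i j : Fin n} → i ≢ j → lookup ⁅ i ⁆ j ≡ false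
lookup-⁅⁆-diff {i = i} {j} h = bit-inj (trans (lookup-⁅⁆ i j) (δ-diff h))

lookup-∪ : ∀ {n} e (X Y : Subset n) → lookup (X ∪ Y) e ≡ lookup X e ∨ lookup Y e
lookup-∪ = VecP.lookup-zipWith _∨_

lookup-∩ : ∀ {n} e (X Y : Subset n) → lookup (X ∩ Y) e ≡ lookup X e ∧ lookup Y e
lookup-∩ = VecP.lookup-zipWith _∧_

lookup-─ : ∀ {n} e (X Y : Subset n) → lookup (X ─ Y) e ≡ lookup X e ∧ not (lookup Y e)
lookup-─ zero    (x ∷ X) (true  ∷ Y) = sym (BoolP.∧-zeroʳ x)
lookup-─ zero    (x ∷ X) (false ∷ Y) = sym (BoolP.∧-identityʳ x)
lookup-─ (suc e) (x ∷ X) (y ∷ Y)     = lookup-─ e X Y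

infix 4 _⊑_

-- Inclusion read on bits, so that set identities become truth tables.
_⊑_ : ∀ {n} → Subset n → Subset n → Set
X ⊑ Y = ∀ e → lookup X e ≡ true → lookup Y e ≡ true

⊆⇒⊑ : ∀ {n} {X Y : Subset n} → X ⊆ Y → X ⊑ Y
⊆⇒⊑ {X = X} h e p = VecP.[]=⇒lookup (h (VecP.lookup⇒[]= e X p))

⊑⇒⊆ : ∀ {n} {X Y : Subset n} → X ⊑ Y → X ⊆ Y
⊑⇒⊆ {Y = Y} h {e} p = VecP.lookup⇒[]= e Y (h e (VecP.[]=⇒lookup p))

∉⇒lookup : ∀ {n} {X : Subset n} {e} → e ∉ X → lookup X e ≡ false
∉⇒lookup {X = X} {e} h = BoolP.¬-not λ p → h (VecP.lookup⇒[]= e X p)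

lookup⇒∉ : ∀ {n} {X : Subset n} {e} → lookup X e ≡ false → e ∉ X
lookup⇒∉ p q = contradiction (trans (sym (VecP.[]=⇒lookup q)) p) λ ()

-- The exchange of `x` for `y` as a subtraction-free equation of indicator vectors. Such equations
-- can be added, which handles sizes and double exchanges alike.
record Exchanged {n} (B : Subset n) (x y : Fin n) (B′ : Subset n) : Set where
  constructor exchanging
  field
    equation : ∀ e → bit (lookup B′ e) + δ x e ≡ bit (lookup B e) + δ y e

exchanged : ∀ {n} (B : Subset n) {x y} → lookup B x ≡ true → lookup B y ≡ false →
  Exchanged B x y ((B - x) ∪ ⁅ y ⁆)
exchanged B {x} {y} hx hy = exchanging λ e → begin
  bit (lookup ((B - x) ∪ ⁅ y ⁆) e) + δ x e
    ≡⟨ cong₂ _+_ (cong bit (trans (lookup-∪ e (B - x) _) (cong (_∨ lookup ⁅ y ⁆ e) (lookup-─ e B ⁅ x ⁆))))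
                 (sym (lookup-⁅⁆ x e)) ⟩
  bit ((lookup B e ∧ not (lookup ⁅ x ⁆ e)) ∨ lookup ⁅ y ⁆ e) + bit (lookup ⁅ x ⁆ e)
    ≡⟨ table (lookup B e) (lookup ⁅ x ⁆ e) (lookup ⁅ y ⁆ e)
         (λ p → subst (λ i → lookup B i ≡ true) (lookup-⁅⁆-true p) hx)
         (λ p → subst (λ i → lookup B i ≡ false) (lookup-⁅⁆-true p) hy) ⟩
  bit (lookup B e) + bit (lookup ⁅ y ⁆ e) ≡⟨ cong (bit (lookup B e) +_) (lookup-⁅⁆ y e) ⟩
  bit (lookup B e) + δ y e ∎
  where
  open ≡-Reasoning
  table : ∀ b p q → (p ≡ true → b ≡ true) → (q ≡ true → b ≡ false) →
    bit ((b ∧ not p) ∨ q) + bit p ≡ bit b + bit q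
  table true  true  true  _ h = contradiction (h refl) λ ()
  table true  true  false _ _ = refl
  table true  false true  _ h = contradiction (h refl) λ ()
  table true  false false _ _ = refl
  table false true  _     h _ = contradiction (h refl) λ ()
  table false false true  _ _ = refl
  table false false false _ _ = refl

size : ∀ {n} → Subset n → ℕ
size X = ∑.sum (λ e → bit (lookup X e))

sum-δ : ∀ {n} (i : Fin n) → ∑.sum (δ i) ≡ 1
sum-δ {suc n} zero    = cong suc (trans (∑.sum-cong-≗ {n} (λ j → VecP.lookup-replicate j 0)) (∑.sum-replicate-zero n))
sum-δ {suc n} (suc i) = sum-δ i

sum≢0 : ∀ {n} (f : Fin n → ℕ) → ∑.sum f ≢ 0 → ∃[ i ] f i ≢ 0
sum≢0 {zero}  f h = ⊥-elim (h refl)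
sum≢0 {suc n} f h with f zero in eq
... | zero  = let i , p = sum≢0 (f ∘ suc) h in suc i , p
... | suc m = zero , λ z → contradiction (trans (sym eq) z) λ ()

sum≡0 : ∀ {n} (f : Fin n → ℕ) → ∑.sum f ≡ 0 → ∀ i → f i ≡ 0
sum≡0 f h zero    = ℕP.m+n≡0⇒m≡0 (f zero) h
sum≡0 f h (suc i) = sum≡0 (f ∘ suc) (ℕP.m+n≡0⇒n≡0 (f zero) h) i

-- This is how the shared element is resolved. It is applied to the indicators of bases and again to
-- the multiplicities of monomials.
sum-agree : ∀ {n} (f g : Fin n → ℕ) c → (∀ e → e ≢ c → f e ≡ g e) → ∑.sum f ≡ ∑.sum g → f c ≡ g c
sum-agree f g zero h eq =
  +-cancelʳ-≡ _ _ _ (trans eq (cong (g zero +_) (∑.sum-cong-≗ λ e → sym (h (suc e) λ ()))))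
sum-agree f g (suc c) h eq = sum-agree (f ∘ suc) (g ∘ suc) c (λ e ne → h (suc e) (ne ∘ FinP.suc-injective))
  (+-cancelˡ-≡ (f zero) _ _ (trans eq (cong (_+ ∑.sum (g ∘ suc)) (sym (h zero λ ())))))

sum-+ : ∀ {n} (f g : Fin n → ℕ) → ∑.sum (λ e → f e + g e) ≡ ∑.sum f + ∑.sum g
sum-+ = ∑.∑-distrib-+

Exchanged⇒size : ∀ {n} {B B′ : Subset n} {x y} → Exchanged B x y B′ → size B′ ≡ size B
Exchanged⇒size {B = B} {B′} {x} {y} (exchanging h) = +-cancelʳ-≡ 1 _ _ (begin
  size B′ + 1                                   ≡⟨ cong (size B′ +_) (sum-δ x) ⟨
  size B′ + ∑.sum (δ x)                         ≡⟨ sum-+ (λ e → bit (lookup B′ e)) (δ x) ⟨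
  ∑.sum (λ e → bit (lookup B′ e) + δ x e)       ≡⟨ ∑.sum-cong-≗ h ⟩
  ∑.sum (λ e → bit (lookup B e) + δ y e)        ≡⟨ sum-+ (λ e → bit (lookup B e)) (δ y) ⟩
  size B + ∑.sum (δ y)                          ≡⟨ cong (size B +_) (sum-δ y) ⟩
  size B + 1                                    ∎)
  where open ≡-Reasoning

module Matroid {N} {M : SetSystem N} (mat : IsMatroid M) where
  open IsMatroid mat public

  ground : ∀ {B} → IsBasis M B → B ⊑ E M
  ground {B} b = ⊆⇒⊑ (⊆ground B b)

  outside : ∀ {B e} → IsBasis M B → lookup (E M) e ≡ false → lookup B e ≡ false
  outside {B} {e} b h = BoolP.¬-not λ p → contradiction (trans (sym (ground b e p)) h) λ ()

  exchange′ : ∀ {B₁ B₂ x} → IsBasis M B₁ → IsBasis M B₂ → lookup B₁ x ≡ true → lookup B₂ x ≡ false →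
    ∃[ y ] (lookup B₂ y ≡ true × lookup B₁ y ≡ false × ∃[ B′ ] (IsBasis M B′ × Exchanged B₁ x y B′))
  exchange′ {B₁} {B₂} {x} b₁ b₂ x∈ x∉ =
    let y , y∈ , y∉ , b = exchange B₁ B₂ b₁ b₂ x (VecP.lookup⇒[]= x B₁ x∈) (lookup⇒∉ x∉)
    in y , VecP.[]=⇒lookup y∈ , ∉⇒lookup y∉ , _ , b , exchanged B₁ x∈ (∉⇒lookup y∉)

  difference : Subset N → Subset N → Fin N → ℕ
  difference X Y e = bit (lookup X e ∧ not (lookup Y e))

  -- Induction on the number of elements of `B₁` outside `B₂`: an exchange towards `B₂` lowers it by
  -- one and keeps the cardinality. When it is 0, an element of `B₂` outside `B₁` would demand a
  -- partner in `B₁` outside `B₂`, so the bases are equal.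
  equicardinal : ∀ {B₁ B₂} → IsBasis M B₁ → IsBasis M B₂ → size B₁ ≡ size B₂
  equicardinal {B₁} {B₂} b₁ b₂ = go _ b₁ refl
    where
    nonzero : ∀ a b → bit (a ∧ not b) ≢ 0 → a ≡ true × b ≡ false
    nonzero true  false _ = refl , refl
    nonzero true  true  h = ⊥-elim (h refl)
    nonzero false _     h = ⊥-elim (h refl)
    step-table : ∀ b₁ b′ b₂ x y → bit b′ + x ≡ bit b₁ + y →
      y ≡ 0 × (x ≡ 0 ⊎ b₁ ≡ true × b₂ ≡ false × x ≡ 1) ⊎ (y ≡ 1 × x ≡ 0 × b₂ ≡ true) →
      bit (b′ ∧ not b₂) + x ≡ bit (b₁ ∧ not b₂)
    step-table b₁ b′ b₂ x y h (inj₁ (refl , inj₁ refl))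
      with refl ← bit-inj {b′} {b₁} (+-cancelʳ-≡ 0 _ _ h) = +-identityʳ _
    step-table true  false false x y h (inj₁ (refl , inj₂ (refl , refl , refl))) = refl
    step-table b₁ b′ true  x y h (inj₂ (refl , refl , refl)) =
      trans (+-identityʳ _) (trans (cong bit (BoolP.∧-zeroʳ b′)) (cong bit (sym (BoolP.∧-zeroʳ b₁))))
    step : ∀ {B B′ x y} → lookup B x ≡ true → lookup B₂ x ≡ false → lookup B₂ y ≡ true → Exchanged B x y B′ →
      ∀ e → difference B′ B₂ e + δ x e ≡ difference B B₂ e
    step {B} {B′} {x} {y} x∈ x∉ y∈ (exchanging h) e with y FinP.≟ e | x FinP.≟ e
    ... | yes refl | yes refl = contradiction (trans (sym y∈) x∉) λ ()
    ... | yes refl | no x≢e = step-table _ (lookup B′ e) _ _ _ (h e) (inj₂ (δ-same y , δ-diff x≢e , y∈))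
    ... | no y≢e | yes refl = step-table _ (lookup B′ e) _ _ _ (h e) (inj₁ (δ-diff y≢e , inj₂ (x∈ , x∉ , δ-same x)))
    ... | no y≢e | no x≢e = step-table _ (lookup B′ e) _ _ _ (h e) (inj₁ (δ-diff y≢e , inj₁ (δ-diff x≢e)))
    go : ∀ d {B} → IsBasis M B → ∑.sum (difference B B₂) ≡ d → size B ≡ size B₂
    go zero {B} b h with ∑.sum (difference B₂ B) in eq
    ... | zero = ∑.sum-cong-≗ λ e → table (lookup B e) (lookup B₂ e) (sum≡0 _ h e) (sum≡0 _ eq e)
      where
      table : ∀ p q → bit (p ∧ not q) ≡ 0 → bit (q ∧ not p) ≡ 0 → bit p ≡ bit q
      table true  true  _ _ = refl
      table false false _ _ = refl
    ... | suc m =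
      let x , p = sum≢0 (difference B₂ B) (λ z → contradiction (trans (sym eq) z) λ ())
          x∈ , x∉ = nonzero _ _ p
          y , y∈ , y∉ , _ = exchange′ b₂ b x∈ x∉
      in contradiction (trans (sym (cong₂ (λ p q → bit (p ∧ not q)) y∈ y∉)) (sum≡0 _ h y)) λ ()
    go (suc d) {B} b h =
      let x , p = sum≢0 (difference B B₂) (λ z → contradiction (trans (sym h) z) λ ())
          x∈ , x∉ = nonzero _ _ p
          y , y∈ , y∉ , B′ , b′ , ex = exchange′ b b₂ x∈ x∉
          less = +-cancelʳ-≡ 1 _ _ (begin
            ∑.sum (difference B′ B₂) + 1             ≡⟨ cong (∑.sum (difference B′ B₂) +_) (sum-δ x) ⟨
            ∑.sum (difference B′ B₂) + ∑.sum (δ x)   ≡⟨ sum-+ (difference B′ B₂) (δ x) ⟨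
            ∑.sum (λ e → difference B′ B₂ e + δ x e) ≡⟨ ∑.sum-cong-≗ (step x∈ x∉ y∈ ex) ⟩
            ∑.sum (difference B B₂)                  ≡⟨ h ⟩
            suc d                                    ≡⟨ +-comm 1 d ⟩
            d + 1                                    ∎)
      in trans (sym (Exchanged⇒size ex)) (go d b′ less)
      where open ≡-Reasoning

-- Composites of two matroids

record Combined {N} (κ : Bool) (c : Fin N) (X B D : Subset N) : Set where
  constructor combined
  field
    equation : ∀ e → bit κ * δ c e + bit (lookup X e) ≡ bit (lookup B e) + bit (lookup D e)

  off : ∀ {e} → e ≢ c → bit (lookup X e) ≡ bit (lookup B e) + bit (lookup D e)
  off {e} e≢c = trans (cong (_+ bit (lookup X e)) (sym (trans (cong (bit κ *_) (δ-diff (e≢c ∘ sym))) (ℕP.*-zeroʳ (bit κ))))) (equation e)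

  at : bit κ + bit (lookup X c) ≡ bit (lookup B c) + bit (lookup D c)
  at = trans (cong (_+ bit (lookup X c)) (sym (trans (cong (bit κ *_) (δ-same c)) (ℕP.*-identityʳ (bit κ))))) (equation c)

-- The bases of M are the sets X ⊆ E M with χ(X) + κ χ(c) = χ(B) + χ(D) for bases B and D of M₁ and M₂.  The
-- pairs (B , D) that occur are singled out by a condition f₁ [c ∈ B] ≤ f₂ [c ∈ D].
record Composite {N} (M M₁ M₂ : SetSystem N) (c : Fin N) : Set where
  field
    κ : Bool
    f₁ f₂ : Bool → Bool

  Admissible : Subset N → Subset N → Set
  Admissible B D = f₁ (lookup B c) ≡ true → f₂ (lookup D c) ≡ true

  field
    in-ground : ∀ {X} → IsBasis M X → X ⊑ E M
    disjoint   : ∀ e → e ≢ c → lookup (E M₁) e ≡ false ⊎ lookup (E M₂) e ≡ false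
    split     : ∀ {X} → IsBasis M X →
                ∃[ B ] ∃[ D ] (IsBasis M₁ B × IsBasis M₂ D × Combined κ c X B D × Admissible B D)
    complete  : ∀ {X B D} → X ⊑ E M → IsBasis M₁ B → IsBasis M₂ D → Combined κ c X B D → IsBasis M X
    combine   : ∀ {B D} → IsBasis M₁ B → IsBasis M₂ D → Admissible B D → ∃[ X ] (IsBasis M X × Combined κ c X B D)

-- Exchange out of an element x of B₁.  If the partner found in B₂ is c itself and c ∈ D₁ ∖ D₂, then c must be
-- exchanged further inside M₂.
module HalfExchange {N} {M₁ M₂ : SetSystem N} (mat₁ : IsMatroid M₁) (mat₂ : IsMatroid M₂) (c : Fin N) (κ : ℕ)
  (disjoint : ∀ e → e ≢ c → lookup (E M₁) e ≡ false ⊎ lookup (E M₂) e ≡ false) where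
  private
    module M₁ = Matroid mat₁
    module M₂ = Matroid mat₂

  record Setting : Set where
    field
      {X₁ X₂ B₁ B₂ D₁ D₂} : Subset N
      b₁ : IsBasis M₁ B₁
      b₂ : IsBasis M₁ B₂
      d₁ : IsBasis M₂ D₁
      d₂ : IsBasis M₂ D₂
      off₁ : ∀ {e} → e ≢ c → bit (lookup X₁ e) ≡ bit (lookup B₁ e) + bit (lookup D₁ e)
      off₂ : ∀ {e} → e ≢ c → bit (lookup X₂ e) ≡ bit (lookup B₂ e) + bit (lookup D₂ e)
      at₁ : κ + bit (lookup X₁ c) ≡ bit (lookup B₁ c) + bit (lookup D₁ c)
      at₂ : κ + bit (lookup X₂ c) ≡ bit (lookup B₂ c) + bit (lookup D₂ c)

  module _ (S : Setting) where
    open Setting S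

    Partner : Fin N → Set
    Partner x = ∃[ y ] (lookup X₂ y ≡ true × lookup X₁ y ≡ false × ∃[ B ] ∃[ D ] (IsBasis M₁ B × IsBasis M₂ D ×
      (∀ e → bit (lookup B e) + bit (lookup D e) + δ x e ≡ bit (lookup B₁ e) + bit (lookup D₁ e) + δ y e)))

    half-exchange : ∀ {x} → lookup B₁ x ≡ true → lookup B₂ x ≡ false → Partner x
    half-exchange {x} x∈ x∉ =
      let y , y∈ , y∉ , B , b , ex = M₁.exchange′ b₁ b₂ x∈ x∉ in partner y y∈ y∉ b ex (y FinP.≟ c)
      where
      in-first : ∀ {B y} → IsBasis M₁ B → lookup B y ≡ true → y ≢ c → ∀ {D} → IsBasis M₂ D → lookup D y ≡ false
      in-first {B} {y} b y∈ y≢c d with disjoint y y≢c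
      ... | inj₁ z = contradiction (trans (sym y∈) (M₁.outside b z)) λ ()
      ... | inj₂ z = M₂.outside d z
      in-second : ∀ {D y} → IsBasis M₂ D → lookup D y ≡ true → y ≢ c → ∀ {B} → IsBasis M₁ B → lookup B y ≡ false
      in-second {D} {y} d y∈ y≢c b with disjoint y y≢c
      ... | inj₁ z = M₁.outside b z
      ... | inj₂ z = contradiction (trans (sym y∈) (M₂.outside d z)) λ ()
      single : ∀ {B y} → Exchanged B₁ x y B → ∀ e →
        bit (lookup B e) + bit (lookup D₁ e) + δ x e ≡ bit (lookup B₁ e) + bit (lookup D₁ e) + δ y e
      single {B} {y} (exchanging ex) e = trans (swap₂₃ (bit (lookup B e)) _ _)
        (trans (cong (_+ bit (lookup D₁ e)) (ex e)) (swap₂₃ (bit (lookup B₁ e)) (δ y e) _))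
        where
        swap₂₃ : ∀ a b c → a + b + c ≡ a + c + b
        swap₂₃ = solve-∀
      same-table : ∀ k p q d → k + bit p ≡ bit d → k + bit q ≡ suc (bit d) → q ≡ true × p ≡ false
      same-table k p q d e₁ e₂ = table p q (+-cancelˡ-≡ k _ _ (trans e₂ (trans (cong suc (sym e₁)) (sym (ℕP.+-suc k _)))))
        where
        table : ∀ p q → bit q ≡ suc (bit p) → q ≡ true × p ≡ false
        table false true _ = refl , refl
      at-c : ∀ {B} → lookup B₂ c ≡ true → lookup B₁ c ≡ false → IsBasis M₁ B → Exchanged B₁ x c B → Partner x
      at-c {B} y∈ y∉ b ex with lookup D₁ c in eq₁ | lookup D₂ c in eq₂
      -- `D₁` and `D₂` agree at `c`, so the equations at `c` force `c` into `X₂` and out of `X₁`.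
      ... | true | true =
        let p , q = same-table κ _ _ true (trans at₁ (cong₂ (λ a b → bit a + bit b) y∉ eq₁))
                                          (trans at₂ (cong₂ (λ a b → bit a + bit b) y∈ eq₂))
        in c , p , q , B , D₁ , b , d₁ , single ex
      ... | false | false =
        let p , q = same-table κ _ _ false (trans at₁ (cong₂ (λ a b → bit a + bit b) y∉ eq₁))
                                           (trans at₂ (cong₂ (λ a b → bit a + bit b) y∈ eq₂))
        in c , p , q , B , D₁ , b , d₁ , single ex
      -- The two sums at `c` would be 0 and 2, but for a fixed `κ` they differ by at most 1.
      ... | false | true = ⊥-elim (absurd κ (lookup X₁ c) (lookup X₂ c)
          (trans at₁ (cong₂ (λ a b → bit a + bit b) y∉ eq₁)) (trans at₂ (cong₂ (λ a b → bit a + bit b) y∈ eq₂)))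
        where
        absurd : ∀ k p q → k + bit p ≡ 0 → k + bit q ≡ 2 → ⊥
        absurd zero    p true  _  ()
        absurd zero    p false _  ()
        absurd (suc k) p q     () _
      -- `B` gains `c` and `D` loses it, so in the sum only `x` leaves and `z` enters; `z` is not
      -- `c` because `c` lies in `D₁`.
      ... | true | false =
        let z , z∈ , z∉ , D , d , ex′ = M₂.exchange′ d₁ d₂ eq₁ eq₂
            z≢c = λ z≡c → contradiction (trans (sym eq₁) (subst (λ i → lookup D₁ i ≡ false) z≡c z∉)) λ ()
        in z , bit-inj (trans (off₂ z≢c) (cong₂ (λ a b → bit a + bit b) (in-second d₂ z∈ z≢c b₂) z∈)) ,
               bit-inj (trans (off₁ z≢c) (cong₂ (λ a b → bit a + bit b) (in-second d₂ z∈ z≢c b₁) z∉)) ,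
           B , D , b , d , λ e → double e (bit (lookup B e)) (bit (lookup D e)) (δ x e) (δ c e)
             (bit (lookup B₁ e)) (bit (lookup D₁ e)) (δ z e) (Exchanged.equation ex e) (Exchanged.equation ex′ e)
        where
        double : ∀ (e : Fin N) B D x c B₁ D₁ z → B + x ≡ B₁ + c → D + c ≡ D₁ + z → B + D + x ≡ B₁ + D₁ + z
        double e B D x c B₁ D₁ z h h′ = +-cancelʳ-≡ c _ _
          (trans (left B D x c) (trans (cong₂ _+_ h h′) (right B₁ c D₁ z)))
          where
          left : ∀ B D x c → B + D + x + c ≡ (B + x) + (D + c)
          left = solve-∀
          right : ∀ B c D z → (B + c) + (D + z) ≡ B + D + z + c
          right = solve-∀
      partner : ∀ y {B} → lookup B₂ y ≡ true → lookup B₁ y ≡ false → IsBasis M₁ B → Exchanged B₁ x y B → Dec (y ≡ c) → Partner x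
      partner y y∈ y∉ b ex (yes refl) = at-c y∈ y∉ b ex
      partner y {B} y∈ y∉ b ex (no y≢c) =
        y , bit-inj (trans (off₂ y≢c) (cong₂ (λ a b → bit a + bit b) y∈ (in-first b₂ y∈ y≢c d₂))) ,
            bit-inj (trans (off₁ y≢c) (cong₂ (λ a b → bit a + bit b) y∉ (in-first b₂ y∈ y≢c d₁))) ,
        B , D₁ , b , d₁ , single ex

module CompositeMatroid {N} {M M₁ M₂ : SetSystem N} {c : Fin N} (C : Composite M M₁ M₂ c)
  (mat₁ : IsMatroid M₁) (mat₂ : IsMatroid M₂) where
  open Composite C
  private
    module H₁ = HalfExchange mat₁ mat₂ c (bit κ) disjoint
    module H₂ = HalfExchange mat₂ mat₁ c (bit κ) (λ e e≢c → [ inj₂ , inj₁ ]′ (disjoint e e≢c))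

  -- At `x` the sum of the two indicators drops by one from `X₁` to `X₂`, so `x` is lost in one of
  -- the factors and the exchange starts there. Nonemptiness is a hypothesis because all pairs may
  -- be inadmissible, as for disjoint bases when `c` is a coloop of both factors.
  isMatroid : ∃ (IsBasis M) → IsMatroid M
  isMatroid ne = record
    { nonempty = ne
    ; ⊆ground  = λ X b → ⊑⇒⊆ (in-ground b)
    ; exchange = λ X₁ X₂ b₁ b₂ x x∈ x∉ → exchange X₁ X₂ b₁ b₂ x (VecP.[]=⇒lookup x∈) (∉⇒lookup x∉) (split b₁) (split b₂)
    }
    where
    swap-sum : ∀ a b c d e f → a + b + c ≡ d + e + f → b + a + c ≡ e + d + f
    swap-sum a b c d e f h = trans (cong (_+ c) (+-comm b a)) (trans h (cong (_+ f) (+-comm d e)))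
    finish : ∀ {X₁ X₂ B₁ D₁ x} → IsBasis M X₁ → IsBasis M X₂ → lookup X₁ x ≡ true → Combined κ c X₁ B₁ D₁ →
      ∃[ y ] (lookup X₂ y ≡ true × lookup X₁ y ≡ false × ∃[ B ] ∃[ D ] (IsBasis M₁ B × IsBasis M₂ D ×
        (∀ e → bit (lookup B e) + bit (lookup D e) + δ x e ≡ bit (lookup B₁ e) + bit (lookup D₁ e) + δ y e))) →
      ∃[ y ] (y ∈ X₂ × y ∉ X₁ × IsBasis M ((X₁ - x) ∪ ⁅ y ⁆))
    finish {X₁} {X₂} {B₁} {D₁} {x} x₁ x₂ x∈ comb (y , y∈ , y∉ , B , D , b , d , h) =
      y , VecP.lookup⇒[]= y X₂ y∈ , lookup⇒∉ y∉ , complete inside b d (combined λ e → +-cancelʳ-≡ (δ x e) _ _ (begin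
        bit κ * δ c e + bit (lookup X′ e) + δ x e   ≡⟨ +-assoc (bit κ * δ c e) _ _ ⟩
        bit κ * δ c e + (bit (lookup X′ e) + δ x e) ≡⟨ cong (bit κ * δ c e +_) (Exchanged.equation (exchanged X₁ x∈ y∉) e) ⟩
        bit κ * δ c e + (bit (lookup X₁ e) + δ y e) ≡⟨ +-assoc (bit κ * δ c e) _ _ ⟨
        bit κ * δ c e + bit (lookup X₁ e) + δ y e   ≡⟨ cong (_+ δ y e) (Combined.equation comb e) ⟩
        bit (lookup B₁ e) + bit (lookup D₁ e) + δ y e ≡⟨ h e ⟨
        bit (lookup B e) + bit (lookup D e) + δ x e ∎))
      where
      open ≡-Reasoning
      X′ = (X₁ - x) ∪ ⁅ y ⁆
      ∨-true : ∀ a b c → (a ∧ b) ∨ c ≡ true → a ≡ true ⊎ c ≡ true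
      ∨-true true  _ _    _ = inj₁ refl
      ∨-true false _ true _ = inj₂ refl
      inside : X′ ⊑ E M
      inside e p with ∨-true (lookup X₁ e) (not (lookup ⁅ x ⁆ e)) (lookup ⁅ y ⁆ e)
        (trans (sym (trans (lookup-∪ e (X₁ - x) _) (cong (_∨ lookup ⁅ y ⁆ e) (lookup-─ e X₁ ⁅ x ⁆)))) p)
      ... | inj₁ q = in-ground x₁ e q
      ... | inj₂ q with lookup-⁅⁆-true {i = y} q
      ... | refl = in-ground x₂ y y∈
    larger : ∀ b₁ d₁ b₂ d₂ → bit b₁ + bit d₁ ≡ suc (bit b₂ + bit d₂) →
      (b₁ ≡ true × b₂ ≡ false) ⊎ (d₁ ≡ true × d₂ ≡ false)
    larger true  _    false _     _ = inj₁ (refl , refl)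
    larger _     true _     false _ = inj₂ (refl , refl)
    larger false false true  _    ()
    larger false false false true ()
    larger false true  true  true ()
    larger false true  false true ()
    larger true  false true  false ()
    larger true  false true  true ()
    larger true  true  true  true ()
    exchange : ∀ X₁ X₂ → IsBasis M X₁ → IsBasis M X₂ → ∀ x → lookup X₁ x ≡ true → lookup X₂ x ≡ false →
      ∃[ B ] ∃[ D ] (IsBasis M₁ B × IsBasis M₂ D × Combined κ c X₁ B D × Admissible B D) →
      ∃[ B ] ∃[ D ] (IsBasis M₁ B × IsBasis M₂ D × Combined κ c X₂ B D × Admissible B D) →
      ∃[ y ] (y ∈ X₂ × y ∉ X₁ × IsBasis M ((X₁ - x) ∪ ⁅ y ⁆))
    exchange X₁ X₂ x₁ x₂ x x∈ x∉ (B₁ , D₁ , b₁ , d₁ , h₁ , _) (B₂ , D₂ , b₂ , d₂ , h₂ , _) =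
      [ (λ (p , q) → finish x₁ x₂ x∈ h₁ (H₁.half-exchange S₁ p q))
      , (λ (p , q) → let y , y∈ , y∉ , D , B , d , b , h = H₂.half-exchange S₂ p q
                     in finish x₁ x₂ x∈ h₁ (y , y∈ , y∉ , B , D , b , d , λ e → swap-sum (bit (lookup D e)) _ _ (bit (lookup D₁ e)) _ _ (h e)))
      ]′ (larger (lookup B₁ x) (lookup D₁ x) (lookup B₂ x) (lookup D₂ x) drop)
      where
      drop : bit (lookup B₁ x) + bit (lookup D₁ x) ≡ suc (bit (lookup B₂ x) + bit (lookup D₂ x))
      drop = trans (sym (Combined.equation h₁ x)) (trans (cong (λ a → bit κ * δ c x + bit a) x∈) (trans (+-comm (bit κ * δ c x) 1)
        (cong suc (trans (sym (trans (cong (λ a → bit κ * δ c x + bit a) x∉) (+-identityʳ _))) (Combined.equation h₂ x)))))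
      S₁ : H₁.Setting
      S₁ = record { X₁ = X₁ ; X₂ = X₂ ; b₁ = b₁ ; b₂ = b₂ ; d₁ = d₁ ; d₂ = d₂
        ; off₁ = Combined.off h₁ ; off₂ = Combined.off h₂
        ; at₁ = Combined.at h₁ ; at₂ = Combined.at h₂ }
      S₂ : H₂.Setting
      S₂ = record { X₁ = X₁ ; X₂ = X₂ ; b₁ = d₁ ; b₂ = d₂ ; d₁ = b₁ ; d₂ = b₂
        ; off₁ = λ ne → trans (Combined.off h₁ ne) (+-comm (bit (lookup B₁ _)) _)
        ; off₂ = λ ne → trans (Combined.off h₂ ne) (+-comm (bit (lookup B₂ _)) _)
        ; at₁ = trans (Combined.at h₁) (+-comm (bit (lookup B₁ c)) _)
        ; at₂ = trans (Combined.at h₂) (+-comm (bit (lookup B₂ c)) _) }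

-- Bases as variables and fibres of monomials

allSubsets-complete : ∀ {N} (X : Subset N) → X LM.∈ allSubsets N
allSubsets-complete []          = here refl
allSubsets-complete (false ∷ X) = LMP.∈-++⁺ˡ (LMP.∈-map⁺ (false ∷_) (allSubsets-complete X))
allSubsets-complete (true ∷ X)  = LMP.∈-++⁺ʳ _ (LMP.∈-map⁺ (true ∷_) (allSubsets-complete X))

allSubsets-unique : ∀ N → Unique (allSubsets N)
allSubsets-unique zero    = [] ∷ []
allSubsets-unique (suc N) = UniqueP.++⁺
  (UniqueP.map⁺ VecP.∷-injectiveʳ (allSubsets-unique N))
  (UniqueP.map⁺ VecP.∷-injectiveʳ (allSubsets-unique N))
  λ (p , q) → let _ , _ , e = LMP.∈-map⁻ (false ∷_) p
                  _ , _ , e′ = LMP.∈-map⁻ (true ∷_) q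
              in contradiction (trans (sym e) e′) λ ()

lookup-unique : ∀ {A : Set} {xs : List A} → Unique xs → ∀ i j → List.lookup xs i ≡ List.lookup xs j → i ≡ j
lookup-unique (_ ∷ _)  zero    zero    _ = refl
lookup-unique (x ∷ _)  zero    (suc j) e = ⊥-elim (All.lookup x (LMP.∈-lookup j) e)
lookup-unique (x ∷ _)  (suc i) zero    e = ⊥-elim (All.lookup x (LMP.∈-lookup i) (sym e))
lookup-unique (_ ∷ xs) (suc i) (suc j) e = cong suc (lookup-unique xs i j e)

module _ {N} (M : SetSystem N) where

  #bases : ℕ
  #bases = List.length (bases M)

  basis : Fin #bases → Subset N
  basis = List.lookup (bases M)

  ∈-bases⁺ : ∀ {X} → IsBasis M X → X LM.∈ bases M
  ∈-bases⁺ {X} h = LMP.∈-filter⁺ (λ X → BoolP.T? (isBasis M X)) (allSubsets-complete X)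
    (Function.Equivalence.from BoolP.T-≡ h)

  ∈-bases⁻ : ∀ {X} → X LM.∈ bases M → IsBasis M X
  ∈-bases⁻ h = Function.Equivalence.to BoolP.T-≡
    (proj₂ (LMP.∈-filter⁻ (λ X → BoolP.T? (isBasis M X)) {xs = allSubsets N} h))

  basis-isBasis : ∀ j → IsBasis M (basis j)
  basis-isBasis j = ∈-bases⁻ (LMP.∈-lookup j)

  basis-index : ∀ {X} → IsBasis M X → ∃[ j ] basis j ≡ X
  basis-index h = Any.index (∈-bases⁺ h) , sym (AnyP.lookup-index (∈-bases⁺ h))

  basis-inj : ∀ i j → basis i ≡ basis j → i ≡ j
  basis-inj = lookup-unique (UniqueP.filter⁺ (λ X → BoolP.T? (isBasis M X)) (allSubsets-unique N))

  -- The exponent at `e` of the image of the monomial `u`.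
  multiplicity : Mon #bases → Fin N → ℕ
  multiplicity u e = wt (λ j → bit (lookup (basis j) e)) u

  -- The degree is a field of its own so that fibres stay homogeneous in rank 0, where every
  -- monomial has image 1. This gives the matroid with empty basis both fibrewise properties.
  record Fibre (u v : Mon #bases) : Set where
    constructor fibre
    field
      degrees        : deg u ≡ deg v
      multiplicities : ∀ e → multiplicity u e ≡ multiplicity v e

  Fibre-refl : ∀ {u} → Fibre u u
  Fibre-refl = fibre refl λ _ → refl

  -- Comparing exponents at `c`: two pairs of bits with the same sum are the same multiset, and they
  -- remain so after `f` is applied.
  Fibre-match : ∀ (c : Fin N) (f : Bool → Bool) {i i′ k k′} →
    Fibre (unit i ⊞ unit i′) (unit k ⊞ unit k′) →
    let t = λ j → f (lookup (basis j) c) in (t i ≡ t k × t i′ ≡ t k′) ⊎ (t i ≡ t k′ × t i′ ≡ t k)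
  Fibre-match c f {i} {i′} {k} {k′} (fibre _ h) =
    Sum.map (λ (p , q) → cong f p , cong f q) (λ (p , q) → cong f p , cong f q)
      (table (b i) (b i′) (b k) (b k′)
        (trans (sym (wt-units (bit ∘ b) i i′)) (trans (h c) (wt-units (bit ∘ b) k k′))))
    where
    b : Fin #bases → Bool
    b j = lookup (basis j) c
    table : ∀ p q r s → bit p + bit q ≡ bit r + bit s → (p ≡ r × q ≡ s) ⊎ (p ≡ s × q ≡ r)
    table true  true  true  true  _ = inj₁ (refl , refl)
    table true  true  true  false ()
    table true  true  false true  ()
    table true  true  false false ()
    table true  false true  false _ = inj₁ (refl , refl)
    table true  false false true  _ = inj₂ (refl , refl)
    table true  false true  true  ()
    table true  false false false ()
    table false true  true  true  ()
    table false true  false false ()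
    table false false true  _     ()
    table false false false true  ()
    table false true  true  false _ = inj₂ (refl , refl)
    table false true  false true  _ = inj₁ (refl , refl)
    table false false false false _ = inj₁ (refl , refl)

  sum-multiplicity : ∀ u → ∑.sum (multiplicity u) ≡ wt (size ∘ basis) u
  sum-multiplicity = mon-ind _
    (trans (∑.sum-cong-≗ {N} (λ e → wt-𝟎 (λ j → bit (lookup (basis j) e)))) (trans (∑.sum-replicate-zero N) (sym (wt-𝟎 (size ∘ basis)))))
    λ u j ih → begin
      ∑.sum (multiplicity (u ⊞ unit j))
        ≡⟨ ∑.sum-cong-≗ (λ e → trans (wt-⊞ _ u (unit j)) (cong (multiplicity u e +_) (wt-unit _ j))) ⟩
      ∑.sum (λ e → multiplicity u e + bit (lookup (basis j) e)) ≡⟨ sum-+ (multiplicity u) _ ⟩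
      ∑.sum (multiplicity u) + size (basis j) ≡⟨ cong₂ _+_ ih (sym (wt-unit (size ∘ basis) j)) ⟩
      wt (size ∘ basis) u + wt (size ∘ basis) (unit j) ≡⟨ wt-⊞ (size ∘ basis) u (unit j) ⟨
      wt (size ∘ basis) (u ⊞ unit j) ∎
    where open ≡-Reasoning

wt-const : ∀ {n} k (u : Mon n) → wt (λ _ → k) u ≡ k * deg u
wt-const {n} k = mon-ind _ (trans (wt-𝟎 {n} (λ _ → k)) (sym (trans (cong (k *_) (wt-𝟎 {n} (λ _ → 1))) (ℕP.*-zeroʳ k))))
  λ u i ih → begin
    wt (λ _ → k) (u ⊞ unit i)           ≡⟨ wt-⊞ _ u (unit i) ⟩
    wt (λ _ → k) u + wt (λ _ → k) (unit i) ≡⟨ cong₂ _+_ ih (wt-unit _ i) ⟩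
    k * deg u + k                       ≡⟨ cong (k * deg u +_) (sym (ℕP.*-identityʳ k)) ⟩
    k * deg u + k * 1                   ≡⟨ ℕP.*-distribˡ-+ k (deg u) 1 ⟨
    k * (deg u + 1)                     ≡⟨ cong (λ d → k * (deg u + d)) (wt-unit _ i) ⟨
    k * (deg u + deg (unit i))          ≡⟨ cong (k *_) (wt-⊞ _ u (unit i)) ⟨
    k * deg (u ⊞ unit i)                ∎
  where open ≡-Reasoning

wt-+ : ∀ {n} (f g : Fin n → ℕ) u → wt (λ i → f i + g i) u ≡ wt f u + wt g u
wt-+ f g u = trans (∑.sum-cong-≗ λ i → ℕP.*-distribˡ-+ (lookup u i) (f i) (g i))
  (sum-+ (λ i → lookup u i * f i) _)

module _ {N} {M : SetSystem N} (mat : IsMatroid M) where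
  open Matroid mat

  -- All bases have the same size, so the total exponent of the image is the rank times the degree.
  sum-multiplicity-const : ∀ {B} → IsBasis M B → ∀ u → ∑.sum (multiplicity M u) ≡ size B * deg u
  sum-multiplicity-const {B} b u = trans (sum-multiplicity M u)
    (trans (wt-cong (λ j → equicardinal (basis-isBasis M j) b) u) (wt-const (size B) u))

  sum-multiplicity-fibre : ∀ {u v} → deg u ≡ deg v → ∑.sum (multiplicity M u) ≡ ∑.sum (multiplicity M v)
  sum-multiplicity-fibre {u} {v} h = let B , b = nonempty in
    trans (sum-multiplicity-const b u) (trans (cong (size B *_) h) (sym (sum-multiplicity-const b v)))

  multiplicity-outside : ∀ {e} → lookup (E M) e ≡ false → ∀ u → multiplicity M u e ≡ 0
  multiplicity-outside {e} h u = trans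
    (wt-cong {g = λ _ → 0} (λ j → cong bit (outside (basis-isBasis M j) h)) u) (wt-const 0 u)

module CompositeFibre {N} {M M₁ M₂ : SetSystem N} {c : Fin N} (C : Composite M M₁ M₂ c)
  (mat₁ : IsMatroid M₁) (mat₂ : IsMatroid M₂) where
  open Composite C
  private
    module M₁ = Matroid mat₁
    module M₂ = Matroid mat₂

  -- Away from `c` an element belongs to at most one ground set, which decides between `B` and `D`.
  -- At `c` only the sum is known; `B` is settled by its cardinality and `D` by subtraction.
  components-unique : ∀ {X B D B′ D′} → IsBasis M₁ B → IsBasis M₂ D → IsBasis M₁ B′ → IsBasis M₂ D′ →
    Combined κ c X B D → Combined κ c X B′ D′ → B ≡ B′ × D ≡ D′
  components-unique {X} {B} {D} {B′} {D′} b d b′ d′ h h′ =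
    lookup-ext (bit-inj ∘ same-B) ,
    lookup-ext λ e → bit-inj (+-cancelˡ-≡ (bit (lookup B e)) _ _ (trans (sum-same e) (cong (_+ _) (sym (same-B e)))))
    where
    sum-same : ∀ e → bit (lookup B e) + bit (lookup D e) ≡ bit (lookup B′ e) + bit (lookup D′ e)
    sum-same e = trans (sym (Combined.equation h e)) (Combined.equation h′ e)
    off-c : ∀ e → e ≢ c → bit (lookup B e) ≡ bit (lookup B′ e)
    off-c e e≢c with disjoint e e≢c
    ... | inj₁ z = cong bit (trans (M₁.outside b z) (sym (M₁.outside b′ z)))
    ... | inj₂ z = +-cancelʳ-≡ (bit (lookup D e)) _ _ (trans (sum-same e)
      (cong (λ a → bit (lookup B′ e) + bit a) (trans (M₂.outside d′ z) (sym (M₂.outside d z)))))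
    same-B : ∀ e → bit (lookup B e) ≡ bit (lookup B′ e)
    same-B e with e FinP.≟ c
    ... | no e≢c = off-c e e≢c
    ... | yes refl = sum-agree _ _ c off-c (M₁.equicardinal b b′)

  private
    components : ∀ j → ∃[ i ] ∃[ i′ ] (Combined κ c (basis M j) (basis M₁ i) (basis M₂ i′) ×
                                 Admissible (basis M₁ i) (basis M₂ i′))
    components j =
      let B , D , b , d , h , ok = split (basis-isBasis M j)
          i , p = basis-index M₁ b
          i′ , q = basis-index M₂ d
      in i , i′ , subst₂ (Combined κ c (basis M j)) (sym p) (sym q) h , subst₂ Admissible (sym p) (sym q) ok

    π₁ : Fin (#bases M) → Fin (#bases M₁)
    π₁ j = proj₁ (components j)

    π₂ : Fin (#bases M) → Fin (#bases M₂)
    π₂ j = proj₁ (proj₂ (components j))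

    combined-π : ∀ j → Combined κ c (basis M j) (basis M₁ (π₁ j)) (basis M₂ (π₂ j))
    combined-π j = proj₁ (proj₂ (proj₂ (components j)))

    pairing : ∀ i i′ → Admissible (basis M₁ i) (basis M₂ i′) → ∃[ k ] (π₁ k ≡ i × π₂ k ≡ i′)
    pairing i i′ ok =
      let X , x , h = combine (basis-isBasis M₁ i) (basis-isBasis M₂ i′) ok
          k , p = basis-index M x
          e , e′ = components-unique (basis-isBasis M₁ (π₁ k)) (basis-isBasis M₂ (π₂ k)) (basis-isBasis M₁ i)
                     (basis-isBasis M₂ i′) (combined-π k)
                     (subst (λ X → Combined κ c X (basis M₁ i) (basis M₂ i′)) (sym p) h)
      in k , basis-inj M₁ _ _ e , basis-inj M₂ _ _ e′

    π-inj : ∀ k l → π₁ k ≡ π₁ l → π₂ k ≡ π₂ l → k ≡ l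
    π-inj k l e₁ e₂ = basis-inj M k l (lookup-ext λ e → bit-inj (+-cancelˡ-≡ (bit κ * δ c e) _ _
      (trans (Combined.equation (combined-π k) e)
        (trans (cong₂ (λ i j → bit (lookup (basis M₁ i) e) + bit (lookup (basis M₂ j) e)) e₁ e₂)
          (sym (Combined.equation (combined-π l) e))))))

  gluing : Gluing (#bases M) (#bases M₁) (#bases M₂)
  gluing = record
    { p₁ = π₁ ; p₂ = π₂
    ; t₁ = λ i → f₁ (lookup (basis M₁ i) c)
    ; t₂ = λ i → f₂ (lookup (basis M₂ i) c)
    ; compatible = λ j → proj₂ (proj₂ (proj₂ (components j)))
    ; pair = pairing
    ; joint-inj = π-inj }

  -- The equation of `Combined` summed over the factors of `u`; each factor brings one copy of `κ`
  -- at `c`, hence the degree.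
  multiplicity-combined : ∀ u e → bit κ * δ c e * deg u + multiplicity M u e
    ≡ multiplicity M₁ (push π₁ u) e + multiplicity M₂ (push π₂ u) e
  multiplicity-combined u e = begin
    bit κ * δ c e * deg u + multiplicity M u e
      ≡⟨ cong (_+ multiplicity M u e) (wt-const (bit κ * δ c e) u) ⟨
    wt (λ _ → bit κ * δ c e) u + multiplicity M u e
      ≡⟨ wt-+ (λ _ → bit κ * δ c e) _ u ⟨
    wt (λ j → bit κ * δ c e + bit (lookup (basis M j) e)) u
      ≡⟨ wt-cong (λ j → Combined.equation (combined-π j) e) u ⟩
    wt (λ j → bit (lookup (basis M₁ (π₁ j)) e) + bit (lookup (basis M₂ (π₂ j)) e)) u
      ≡⟨ wt-+ (λ j → bit (lookup (basis M₁ (π₁ j)) e)) _ u ⟩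
    wt (λ j → bit (lookup (basis M₁ (π₁ j)) e)) u + wt (λ j → bit (lookup (basis M₂ (π₂ j)) e)) u
      ≡⟨ cong₂ _+_ (wt-push π₁ _ u) (wt-push π₂ _ u) ⟨
    multiplicity M₁ (push π₁ u) e + multiplicity M₂ (push π₂ u) e ∎
    where open ≡-Reasoning

  fibreProduct : FibreProduct gluing (Fibre M) (Fibre M₁) (Fibre M₂)
  fibreProduct = record
    { refl₁ = Fibre-refl M₁
    ; refl₂ = Fibre-refl M₂
    ; project = project
    ; glue = glue
    ; match₁ = Fibre-match M₁ c f₁
    ; match₂ = Fibre-match M₂ c f₂ }
    where
    glue : ∀ {u v} → Fibre M₁ (push π₁ u) (push π₁ v) → Fibre M₂ (push π₂ u) (push π₂ v) → Fibre M u v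
    glue {u} {v} (fibre d h₁) (fibre _ h₂) = fibre degs λ e → +-cancelˡ-≡ (bit κ * δ c e * deg u) _ _
      (trans (multiplicity-combined u e) (trans (cong₂ _+_ (h₁ e) (h₂ e))
        (trans (sym (multiplicity-combined v e)) (cong (λ d → bit κ * δ c e * d + _) (sym degs)))))
      where
      degs : deg u ≡ deg v
      degs = trans (sym (deg-push π₁ u)) (trans d (deg-push π₁ v))
    -- Exponents of the first projection are known away from `c` by the separation of the ground
    -- sets, and at `c` from the total exponent, which the degree fixes. The second projection
    -- follows by subtraction.
    project : ∀ {u v} → Fibre M u v → Fibre M₁ (push π₁ u) (push π₁ v) × Fibre M₂ (push π₂ u) (push π₂ v)
    project {u} {v} (fibre d h) =
      fibre deg₁ same₁ ,
      fibre (trans (deg-push π₂ u) (trans d (sym (deg-push π₂ v))))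
        λ e → +-cancelˡ-≡ (multiplicity M₁ (push π₁ u) e) _ _ (trans (sum-same e) (cong (_+ _) (sym (same₁ e))))
      where
      deg₁ : deg (push π₁ u) ≡ deg (push π₁ v)
      deg₁ = trans (deg-push π₁ u) (trans d (sym (deg-push π₁ v)))
      sum-same : ∀ e → multiplicity M₁ (push π₁ u) e + multiplicity M₂ (push π₂ u) e
                     ≡ multiplicity M₁ (push π₁ v) e + multiplicity M₂ (push π₂ v) e
      sum-same e = trans (sym (multiplicity-combined u e))
        (trans (cong₂ (λ d m → bit κ * δ c e * d + m) d (h e)) (multiplicity-combined v e))
      off-c : ∀ e → e ≢ c → multiplicity M₁ (push π₁ u) e ≡ multiplicity M₁ (push π₁ v) e
      off-c e e≢c with disjoint e e≢c
      ... | inj₁ z = trans (multiplicity-outside mat₁ z (push π₁ u)) (sym (multiplicity-outside mat₁ z (push π₁ v)))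
      ... | inj₂ z = +-cancelʳ-≡ (multiplicity M₂ (push π₂ u) e) _ _ (trans (sum-same e)
        (cong (multiplicity M₁ (push π₁ v) e +_)
          (trans (multiplicity-outside mat₂ z (push π₂ v)) (sym (multiplicity-outside mat₂ z (push π₂ u))))))
      same₁ : ∀ e → multiplicity M₁ (push π₁ u) e ≡ multiplicity M₁ (push π₁ v) e
      same₁ e with e FinP.≟ c
      ... | no e≢c = off-c e e≢c
      ... | yes refl = sum-agree _ _ c off-c (sum-multiplicity-fibre mat₁ {push π₁ u} {push π₁ v} deg₁)

-- Minors, direct sums and connections

does⇒ : ∀ {p} {P : Set p} (d : Dec P) → ⌊ d ⌋ ≡ true → P
does⇒ (yes p) _ = p

⇒does : ∀ {p} {P : Set p} (d : Dec P) → P → ⌊ d ⌋ ≡ true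
⇒does (yes _) _ = refl
⇒does (no ¬p) p = ⊥-elim (¬p p)

∈ᵇ≡lookup : ∀ {N} (x : Fin N) X → (x ∈ᵇ X) ≡ lookup X x
∈ᵇ≡lookup x X with FSP._∈?_ x X
... | yes p = sym (VecP.[]=⇒lookup p)
... | no ¬p = sym (∉⇒lookup ¬p)

∧-true : ∀ {a b} → a ∧ b ≡ true → a ≡ true × b ≡ true
∧-true {true} {true} _ = refl , refl

∧-intro : ∀ {a b} → a ≡ true → b ≡ true → a ∧ b ≡ true
∧-intro refl refl = refl

not-true : ∀ {a} → not a ≡ true → a ≡ false
not-true {false} _ = refl

module _ {A : Set} (f : A → Bool) where

  any⁻ : ∀ xs → any f xs ≡ true → ∃[ x ] (x LM.∈ xs × f x ≡ true)
  any⁻ (x ∷ xs) h with f x in eq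
  ... | true  = x , here refl , eq
  ... | false = let y , m , e = any⁻ xs h in y , there m , e

  any⁺ : ∀ {xs x} → x LM.∈ xs → f x ≡ true → any f xs ≡ true
  any⁺ {x ∷ xs} (here refl) h = cong (_∨ any f xs) h
  any⁺ {y ∷ xs} (there m) h = trans (cong (f y ∨_) (any⁺ m h)) (BoolP.∨-zeroʳ (f y))

  all⁻ : ∀ {xs x} → all f xs ≡ true → x LM.∈ xs → f x ≡ true
  all⁻ h (here refl) = proj₁ (∧-true h)
  all⁻ {y ∷ xs} h (there m) = all⁻ (proj₂ (∧-true {f y} h)) m

  ¬all : ∀ xs → all f xs ≡ false → ∃[ x ] (x LM.∈ xs × f x ≡ false)
  ¬all (x ∷ xs) h with f x in eq
  ... | false = x , here refl , eq
  ... | true  = let y , m , e = ¬all xs h in y , there m , e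

module _ {N} (M : SetSystem N) (c : Fin N) where

  coloop⇒ : isColoopᵇ M c ≡ true → ∀ {B} → IsBasis M B → lookup B c ≡ true
  coloop⇒ h {B} b = trans (sym (∈ᵇ≡lookup c B)) (all⁻ (c ∈ᵇ_) (proj₂ (∧-true {c ∈ᵇ E M} h)) (∈-bases⁺ M b))

  ¬coloop⇒ : lookup (E M) c ≡ true → isColoopᵇ M c ≡ false → ∃[ B ] (IsBasis M B × lookup B c ≡ false)
  ¬coloop⇒ c∈E h =
    let B , m , e = ¬all (c ∈ᵇ_) (bases M) (trans (cong (_∧ all (c ∈ᵇ_) (bases M)) (sym (trans (∈ᵇ≡lookup c (E M)) c∈E))) h)
    in B , ∈-bases⁻ M m , trans (sym (∈ᵇ≡lookup c B)) e

  ¬loop⇒ : lookup (E M) c ≡ true → isLoopᵇ M c ≡ false → ∃[ B ] (IsBasis M B × lookup B c ≡ true)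
  ¬loop⇒ c∈E h =
    let B , m , e = any⁻ (c ∈ᵇ_) (bases M) (BoolP.not-injective (trans
                      (cong (_∧ not (any (c ∈ᵇ_) (bases M))) (sym (trans (∈ᵇ≡lookup c (E M)) c∈E))) h))
    in B , ∈-bases⁻ M m , trans (sym (∈ᵇ≡lookup c B)) e

  delete-¬coloop : isColoopᵇ M c ≡ false → ∀ X → isBasis (delete M c) X ≡ not (lookup X c) ∧ isBasis M X
  delete-¬coloop h X rewrite h = cong (λ b → not b ∧ isBasis M X) (∈ᵇ≡lookup c X)

  delete-coloop : isColoopᵇ M c ≡ true → ∀ X → isBasis (delete M c) X ≡ not (lookup X c) ∧ isBasis M (X ∪ ⁅ c ⁆)
  delete-coloop h X rewrite h = cong (λ b → not b ∧ isBasis M (X ∪ ⁅ c ⁆)) (∈ᵇ≡lookup c X)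

-- Both minors at c have, as bases, either the bases of M avoiding c or the bases through c with c removed.
data Minor {N} (M′ M : SetSystem N) (c : Fin N) : Set where
  avoiding : E M′ ≡ E M - c →
    (∀ {X} → IsBasis M′ X → lookup X c ≡ false × IsBasis M X) →
    (∀ {X} → lookup X c ≡ false → IsBasis M X → IsBasis M′ X) →
    ∃[ B ] (IsBasis M B × lookup B c ≡ false) → Minor M′ M c
  through : E M′ ≡ E M - c →
    (∀ {X} → IsBasis M′ X → lookup X c ≡ false × IsBasis M (X ∪ ⁅ c ⁆)) →
    (∀ {X} → lookup X c ≡ false → IsBasis M (X ∪ ⁅ c ⁆) → IsBasis M′ X) →
    ∃[ B ] (IsBasis M B × lookup B c ≡ true) → Minor M′ M c

lookup-removed : ∀ {N} (X : Subset N) c e → lookup (X - c) e ≡ lookup X e ∧ not (lookup ⁅ c ⁆ e)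
lookup-removed X c e = lookup-─ e X ⁅ c ⁆

removed-self : ∀ {N} (X : Subset N) c → lookup (X - c) c ≡ false
removed-self X c = trans (lookup-removed X c c)
  (trans (cong (λ b → lookup X c ∧ not b) (lookup-⁅⁆-same c)) (BoolP.∧-zeroʳ (lookup X c)))

removed-⊑ : ∀ {N} (X : Subset N) c → X - c ⊑ X
removed-⊑ X c e h = proj₁ (∧-true (trans (sym (lookup-removed X c e)) h))

⊑-removed : ∀ {N} {X Y : Subset N} {c} → X ⊑ Y → lookup X c ≡ false → X ⊑ Y - c
⊑-removed {X = X} {Y} {c} h hc e p = trans (lookup-removed Y c e) (∧-intro (h e p) (cong not (lookup-⁅⁆-diff λ c≡e →
  contradiction (trans (sym p) (subst (λ i → lookup X i ≡ false) c≡e hc)) λ ())))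

removed-insert : ∀ {N} (B : Subset N) c → lookup B c ≡ true → (B - c) ∪ ⁅ c ⁆ ≡ B
removed-insert B c h = lookup-ext λ e → trans (lookup-∪ e (B - c) _)
  (trans (cong (_∨ lookup ⁅ c ⁆ e) (lookup-removed B c e))
    (table (lookup B e) (lookup ⁅ c ⁆ e) λ p → subst (λ i → lookup B i ≡ true) (lookup-⁅⁆-true p) h))
  where
  table : ∀ b p → (p ≡ true → b ≡ true) → (b ∧ not p) ∨ p ≡ b
  table true  true  _ = refl
  table true  false _ = refl
  table false true  h = sym (h refl)
  table false false _ = refl

insert-⊒ : ∀ {N} (X : Subset N) c → X ⊑ X ∪ ⁅ c ⁆
insert-⊒ X c e h = trans (lookup-∪ e X ⁅ c ⁆) (cong (_∨ _) h)

module _ {N} (M : SetSystem N) (c : Fin N) (c∈E : lookup (E M) c ≡ true) (mat : IsMatroid M) where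
  open Matroid mat using (ground; nonempty)

  delete-minor : Minor (delete M c) M c
  delete-minor = by-coloop _ refl
    where
    by-coloop : ∀ b → isColoopᵇ M c ≡ b → Minor (delete M c) M c
    by-coloop false eq = avoiding refl
      (λ {X} h → let p , q = ∧-true (trans (sym (delete-¬coloop M c eq X)) h) in not-true p , q)
      (λ {X} p q → trans (delete-¬coloop M c eq X) (∧-intro (cong not p) q))
      (¬coloop⇒ M c c∈E eq)
    by-coloop true eq = through refl
      (λ {X} h → let p , q = ∧-true (trans (sym (delete-coloop M c eq X)) h) in not-true p , q)
      (λ {X} p q → trans (delete-coloop M c eq X) (∧-intro (cong not p) q))
      (let B , b = nonempty in B , b , coloop⇒ M c eq b)

  private
    -- Complement in the ground set of the minor, which is what the outer `dual` of a contraction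
    -- tests. Going back to `M` takes complements in `E M` instead, and there `c` has to be
    -- accounted for.
    co : Subset N → Subset N
    co X = (E M - c) ─ X

    lookup-co : ∀ X e → lookup (co X) e ≡ (lookup (E M) e ∧ not (lookup ⁅ c ⁆ e)) ∧ not (lookup X e)
    lookup-co X e = trans (lookup-─ e (E M - c) X) (cong (_∧ not (lookup X e)) (lookup-removed (E M) c e))

    c∈E-table : ∀ e → lookup ⁅ c ⁆ e ≡ true → lookup (E M) e ≡ true
    c∈E-table e p = subst (λ i → lookup (E M) i ≡ true) (lookup-⁅⁆-true p) c∈E

    co-c : ∀ X → lookup (co X) c ≡ false
    co-c X = trans (lookup-─ c (E M - c) X) (cong (_∧ not (lookup X c)) (removed-self (E M) c))

    co-⊑ : ∀ X → co X ⊑ E M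
    co-⊑ X e p = removed-⊑ (E M) c e (proj₁ (∧-true (trans (sym (lookup-─ e (E M - c) X)) p)))

    co-∪-⊑ : ∀ X → co X ∪ ⁅ c ⁆ ⊑ E M
    co-∪-⊑ X e p = [ co-⊑ X e , c∈E-table e ]′ (∨-true (trans (sym (lookup-∪ e (co X) ⁅ c ⁆)) p))
      where
      ∨-true : ∀ {a b} → a ∨ b ≡ true → a ≡ true ⊎ b ≡ true
      ∨-true {true}  _ = inj₁ refl
      ∨-true {false} h = inj₂ h

    E─co : ∀ {X} → X ⊑ E M - c → E M ─ co X ≡ X ∪ ⁅ c ⁆
    E─co {X} h = lookup-ext λ e → trans (lookup-─ e (E M) (co X)) (trans (cong (λ b → lookup (E M) e ∧ not b) (lookup-co X e))
      (trans (table (lookup (E M) e) (lookup ⁅ c ⁆ e) (lookup X e) (c∈E-table e)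
               (λ p → ∧-true (trans (sym (lookup-removed (E M) c e)) (h e p))))
             (sym (lookup-∪ e X ⁅ c ⁆))))
      where
      table : ∀ e p x → (p ≡ true → e ≡ true) → (x ≡ true → e ≡ true × not p ≡ true) →
        e ∧ not ((e ∧ not p) ∧ not x) ≡ x ∨ p
      table true  true  true  _ g = refl
      table true  true  false _ _ = refl
      table true  false true  _ _ = refl
      table true  false false _ _ = refl
      table false true  _     h _ = contradiction (h refl) λ ()
      table false false true  _ g = proj₁ (g refl)
      table false false false _ _ = refl

    E─co∪ : ∀ {X} → X ⊑ E M - c → E M ─ (co X ∪ ⁅ c ⁆) ≡ X
    E─co∪ {X} h = lookup-ext λ e → trans (lookup-─ e (E M) (co X ∪ ⁅ c ⁆))
      (trans (cong (λ b → lookup (E M) e ∧ not b) (trans (lookup-∪ e (co X) _) (cong (_∨ lookup ⁅ c ⁆ e) (lookup-co X e))))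
        (table (lookup (E M) e) (lookup ⁅ c ⁆ e) (lookup X e)
               (λ p → ∧-true (trans (sym (lookup-removed (E M) c e)) (h e p)))))
      where
      table : ∀ e p x → (x ≡ true → e ≡ true × not p ≡ true) →
        e ∧ not (((e ∧ not p) ∧ not x) ∨ p) ≡ x
      table true  true  true  g = proj₂ (g refl)
      table true  true  false _ = refl
      table true  false true  _ = refl
      table true  false false _ = refl
      table false _     true  g = proj₁ (g refl)
      table false _     false _ = refl

    dual-basis⁻ : ∀ {Y} → IsBasis (dual M) Y → IsBasis M (E M ─ Y)
    dual-basis⁻ {Y} h = proj₂ (∧-true {Y ⊆ᵇ E M} h)

    dual-basis⁺ : ∀ {Y} → Y ⊑ E M → IsBasis M (E M ─ Y) → IsBasis (dual M) Y
    dual-basis⁺ {Y} h b = ∧-intro (⇒does (FSP._⊆?_ Y (E M)) (⊑⇒⊆ h)) b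

    contract⁻ : ∀ {X} → IsBasis (contract M c) X → X ⊑ E M - c × IsBasis (delete (dual M) c) (co X)
    contract⁻ {X} h = let p , q = ∧-true {X ⊆ᵇ (E M - c)} h in ⊆⇒⊑ (does⇒ (FSP._⊆?_ X (E M - c)) p) , q

    contract⁺ : ∀ {X} → X ⊑ E M - c → IsBasis (delete (dual M) c) (co X) → IsBasis (contract M c) X
    contract⁺ {X} h b = ∧-intro (⇒does (FSP._⊆?_ X (E M - c)) (⊑⇒⊆ h)) b

    ⊑E-c⇒ : ∀ {X} → X ⊑ E M - c → lookup X c ≡ false
    ⊑E-c⇒ h = BoolP.¬-not λ p → contradiction (trans (sym (h c p)) (removed-self (E M) c)) λ ()

    E─E─ : ∀ {B} → B ⊑ E M → E M ─ (E M ─ B) ≡ B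
    E─E─ {B} h = lookup-ext λ e → trans (lookup-─ e (E M) (E M ─ B))
      (trans (cong (λ b → lookup (E M) e ∧ not b) (lookup-─ e (E M) B)) (table (lookup (E M) e) (lookup B e) (h e)))
      where
      table : ∀ e b → (b ≡ true → e ≡ true) → e ∧ not (e ∧ not b) ≡ b
      table true  true  _ = refl
      table true  false _ = refl
      table false true  h = h refl
      table false false _ = refl

    ─-⊑ : ∀ (X Y : Subset N) → X ─ Y ⊑ X
    ─-⊑ X Y e p = proj₁ (∧-true (trans (sym (lookup-─ e X Y)) p))

  -- Complements make the two cases of deletion trade places: if some basis of the dual avoids `c`,
  -- its complement is a basis of `M` through `c`; if all bases of the dual contain `c`, no basis of
  -- `M` does.
  contract-minor : Minor (contract M c) M c
  contract-minor = by-coloop _ refl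
    where
    by-coloop : ∀ b → isColoopᵇ (dual M) c ≡ b → Minor (contract M c) M c
    by-coloop false eq = through refl
      (λ {X} h → let X⊑ , b = contract⁻ {X} h
                     _ , q = ∧-true {not (lookup (co X) c)} (trans (sym (delete-¬coloop (dual M) c eq (co X))) b)
                 in ⊑E-c⇒ {X} X⊑ , subst (IsBasis M) (E─co {X} X⊑) (dual-basis⁻ {co X} q))
      (λ {X} hc b → let X⊑ = ⊑-removed {X = X} {E M} (λ e p → ground b e (insert-⊒ X c e p)) hc
                    in contract⁺ {X} X⊑ (trans (delete-¬coloop (dual M) c eq (co X)) (∧-intro (cong not (co-c X))
                         (dual-basis⁺ {co X} (co-⊑ X) (subst (IsBasis M) (sym (E─co {X} X⊑)) b)))))
      (let Y , y , yc = ¬coloop⇒ (dual M) c c∈E eq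
       in E M ─ Y , dual-basis⁻ y , trans (lookup-─ c (E M) Y) (∧-intro c∈E (cong not yc)))
    by-coloop true eq = avoiding refl
      (λ {X} h → let X⊑ , b = contract⁻ {X} h
                     _ , q = ∧-true {not (lookup (co X) c)} (trans (sym (delete-coloop (dual M) c eq (co X))) b)
                 in ⊑E-c⇒ {X} X⊑ , subst (IsBasis M) (E─co∪ {X} X⊑) (dual-basis⁻ {co X ∪ ⁅ c ⁆} q))
      (λ {X} hc b → let X⊑ = ⊑-removed {X = X} {E M} (ground b) hc
                    in contract⁺ {X} X⊑ (trans (delete-coloop (dual M) c eq (co X)) (∧-intro (cong not (co-c X))
                         (dual-basis⁺ {co X ∪ ⁅ c ⁆} (co-∪-⊑ X) (subst (IsBasis M) (sym (E─co∪ {X} X⊑)) b)))))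
      (let B , b = nonempty
           B⊑ = ground b
           Y∈ = coloop⇒ (dual M) c eq (dual-basis⁺ {E M ─ B} (─-⊑ (E M) B) (subst (IsBasis M) (sym (E─E─ {B} B⊑)) b))
       in B , b , not-true (proj₂ (∧-true (trans (sym (lookup-─ c (E M) B)) Y∈))))

-- Minors as composites with the matroid of rank 0

trivial : ∀ {N} → SetSystem N
trivial = ⟨ FS.⊥ , _== FS.⊥ ⟩

trivial-basis⁻ : ∀ {N} {D : Subset N} → IsBasis trivial D → D ≡ FS.⊥
trivial-basis⁻ {D = D} = does⇒ (VecP.≡-dec BoolP._≟_ D FS.⊥)

trivial-basis⁺ : ∀ {N} → IsBasis (trivial {N}) FS.⊥
trivial-basis⁺ {N} = ⇒does (VecP.≡-dec BoolP._≟_ (FS.⊥ {N}) FS.⊥) refl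

lookup-⊥ : ∀ {N} (e : Fin N) → lookup FS.⊥ e ≡ false
lookup-⊥ e = VecP.lookup-replicate e false

trivial-isMatroid : ∀ {N} → IsMatroid (trivial {N})
trivial-isMatroid = record
  { nonempty = FS.⊥ , trivial-basis⁺
  ; ⊆ground = λ B b → FSP.⊆-reflexive (trivial-basis⁻ b)
  ; exchange = λ B₁ B₂ b₁ _ x x∈ → ⊥-elim (FSP.∉⊥ (subst (x ∈_) (trivial-basis⁻ b₁) x∈)) }

module _ {N} {M′ M : SetSystem N} {c : Fin N} (mat : IsMatroid M) where
  open Matroid mat using (ground)

  private
    Combined-⊥ : ∀ {X B} → (∀ e → bit (lookup X e) ≡ bit (lookup B e)) → Combined false c X B FS.⊥
    Combined-⊥ {B = B} h = combined λ e → trans (h e)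
      (sym (trans (cong (λ b → bit (lookup B e) + bit b) (lookup-⊥ e)) (+-identityʳ _)))

    Combined-⊥⁻ : ∀ {X B D} → IsBasis trivial D → Combined false c X B D → X ≡ B
    Combined-⊥⁻ {X} {B} {D} d (combined h) = lookup-ext λ e → bit-inj (trans (h e)
      (trans (cong (λ D → bit (lookup B e) + bit (lookup D e)) (trivial-basis⁻ d))
        (trans (cong (λ b → bit (lookup B e) + bit b) (lookup-⊥ e)) (+-identityʳ _))))

    Combined-insert : ∀ {X} → lookup X c ≡ false → Combined true c X (X ∪ ⁅ c ⁆) FS.⊥
    Combined-insert {X} hc = combined λ e → trans (cong (_+ bit (lookup X e)) (+-identityʳ (δ c e)))
      (trans (cong (_+ bit (lookup X e)) (sym (lookup-⁅⁆ c e)))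
        (trans (table (lookup X e) (lookup ⁅ c ⁆ e) λ p → subst (λ i → lookup X i ≡ false) (lookup-⁅⁆-true p) hc)
          (cong₂ (λ a b → bit a + bit b) (sym (lookup-∪ e X ⁅ c ⁆)) (sym (lookup-⊥ e)))))
      where
      table : ∀ x p → (p ≡ true → x ≡ false) → bit p + bit x ≡ bit (x ∨ p) + 0
      table true  true  h = contradiction (h refl) λ ()
      table true  false _ = refl
      table false true  _ = refl
      table false false _ = refl

    Combined-insert⁻ : ∀ {X B D} → IsBasis trivial D → lookup X c ≡ false → Combined true c X B D → X ∪ ⁅ c ⁆ ≡ B
    Combined-insert⁻ {X} {B} {D} d hc (combined h) = lookup-ext λ e → bit-inj (+-cancelʳ-≡ 0 _ _ (begin
      bit (lookup (X ∪ ⁅ c ⁆) e) + 0                       ≡⟨ cong (λ b → bit (lookup (X ∪ ⁅ c ⁆) e) + bit b) (lookup-⊥ e) ⟨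
      bit (lookup (X ∪ ⁅ c ⁆) e) + bit (lookup FS.⊥ e)     ≡⟨ Combined.equation (Combined-insert {X} hc) e ⟨
      bit true * δ c e + bit (lookup X e)                 ≡⟨ h e ⟩
      bit (lookup B e) + bit (lookup D e)                 ≡⟨ cong (λ D → bit (lookup B e) + bit (lookup D e)) (trivial-basis⁻ d) ⟩
      bit (lookup B e) + bit (lookup FS.⊥ e)              ≡⟨ cong (λ b → bit (lookup B e) + bit b) (lookup-⊥ e) ⟩
      bit (lookup B e) + 0                                ∎))
      where open ≡-Reasoning

    trivial-c : ∀ {D} → IsBasis trivial D → ¬ lookup D c ≡ true
    trivial-c d p = contradiction (trans (sym p) (trans (cong (λ D → lookup D c) (trivial-basis⁻ d)) (lookup-⊥ c))) λ ()

    avoids : ∀ {X} → X ⊑ E M - c → lookup X c ≡ false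
    avoids h = BoolP.¬-not λ p → contradiction (trans (sym (h c p)) (removed-self (E M) c)) λ ()

  -- `D` is empty, so the condition at `c` falls on `B` alone: `f₁ = id` forces `c` out of `B`, and
  -- `f₁ = not` forces it in. In the second case `κ = true` removes it again.
  minor-composite : Minor M′ M c → Composite M′ M trivial c
  minor-composite (avoiding E≡ to from _) = record
    { κ = false ; f₁ = id ; f₂ = id
    ; in-ground = λ {X} x → let hc , b = to x in subst (X ⊑_) (sym E≡) (⊑-removed {X = X} {E M} (ground b) hc)
    ; disjoint = λ e _ → inj₂ (lookup-⊥ e)
    ; split = λ {X} x → let hc , b = to x in
        X , FS.⊥ , b , trivial-basis⁺ , Combined-⊥ (λ _ → refl) , λ p → contradiction (trans (sym p) hc) λ ()
    ; complete = λ {X} X⊑ b d h → from (avoids {X} (subst (X ⊑_) E≡ X⊑)) (subst (IsBasis M) (sym (Combined-⊥⁻ d h)) b)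
    ; combine = λ {B} b d ok → B , from (BoolP.¬-not λ p → trivial-c d (ok p)) b ,
        subst (Combined false c B B) (sym (trivial-basis⁻ d)) (Combined-⊥ λ _ → refl) }
  minor-composite (through E≡ to from _) = record
    { κ = true ; f₁ = not ; f₂ = id
    ; in-ground = λ {X} x → let hc , b = to x in
        subst (X ⊑_) (sym E≡) (⊑-removed {X = X} {E M} (λ e p → ground b e (insert-⊒ X c e p)) hc)
    ; disjoint = λ e _ → inj₂ (lookup-⊥ e)
    ; split = λ {X} x → let hc , b = to x in
        X ∪ ⁅ c ⁆ , FS.⊥ , b , trivial-basis⁺ , Combined-insert hc ,
        λ p → contradiction (trans (sym (trans (lookup-∪ c X ⁅ c ⁆)
          (trans (cong (lookup X c ∨_) (lookup-⁅⁆-same c)) (BoolP.∨-zeroʳ (lookup X c))))) (not-true p)) λ ()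
    ; complete = λ {X} X⊑ b d h → let hc = avoids {X} (subst (X ⊑_) E≡ X⊑) in
        from hc (subst (IsBasis M) (sym (Combined-insert⁻ d hc h)) b)
    ; combine = λ {B} b d ok →
        let hB = removed-insert B c (BoolP.¬-not λ p → trivial-c d (ok (cong not p))) in
        B - c , from (removed-self B c) (subst (IsBasis M) (sym hB) b) ,
        subst₂ (Combined true c (B - c)) hB (sym (trivial-basis⁻ d)) (Combined-insert (removed-self B c)) }

  minor-nonempty : Minor M′ M c → ∃ (IsBasis M′)
  minor-nonempty (avoiding _ _ from (B , b , hc)) = B , from hc b
  minor-nonempty (through _ _ from (B , b , hc)) =
    B - c , from (removed-self B c) (subst (IsBasis M) (sym (removed-insert B c hc)) b)

-- Direct sums and connections as composites

∨-sum : ∀ {p q} → (p ≡ true → q ≡ false) → bit (p ∨ q) ≡ bit p + bit q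
∨-sum {true}  {true}  h = contradiction (h refl) λ ()
∨-sum {true}  {false} _ = refl
∨-sum {false} {q}     _ = refl

lookup-∪⁻ : ∀ {N} {X Y : Subset N} {e} → lookup (X ∪ Y) e ≡ true → lookup X e ≡ true ⊎ lookup Y e ≡ true
lookup-∪⁻ {X = X} {Y} {e} h with lookup X e in eq
... | true  = inj₁ refl
... | false = inj₂ (trans (trans (cong (_∨ lookup Y e) (sym eq)) (sym (lookup-∪ e X Y))) h)

lookup-∪⁺ˡ : ∀ {N} (X Y : Subset N) {e} → lookup X e ≡ true → lookup (X ∪ Y) e ≡ true
lookup-∪⁺ˡ X Y {e} h = trans (lookup-∪ e X Y) (cong (_∨ lookup Y e) h)

lookup-∪⁺ʳ : ∀ {N} (X Y : Subset N) {e} → lookup Y e ≡ true → lookup (X ∪ Y) e ≡ true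
lookup-∪⁺ʳ X Y {e} h = trans (lookup-∪ e X Y) (trans (cong (lookup X e ∨_) h) (BoolP.∨-zeroʳ (lookup X e)))

module _ {N} {M₁ M₂ : SetSystem N} (mat₁ : IsMatroid M₁) (mat₂ : IsMatroid M₂) (c : Fin N) where
  private
    module M₁ = Matroid mat₁
    module M₂ = Matroid mat₂

  union-combined : ∀ {B D : Subset N} → (∀ e → lookup B e ≡ true → lookup D e ≡ false) → Combined false c (B ∪ D) B D
  union-combined {B} {D} h = combined λ e → trans (cong bit (lookup-∪ e B D)) (∨-sum (h e))

  private
    exclusive : ∀ {B D e} → IsBasis M₁ B → IsBasis M₂ D →
      lookup (E M₁) e ≡ false ⊎ lookup (E M₂) e ≡ false → lookup B e ≡ true → lookup D e ≡ false
    exclusive b d (inj₁ z) p = contradiction (trans (sym p) (M₁.outside b z)) λ ()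
    exclusive b d (inj₂ z) _ = M₂.outside d z

    union-⊑ : ∀ {B D} → IsBasis M₁ B → IsBasis M₂ D → B ∪ D ⊑ E M₁ ∪ E M₂
    union-⊑ {B} {D} b d e p = [ (λ q → lookup-∪⁺ˡ (E M₁) (E M₂) (M₁.ground b e q))
                              , (λ q → lookup-∪⁺ʳ (E M₁) (E M₂) (M₂.ground d e q)) ]′ (lookup-∪⁻ {X = B} {D} p)

  module DirectSum (disjoint : ∀ e → lookup (E M₁) e ≡ false ⊎ lookup (E M₂) e ≡ false) where

    private
      restrict : ∀ {X B D : Subset N} {E₁ E₂} → B ⊑ E₁ → D ⊑ E₂ →
        (∀ e → lookup E₁ e ≡ false ⊎ lookup E₂ e ≡ false) →
        (∀ e → bit (lookup X e) ≡ bit (lookup B e) + bit (lookup D e)) → X ∩ E₁ ≡ B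
      restrict {X} {B} {D} {E₁} {E₂} hB hD dis h = lookup-ext λ e → trans (lookup-∩ e X E₁)
        (table (lookup X e) (lookup B e) (lookup D e) (lookup E₁ e) (lookup E₂ e) (h e) (hB e) (hD e) (dis e))
        where
        table : ∀ x b d p q → bit x ≡ bit b + bit d → (b ≡ true → p ≡ true) → (d ≡ true → q ≡ true) →
          p ≡ false ⊎ q ≡ false → x ∧ p ≡ b
        table x b     d     true  true  _ _ _ (inj₁ ())
        table x b     d     true  true  _ _ _ (inj₂ ())
        table x b     true  true  false _ _ g _ = contradiction (g refl) λ ()
        table x b     false true  false h _ _ _ =
          trans (BoolP.∧-identityʳ x) (bit-inj (trans h (+-identityʳ (bit b))))
        table x true  d     false q     _ g _ _ = contradiction (g refl) λ ()
        table x false d     false q     _ _ _ _ = BoolP.∧-zeroʳ x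

      restrictions-combined : ∀ {X} → X ⊑ E M₁ ∪ E M₂ → Combined false c X (X ∩ E M₁) (X ∩ E M₂)
      restrictions-combined {X} h = combined λ e →
        trans (table (lookup X e) (lookup (E M₁) e) (lookup (E M₂) e) (λ p → trans (sym (lookup-∪ e (E M₁) _)) (h e p)) (disjoint e))
          (cong₂ (λ a b → bit a + bit b) (sym (lookup-∩ e X (E M₁))) (sym (lookup-∩ e X (E M₂))))
        where
        table : ∀ x p q → (x ≡ true → p ∨ q ≡ true) → p ≡ false ⊎ q ≡ false → bit x ≡ bit (x ∧ p) + bit (x ∧ q)
        table false p     q     _ _ = refl
        table true  true  false _ _ = refl
        table true  false true  _ _ = refl
        table true  false false h _ = contradiction (h refl) λ ()
        table true  true  true  _ (inj₁ ())
        table true  true  true  _ (inj₂ ())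

      ⊕⁻ : ∀ {X} → IsBasis (M₁ ⊕ M₂) X → X ⊑ E M₁ ∪ E M₂ × IsBasis M₁ (X ∩ E M₁) × IsBasis M₂ (X ∩ E M₂)
      ⊕⁻ {X} h = let p , q = ∧-true {X ⊆ᵇ (E M₁ ∪ E M₂)} h
                     r , s = ∧-true {isBasis M₁ (X ∩ E M₁)} q
                 in ⊆⇒⊑ (does⇒ (FSP._⊆?_ X (E M₁ ∪ E M₂)) p) , r , s

      ⊕⁺ : ∀ {X B D} → X ⊑ E M₁ ∪ E M₂ → IsBasis M₁ B → IsBasis M₂ D → Combined false c X B D → IsBasis (M₁ ⊕ M₂) X
      ⊕⁺ {X} {B} {D} X⊑ b d (combined h) = ∧-intro (⇒does (FSP._⊆?_ X (E M₁ ∪ E M₂)) (⊑⇒⊆ X⊑))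
        (∧-intro (subst (IsBasis M₁) (sym (restrict {X} {B} {D} {E M₁} {E M₂} (M₁.ground b) (M₂.ground d) disjoint h)) b)
                 (subst (IsBasis M₂) (sym (restrict {X} {D} {B} {E M₂} {E M₁} (M₂.ground d) (M₁.ground b)
                   (λ e → Sum.swap (disjoint e)) λ e → trans (h e) (+-comm (bit (lookup B e)) _))) d))

    -- Disjoint ground sets keep `c` out of `B` or out of `D`, so the condition that `c` is not in
    -- both admits all pairs.
    composite : Composite (M₁ ⊕ M₂) M₁ M₂ c
    composite = record
      { κ = false ; f₁ = id ; f₂ = not
      ; in-ground = λ {X} x → proj₁ (⊕⁻ {X} x)
      ; disjoint = λ e _ → disjoint e
      ; split = λ {X} x → let X⊑ , b , d = ⊕⁻ {X} x in X ∩ E M₁ , X ∩ E M₂ , b , d , restrictions-combined {X} X⊑ ,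
          λ p → cong not (exclusive b d (disjoint c) p)
      ; complete = ⊕⁺
      ; combine = λ {B} {D} b d _ →
          let h = union-combined {B} {D} λ e → exclusive b d (disjoint e)
          in B ∪ D , ⊕⁺ (union-⊑ b d) b d h , h }

    nonempty : ∃ (IsBasis (M₁ ⊕ M₂))
    nonempty = let B , b = M₁.nonempty
                   D , d = M₂.nonempty
                   X , x , _ = Composite.combine composite b d
                     λ p → cong not (exclusive b d (disjoint c) p)
               in X , x

  module AtPoint (disjoint : ∀ e → e ≢ c → lookup (E M₁) e ≡ false ⊎ lookup (E M₂) e ≡ false) where

    private
      any₂⁻ : ∀ (f : Subset N → Subset N → Bool) → any (λ B → any (f B) (bases M₂)) (bases M₁) ≡ true →
        ∃[ B ] ∃[ D ] (IsBasis M₁ B × IsBasis M₂ D × f B D ≡ true)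
      any₂⁻ f h =
        let B , b , h₁ = any⁻ (λ B → any (f B) (bases M₂)) (bases M₁) h
            D , d , h₂ = any⁻ (f B) (bases M₂) h₁
        in B , D , ∈-bases⁻ M₁ b , ∈-bases⁻ M₂ d , h₂

      any₂⁺ : ∀ (f : Subset N → Subset N → Bool) {B D} → IsBasis M₁ B → IsBasis M₂ D → f B D ≡ true →
        any (λ B → any (f B) (bases M₂)) (bases M₁) ≡ true
      any₂⁺ f {B} b d h = any⁺ (λ B → any (f B) (bases M₂)) (∈-bases⁺ M₁ b) (any⁺ (f B) (∈-bases⁺ M₂ d) h)

      _==⁻_ : ∀ (X Y : Subset N) → (X == Y) ≡ true → X ≡ Y
      X ==⁻ Y = does⇒ (VecP.≡-dec BoolP._≟_ X Y)

      _==⁺_ : ∀ (X Y : Subset N) → X ≡ Y → (X == Y) ≡ true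
      X ==⁺ Y = ⇒does (VecP.≡-dec BoolP._≟_ X Y)

      off-c : ∀ {B D e} → IsBasis M₁ B → IsBasis M₂ D → e ≢ c → lookup B e ≡ true → lookup D e ≡ false
      off-c b d e≢c = exclusive b d (disjoint _ e≢c)

    module Series where

      private
        to : ∀ {X} → IsBasis (seriesGen M₁ M₂) X →
          ∃[ B ] ∃[ D ] (IsBasis M₁ B × IsBasis M₂ D × B ∩ D ≡ FS.⊥ × X ≡ B ∪ D)
        to {X} x = let B , D , b , d , h = any₂⁻ (λ B D → ((B ∩ D) == FS.⊥) ∧ (X == (B ∪ D))) x
                       p , q = ∧-true h
                   in B , D , b , d , ((B ∩ D) ==⁻ FS.⊥) p , (X ==⁻ (B ∪ D)) q

        from : ∀ {X B D} → IsBasis M₁ B → IsBasis M₂ D → B ∩ D ≡ FS.⊥ → X ≡ B ∪ D → IsBasis (seriesGen M₁ M₂) X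
        from {X} {B} {D} b d p q = any₂⁺ (λ B D → ((B ∩ D) == FS.⊥) ∧ (X == (B ∪ D))) b d
          (∧-intro (((B ∩ D) ==⁺ FS.⊥) p) ((X ==⁺ (B ∪ D)) q))

        ∩-⊥⁻ : ∀ {B D : Subset N} → B ∩ D ≡ FS.⊥ → ∀ e → lookup B e ≡ true → lookup D e ≡ false
        ∩-⊥⁻ {B} {D} h e p = BoolP.¬-not λ q → contradiction
          (trans (sym (trans (lookup-∩ e B D) (∧-intro p q))) (trans (cong (λ Z → lookup Z e) h) (lookup-⊥ e))) λ ()

        ∩-⊥⁺ : ∀ {B D : Subset N} → (∀ e → lookup B e ≡ true → lookup D e ≡ false) → B ∩ D ≡ FS.⊥
        ∩-⊥⁺ {B} {D} h = lookup-ext λ e → trans (lookup-∩ e B D)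
          (trans (table (lookup B e) (lookup D e) (h e)) (sym (lookup-⊥ e)))
          where
          table : ∀ b d → (b ≡ true → d ≡ false) → b ∧ d ≡ false
          table true  d h = h refl
          table false _ _ = refl

        -- A sum of two indicators that is itself an indicator never reaches 2, so the equation with
        -- `κ = false` already contains the disjointness of `B` and `D`.
        from-combined : ∀ {X B D} → IsBasis M₁ B → IsBasis M₂ D → Combined false c X B D → IsBasis (seriesGen M₁ M₂) X
        from-combined {X} {B} {D} b d (combined h) = from b d (∩-⊥⁺ λ e → proj₁ (table (lookup X e) (lookup B e) (lookup D e) (h e)))
          (lookup-ext λ e → trans (proj₂ (table (lookup X e) (lookup B e) (lookup D e) (h e))) (sym (lookup-∪ e B D)))
          where
          table : ∀ x b d → bit x ≡ bit b + bit d → (b ≡ true → d ≡ false) × x ≡ b ∨ d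
          table true  true  true  ()
          table false true  true  ()
          table x     true  false h = (λ _ → refl) , bit-inj h
          table x     false d     h = (λ ()) , bit-inj h

      composite : Composite (seriesGen M₁ M₂) M₁ M₂ c
      composite = record
        { κ = false ; f₁ = id ; f₂ = not
        ; in-ground = λ {X} x → let B , D , b , d , _ , e = to {X} x in
            subst (_⊑ E M₁ ∪ E M₂) (sym e) (union-⊑ b d)
        ; disjoint = disjoint
        ; split = λ {X} x → let B , D , b , d , h , e = to {X} x in
            B , D , b , d , subst (λ X → Combined false c X B D) (sym e) (union-combined (∩-⊥⁻ {B} {D} h)) ,
            λ p → cong not (∩-⊥⁻ {B} {D} h c p)
        ; complete = λ _ → from-combined
        ; combine = λ {B} {D} b d ok →
            let h = union-combined {B} {D} λ e p → combine-exclusive b d ok e p (e FinP.≟ c)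
            in B ∪ D , from-combined b d h , h }
        where
        combine-exclusive : ∀ {B D} → IsBasis M₁ B → IsBasis M₂ D → (lookup B c ≡ true → not (lookup D c) ≡ true) →
          ∀ e → lookup B e ≡ true → Dec (e ≡ c) → lookup D e ≡ false
        combine-exclusive b d ok e p (yes refl) = not-true (ok p)
        combine-exclusive b d ok e p (no e≢c)   = off-c b d e≢c p

      -- A basis of `M₁` avoiding `c` is admissible with every basis of `M₂`.
      nonempty : ∃[ B ] (IsBasis M₁ B × lookup B c ≡ false) → ∃ (IsBasis (seriesGen M₁ M₂))
      nonempty (B , b , hc) = let D , d = M₂.nonempty
                                  X , x , _ = Composite.combine composite b d λ p → contradiction (trans (sym p) hc) λ ()
                              in X , x

    module Parallel where

      private
        union-off : ∀ {B D e} → IsBasis M₁ B → IsBasis M₂ D → e ≢ c →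
          bit (lookup (B ∪ D) e) ≡ bit (lookup B e) + bit (lookup D e)
        union-off {B} {D} {e} b d e≢c = trans (cong bit (lookup-∪ e B D)) (∨-sum (off-c b d e≢c))

        removed-off : ∀ {X : Subset N} {e} → e ≢ c → lookup (X - c) e ≡ lookup X e
        removed-off {X} {e} e≢c = trans (lookup-removed X c e)
          (trans (cong (λ b → lookup X e ∧ not b) (lookup-⁅⁆-diff (e≢c ∘ sym))) (BoolP.∧-identityʳ (lookup X e)))

        by-cases : ∀ {X B D} → (∀ e → e ≢ c → bit (lookup X e) ≡ bit (lookup B e) + bit (lookup D e)) →
          1 + bit (lookup X c) ≡ bit (lookup B c) + bit (lookup D c) → Combined true c X B D
        by-cases {X} {B} {D} off at = combined λ e → equation e (e FinP.≟ c)
          where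
          equation : ∀ e → Dec (e ≡ c) → 1 * δ c e + bit (lookup X e) ≡ bit (lookup B e) + bit (lookup D e)
          equation e (yes refl) = trans (cong (λ a → 1 * a + bit (lookup X c)) (δ-same c)) at
          equation e (no e≢c)   = trans (cong (λ a → 1 * a + bit (lookup X e)) (δ-diff (e≢c ∘ sym))) (off e e≢c)

        both : ∀ {B D} → IsBasis M₁ B → IsBasis M₂ D → lookup B c ≡ true → lookup D c ≡ true →
          Combined true c (B ∪ D) B D
        both {B} {D} b d p q = by-cases (λ _ → union-off b d)
          (trans (cong (λ x → 1 + bit x) (lookup-∪⁺ˡ B D p)) (cong₂ (λ a b → bit a + bit b) (sym p) (sym q)))

        one : ∀ {B D} → IsBasis M₁ B → IsBasis M₂ D → bit (lookup B c) + bit (lookup D c) ≡ 1 →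
          Combined true c ((B ∪ D) - c) B D
        one {B} {D} b d h = by-cases (λ e e≢c → trans (cong bit (removed-off {B ∪ D} e≢c)) (union-off b d e≢c))
          (trans (cong (λ x → 1 + bit x) (removed-self (B ∪ D) c)) (sym h))

        Combined-unique : ∀ {X X′ B D} → Combined true c X B D → Combined true c X′ B D → X ≡ X′
        Combined-unique (combined h) (combined h′) =
          lookup-ext λ e → bit-inj (+-cancelˡ-≡ (1 * δ c e) _ _ (trans (h e) (sym (h′ e))))

        -- The test in `parallelGen` is local to a `where` block and cannot be named here; the pair
        -- lets unification find it from `refl`.
        test : ∀ X → Σ (Subset N → Subset N → Bool) λ f →
          isBasis (parallelGen M₁ M₂ c) X ≡ any (λ B → any (f B) (bases M₂)) (bases M₁)
        test X = _ , refl

        to : ∀ {X} → IsBasis (parallelGen M₁ M₂ c) X →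
          ∃[ B ] ∃[ D ] (IsBasis M₁ B × IsBasis M₂ D × Combined true c X B D)
        to {X} x with any₂⁻ (proj₁ (test X)) x
        ... | B , D , b , d , h with c ∈ᵇ B in p | c ∈ᵇ D in q
        ... | true | true = B , D , b , d , subst (λ X → Combined true c X B D) (sym ((X ==⁻ (B ∪ D)) h))
          (both b d (trans (sym (∈ᵇ≡lookup c B)) p) (trans (sym (∈ᵇ≡lookup c D)) q))
        ... | true | false = B , D , b , d , subst (λ X → Combined true c X B D) (sym ((X ==⁻ ((B ∪ D) - c)) h))
          (one b d (cong₂ (λ a b → bit a + bit b) (trans (sym (∈ᵇ≡lookup c B)) p) (trans (sym (∈ᵇ≡lookup c D)) q)))
        ... | false | true = B , D , b , d , subst (λ X → Combined true c X B D) (sym ((X ==⁻ ((B ∪ D) - c)) h))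
          (one b d (cong₂ (λ a b → bit a + bit b) (trans (sym (∈ᵇ≡lookup c B)) p) (trans (sym (∈ᵇ≡lookup c D)) q)))

        passes : ∀ {X B D} → IsBasis M₁ B → IsBasis M₂ D → Combined true c X B D → proj₁ (test X) B D ≡ true
        passes {X} {B} {D} b d h with c ∈ᵇ B in p | c ∈ᵇ D in q
        ... | true | true = (X ==⁺ (B ∪ D)) (Combined-unique h
          (both b d (trans (sym (∈ᵇ≡lookup c B)) p) (trans (sym (∈ᵇ≡lookup c D)) q)))
        ... | true | false = (X ==⁺ ((B ∪ D) - c)) (Combined-unique h
          (one b d (cong₂ (λ a b → bit a + bit b) (trans (sym (∈ᵇ≡lookup c B)) p) (trans (sym (∈ᵇ≡lookup c D)) q))))
        ... | false | true = (X ==⁺ ((B ∪ D) - c)) (Combined-unique h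
          (one b d (cong₂ (λ a b → bit a + bit b) (trans (sym (∈ᵇ≡lookup c B)) p) (trans (sym (∈ᵇ≡lookup c D)) q))))
        ... | false | false = contradiction (trans (Combined.at h)
          (cong₂ (λ a b → bit a + bit b) (trans (sym (∈ᵇ≡lookup c B)) p) (trans (sym (∈ᵇ≡lookup c D)) q))) λ ()

        from : ∀ {X B D} → IsBasis M₁ B → IsBasis M₂ D → Combined true c X B D → IsBasis (parallelGen M₁ M₂ c) X
        from {X} b d h = any₂⁺ (proj₁ (test X)) b d (passes b d h)

      -- With `κ = true` one equation covers both kinds of basis: `c` in both gives `1 + 1 = 2` and
      -- `c` stays, `c` in exactly one gives `1 + 0 = 1` and `c` goes. The sum 0 is impossible,
      -- which is the condition.
      composite : Composite (parallelGen M₁ M₂ c) M₁ M₂ c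
      composite = record
        { κ = true ; f₁ = not ; f₂ = id
        ; in-ground = λ {X} x → let B , D , b , d , h = to {X} x in in-union b d h
        ; disjoint = disjoint
        ; split = λ {X} x → let B , D , b , d , h = to {X} x in B , D , b , d , h , admissible h
        ; complete = λ _ → from
        ; combine = λ b d ok → let X , h = sum b d ok in X , from b d h , h }
        where
        admissible : ∀ {X B D} → Combined true c X B D → not (lookup B c) ≡ true → lookup D c ≡ true
        admissible {X} {B} {D} h p = BoolP.¬-not λ q →
          contradiction (trans (Combined.at h) (cong₂ (λ a b → bit a + bit b) (not-true p) q)) λ ()
        in-union : ∀ {X B D} → IsBasis M₁ B → IsBasis M₂ D → Combined true c X B D → X ⊑ E M₁ ∪ E M₂
        in-union {X} {B} {D} b d (combined h) e p =
          union-⊑ b d e (trans (lookup-∪ e B D)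
            (table (1 * δ c e) (lookup B e) (lookup D e) (trans (cong (λ x → 1 * δ c e + bit x) (sym p)) (h e))))
          where
          table : ∀ k b d → k + 1 ≡ bit b + bit d → b ∨ d ≡ true
          table k true  _     _ = refl
          table k false true  _ = refl
          table k false false h = contradiction (trans (+-comm 1 k) h) λ ()
        sum : ∀ {B D} → IsBasis M₁ B → IsBasis M₂ D → (not (lookup B c) ≡ true → lookup D c ≡ true) →
          ∃[ X ] Combined true c X B D
        sum {B} {D} b d ok with lookup B c in p | lookup D c in q
        ... | true  | true  = B ∪ D , both b d p q
        ... | true  | false = (B ∪ D) - c , one b d (cong₂ (λ a b → bit a + bit b) p q)
        ... | false | true  = (B ∪ D) - c , one b d (cong₂ (λ a b → bit a + bit b) p q)
        ... | false | false = contradiction (ok refl) λ ()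

      nonempty : ∃[ B ] (IsBasis M₁ B × lookup B c ≡ true) → ∃ (IsBasis (parallelGen M₁ M₂ c))
      nonempty (B , b , hc) = let D , d = M₂.nonempty
                                  X , x , _ = Composite.combine composite b d
                                    λ p → contradiction (trans (sym hc) (not-true p)) λ ()
                              in X , x

-- Closure with a lower bound on the rank

size-combined : ∀ {N κ} {c : Fin N} {X B D} → Combined κ c X B D → bit κ + size X ≡ size B + size D
size-combined {N} {κ} {c} {X} {B} {D} (combined h) = begin
  bit κ + size X                                        ≡⟨ cong (_+ size X) (sum-bit κ) ⟨
  ∑.sum (λ e → bit κ * δ c e) + size X                  ≡⟨ sum-+ (λ e → bit κ * δ c e) _ ⟨
  ∑.sum (λ e → bit κ * δ c e + bit (lookup X e))        ≡⟨ ∑.sum-cong-≗ h ⟩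
  ∑.sum (λ e → bit (lookup B e) + bit (lookup D e))     ≡⟨ sum-+ (λ e → bit (lookup B e)) _ ⟩
  size B + size D                                       ∎
  where
  open ≡-Reasoning
  sum-bit : ∀ κ → ∑.sum (λ e → bit κ * δ c e) ≡ bit κ
  sum-bit true  = trans (∑.sum-cong-≗ λ e → +-identityʳ (δ c e)) (sum-δ c)
  sum-bit false = ∑.sum-replicate-zero N

lookup-disjoint : ∀ {N} {X Y Z : Subset N} → X ∩ Y ≡ Z → ∀ e → lookup Z e ≡ false →
  lookup X e ≡ false ⊎ lookup Y e ≡ false
lookup-disjoint {X = X} {Y} h e z with lookup X e in p
... | false = inj₁ refl
... | true  = inj₂ (trans (trans (cong (_∧ lookup Y e) (sym p)) (sym (lookup-∩ e X Y)))
                     (trans (cong (λ Z → lookup Z e) h) z))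

module Closure {q} (𝓟 : ∀ {N} → SetSystem N → Set q)
  (𝓟-trivial : ∀ {N} → 𝓟 (trivial {N}))
  (𝓟-composite : ∀ {N} {M M₁ M₂ : SetSystem N} {c} → Composite M M₁ M₂ c →
    IsMatroid M₁ → IsMatroid M₂ → 𝓟 M₁ → 𝓟 M₂ → 𝓟 M) where

  -- The bound is a number instead of mere positivity because ranks add and drop along the way: a
  -- minor of one factor may reach rank 0 while the other summand keeps the direct sum positive.
  record Good (r : ℕ) {N} (M : SetSystem N) : Set q where
    constructor good
    field
      isMatroid : IsMatroid M
      property  : 𝓟 M
      rank≥     : ∀ {X} → IsBasis M X → r ≤ size X

  open Good

  good-trivial : ∀ {N} → Good 0 (trivial {N})
  good-trivial = good trivial-isMatroid 𝓟-trivial λ _ → z≤n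

  good-composite : ∀ {r₁ r₂ N} {M M₁ M₂ : SetSystem N} {c} (C : Composite M M₁ M₂ c) → ∃ (IsBasis M) →
    Good r₁ M₁ → Good r₂ M₂ → Good (r₁ + r₂ ∸ bit (Composite.κ C)) M
  good-composite C ne g₁ g₂ = good
    (CompositeMatroid.isMatroid C (isMatroid g₁) (isMatroid g₂) ne)
    (𝓟-composite C (isMatroid g₁) (isMatroid g₂) (property g₁) (property g₂))
    λ x → let B , D , b , d , h , _ = Composite.split C x in
      ℕP.m≤n+o⇒m∸n≤o _ (bit (Composite.κ C))
        (≤-trans (ℕP.+-mono-≤ (rank≥ g₁ b) (rank≥ g₂ d)) (ℕP.≤-reflexive (sym (size-combined h))))

  weaken : ∀ {r r′ N} {M : SetSystem N} → r′ ≤ r → Good r M → Good r′ M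
  weaken h (good m p r) = good m p λ x → ≤-trans h (r x)

  -- The rank drops by `κ`, which is at most 1; the weaker bound serves both kinds of minor.
  good-minor : ∀ {r N} {M′ M : SetSystem N} {c} → Minor M′ M c → Good r M → Good (r ∸ 1) M′
  good-minor {r} {M = M} {c} minor g =
    weaken (bound (Composite.κ C)) (good-composite C (minor-nonempty (isMatroid g) minor) g good-trivial)
    where
    C = minor-composite (isMatroid g) minor
    bound : ∀ κ → r ∸ 1 ≤ r + 0 ∸ bit κ
    bound true  = ℕP.≤-reflexive (cong (_∸ 1) (sym (+-identityʳ r)))
    bound false = ≤-trans (ℕP.m∸n≤m r 1) (ℕP.≤-reflexive (sym (+-identityʳ r)))

  good-⊕ : ∀ {r₁ r₂ N} {M₁ M₂ : SetSystem N} → Fin N → (∀ e → lookup (E M₁) e ≡ false ⊎ lookup (E M₂) e ≡ false) →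
    Good r₁ M₁ → Good r₂ M₂ → Good (r₁ + r₂) (M₁ ⊕ M₂)
  good-⊕ c disjoint g₁ g₂ = good-composite composite nonempty g₁ g₂
    where open DirectSum (isMatroid g₁) (isMatroid g₂) c disjoint

  module _ {N} {M₁ M₂ : SetSystem N} {c : Fin N} (E∩E : E M₁ ∩ E M₂ ≡ ⁅ c ⁆) where

    private
      off : ∀ e → e ≢ c → lookup (E M₁) e ≡ false ⊎ lookup (E M₂) e ≡ false
      off e e≢c = lookup-disjoint E∩E e (lookup-⁅⁆-diff (e≢c ∘ sym))

      c∈both : lookup (E M₁) c ≡ true × lookup (E M₂) c ≡ true
      c∈both = ∧-true (trans (sym (lookup-∩ c (E M₁) (E M₂))) (trans (cong (λ Z → lookup Z c) E∩E) (lookup-⁅⁆-same c)))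

      removed : ∀ {X Y : Subset N} → (∀ e → e ≢ c → lookup X e ≡ false ⊎ lookup Y e ≡ false) →
        ∀ e → lookup (X - c) e ≡ false ⊎ lookup Y e ≡ false
      removed {X} {Y} h e with e FinP.≟ c
      ... | yes refl = inj₁ (removed-self X c)
      ... | no e≢c   = Sum.map₁ (λ z → BoolP.¬-not λ p → contradiction (trans (sym (removed-⊑ X c e p)) z) λ ()) (h e e≢c)

      removedˡ : ∀ e → lookup (E M₁ - c) e ≡ false ⊎ lookup (E M₂) e ≡ false
      removedˡ = removed {E M₁} {E M₂} off

      removedʳ : ∀ e → lookup (E M₁) e ≡ false ⊎ lookup (E M₂ - c) e ≡ false
      removedʳ e = Sum.swap (removed {E M₂} {E M₁} (λ e e≢c → Sum.swap (off e e≢c)) e)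

    module _ {r₁ r₂} (g₁ : Good r₁ M₁) (g₂ : Good r₂ M₂) where
      open AtPoint (isMatroid g₁) (isMatroid g₂) c off

      private
        delete₁ : Good (r₁ ∸ 1) (delete M₁ c)
        delete₁ = good-minor (delete-minor M₁ c (proj₁ c∈both) (isMatroid g₁)) g₁

        delete₂ : Good (r₂ ∸ 1) (delete M₂ c)
        delete₂ = good-minor (delete-minor M₂ c (proj₂ c∈both) (isMatroid g₂)) g₂

        contract₁ : Good (r₁ ∸ 1) (contract M₁ c)
        contract₁ = good-minor (contract-minor M₁ c (proj₁ c∈both) (isMatroid g₁)) g₁

        contract₂ : Good (r₂ ∸ 1) (contract M₂ c)
        contract₂ = good-minor (contract-minor M₂ c (proj₂ c∈both) (isMatroid g₂)) g₂

      good-seriesGen : isColoopᵇ M₁ c ≡ false → Good (r₁ + r₂) (seriesGen M₁ M₂)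
      good-seriesGen h = good-composite Series.composite (Series.nonempty (¬coloop⇒ M₁ c (proj₁ c∈both) h)) g₁ g₂

      good-parallelGen : isLoopᵇ M₁ c ≡ false → Good (r₁ + r₂ ∸ 1) (parallelGen M₁ M₂ c)
      good-parallelGen h = good-composite Parallel.composite (Parallel.nonempty (¬loop⇒ M₁ c (proj₁ c∈both) h)) g₁ g₂

      good-series : 1 ≤ r₁ → 1 ≤ r₂ → Good 1 (series M₁ M₂ c)
      good-series 1≤r₁ 1≤r₂ with isLoopᵇ M₁ c | isColoopᵇ M₁ c in ¬coloop | isLoopᵇ M₂ c | isColoopᵇ M₂ c
      ... | true  | _     | _     | _     = weaken (ℕP.m≤n⇒m≤o+n (r₁ ∸ 1) 1≤r₂) (good-⊕ c removedˡ contract₁ g₂)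
      ... | false | true  | _     | _     = weaken (ℕP.m≤n⇒m≤n+o (r₂ ∸ 1) 1≤r₁) (good-⊕ c removedʳ g₁ delete₂)
      ... | false | false | true  | _     = weaken (ℕP.m≤n⇒m≤n+o (r₂ ∸ 1) 1≤r₁) (good-⊕ c removedʳ g₁ contract₂)
      ... | false | false | false | true  = weaken (ℕP.m≤n⇒m≤o+n (r₁ ∸ 1) 1≤r₂) (good-⊕ c removedˡ delete₁ g₂)
      ... | false | false | false | false = weaken (ℕP.m≤n⇒m≤n+o r₂ 1≤r₁) (good-seriesGen ¬coloop)

      good-parallel : 1 ≤ r₁ → 1 ≤ r₂ → Good 1 (parallel M₁ M₂ c)
      good-parallel 1≤r₁ 1≤r₂ with isLoopᵇ M₁ c in ¬loop | isColoopᵇ M₁ c | isLoopᵇ M₂ c | isColoopᵇ M₂ c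
      ... | true  | _     | _     | _     = weaken (ℕP.m≤n⇒m≤n+o (r₂ ∸ 1) 1≤r₁) (good-⊕ c removedʳ g₁ contract₂)
      ... | false | true  | _     | _     = weaken (ℕP.m≤n⇒m≤o+n (r₁ ∸ 1) 1≤r₂) (good-⊕ c removedˡ delete₁ g₂)
      ... | false | false | true  | _     = weaken (ℕP.m≤n⇒m≤o+n (r₁ ∸ 1) 1≤r₂) (good-⊕ c removedˡ contract₁ g₂)
      ... | false | false | false | true  = weaken (ℕP.m≤n⇒m≤n+o (r₂ ∸ 1) 1≤r₁) (good-⊕ c removedʳ g₁ delete₂)
      ... | false | false | false | false =
        weaken (ℕP.∸-monoˡ-≤ 1 (ℕP.+-mono-≤ 1≤r₁ 1≤r₂)) (good-parallelGen ¬loop)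

      -- Contraction may cost one from the rank, so the series connection enters with its full bound
      -- `r₁ + r₂`; positivity alone would leave 0.
      good-twoSum : 1 ≤ r₁ → 1 ≤ r₂ → ¬ IsLoop M₁ c → ¬ IsColoop M₁ c → ¬ IsLoop M₂ c → ¬ IsColoop M₂ c →
        Good 1 (twoSum M₁ M₂ c)
      good-twoSum 1≤r₁ 1≤r₂ ¬l₁ ¬c₁ ¬l₂ ¬c₂ = subst (λ M → Good 1 (contract M c)) (sym series≡)
        (weaken (ℕP.∸-monoˡ-≤ 1 (ℕP.+-mono-≤ 1≤r₁ 1≤r₂))
          (good-minor (contract-minor (seriesGen M₁ M₂) c (lookup-∪⁺ˡ (E M₁) (E M₂) (proj₁ c∈both)) (isMatroid g)) g))
        where
        g = good-seriesGen (BoolP.¬-not ¬c₁)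
        series≡ : series M₁ M₂ c ≡ seriesGen M₁ M₂
        series≡ rewrite BoolP.¬-not ¬l₁ | BoolP.¬-not ¬c₁ | BoolP.¬-not ¬l₂ | BoolP.¬-not ¬c₂ = refl

-- Toric ideals

module Polynomials {a ℓ} (K : Field a ℓ) where
  private
    module F = Field K
  open Field K using (Carrier; _≈_; 0#; 1#; 0≉1; -_) renaming (_+_ to _+ₖ_; _*_ to _*ₖ_)
  open Poly K using (Pol; coeff; _≈ₚ_; 0ₚ; _+ₚ_; _*ₚ_; binom; _∈⟨_⟩)
  private module RingP = Algebra.Properties.Ring F.ring
  private module ≈-Reasoning = Relation.Binary.Reasoning.Setoid F.setoid

  _≟ᵐ_ : ∀ {n} (u v : Mon n) → Dec (u ≡ v)
  _≟ᵐ_ = VecP.≡-dec ℕP._≟_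

  -- The linear functional with value `g u` on the monomial `u`. Monomials may repeat in a list, and
  -- two lists are equal as polynomials exactly when all functionals agree on them; coefficients are
  -- the functionals of `indicator`.
  eval : ∀ {n} → (Mon n → Carrier) → Pol n → Carrier
  eval g []            = 0#
  eval g ((a , u) ∷ p) = a *ₖ g u +ₖ eval g p

  indicator : ∀ {n} → Mon n → Mon n → Carrier
  indicator m u with u ≟ᵐ m
  ... | yes _ = 1#
  ... | no  _ = 0#

  indicator-same : ∀ {n} {m u : Mon n} → u ≡ m → indicator m u ≡ 1#
  indicator-same {m = m} {u} h with u ≟ᵐ m
  ... | yes _ = refl
  ... | no ¬p = contradiction h ¬p

  indicator-diff : ∀ {n} {m u : Mon n} → u ≢ m → indicator m u ≡ 0#
  indicator-diff {m = m} {u} h with u ≟ᵐ m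
  ... | yes p = contradiction p h
  ... | no _  = refl

  coeff≈eval : ∀ {n} (p : Pol n) m → coeff p m ≈ eval (indicator m) p
  coeff≈eval [] m = F.refl
  coeff≈eval ((a , u) ∷ p) m with u ≟ᵐ m
  ... | yes _ = F.+-cong (F.sym (F.*-identityʳ a)) (coeff≈eval p m)
  ... | no _  = F.trans (coeff≈eval p m) (F.sym (F.trans (F.+-congʳ (F.zeroʳ a)) (F.+-identityˡ _)))

  eval-++ : ∀ {n} (g : Mon n → Carrier) p q → eval g (p ++ q) ≈ eval g p +ₖ eval g q
  eval-++ g []            q = F.sym (F.+-identityˡ _)
  eval-++ g ((a , u) ∷ p) q = F.trans (F.+-congˡ (eval-++ g p q)) (F.sym (F.+-assoc _ _ _))

  relabel : ∀ {n m} → (Mon n → Mon m) → Pol n → Pol m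
  relabel f = List.map λ (a , u) → a , f u

  eval-relabel : ∀ {n m} (f : Mon n → Mon m) (g : Mon m → Carrier) p → eval g (relabel f p) ≈ eval (g ∘ f) p
  eval-relabel f g []            = F.refl
  eval-relabel f g ((a , u) ∷ p) = F.+-congˡ (eval-relabel f g p)

  remove : ∀ {n} → Mon n → Pol n → Pol n
  remove u [] = []
  remove u ((a , v) ∷ p) with v ≟ᵐ u
  ... | yes _ = remove u p
  ... | no _  = (a , v) ∷ remove u p

  length-remove : ∀ {n} (u : Mon n) p → List.length (remove u p) ≤ List.length p
  length-remove u [] = z≤n
  length-remove u ((a , v) ∷ p) with v ≟ᵐ u
  ... | yes _ = ℕP.m≤n⇒m≤1+n (length-remove u p)
  ... | no _  = s≤s (length-remove u p)

  remove-head : ∀ {n} a (u : Mon n) p → remove u ((a , u) ∷ p) ≡ remove u p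
  remove-head a u p with u ≟ᵐ u
  ... | yes _ = refl
  ... | no ¬p = contradiction refl ¬p

  -- Collects all terms in the monomial `u` at once. Repeated, this computes a functional from the
  -- coefficients of a polynomial instead of its terms.
  eval-remove : ∀ {n} (g : Mon n → Carrier) u p → eval g p ≈ coeff p u *ₖ g u +ₖ eval g (remove u p)
  eval-remove g u [] = F.sym (F.trans (F.+-identityʳ _) (F.zeroˡ (g u)))
  eval-remove g u ((a , v) ∷ p) with v ≟ᵐ u
  ... | yes refl = begin
    a *ₖ g v +ₖ eval g p                                      ≈⟨ F.+-congˡ (eval-remove g u p) ⟩
    a *ₖ g v +ₖ (coeff p u *ₖ g u +ₖ eval g (remove u p))     ≈⟨ F.+-assoc _ _ _ ⟨
    a *ₖ g v +ₖ coeff p u *ₖ g u +ₖ eval g (remove u p)       ≈⟨ F.+-congʳ (F.distribʳ (g u) a (coeff p u)) ⟨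
    (a +ₖ coeff p u) *ₖ g u +ₖ eval g (remove u p)            ∎
    where open ≈-Reasoning
  ... | no _ = begin
    a *ₖ g v +ₖ eval g p                                      ≈⟨ F.+-congˡ (eval-remove g u p) ⟩
    a *ₖ g v +ₖ (coeff p u *ₖ g u +ₖ eval g (remove u p))     ≈⟨ F.+-assoc _ _ _ ⟨
    a *ₖ g v +ₖ coeff p u *ₖ g u +ₖ eval g (remove u p)       ≈⟨ F.+-congʳ (F.+-comm _ _) ⟩
    coeff p u *ₖ g u +ₖ a *ₖ g v +ₖ eval g (remove u p)       ≈⟨ F.+-assoc _ _ _ ⟩
    coeff p u *ₖ g u +ₖ (a *ₖ g v +ₖ eval g (remove u p))     ∎
    where open ≈-Reasoning

  coeff-remove-same : ∀ {n} (u : Mon n) p → coeff (remove u p) u ≈ 0#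
  coeff-remove-same u [] = F.refl
  coeff-remove-same u ((a , v) ∷ p) with v ≟ᵐ u in eq
  ... | yes _ = coeff-remove-same u p
  ... | no _ rewrite eq = coeff-remove-same u p

  coeff-remove-diff : ∀ {n} {u v : Mon n} → v ≢ u → ∀ p → coeff (remove u p) v ≈ coeff p v
  coeff-remove-diff v≢u [] = F.refl
  coeff-remove-diff {u = u} {v} v≢u ((a , w) ∷ p) with w ≟ᵐ u
  ... | yes refl with w ≟ᵐ v
  ... | yes e = contradiction (sym e) v≢u
  ... | no _  = coeff-remove-diff v≢u p
  coeff-remove-diff {u = u} {v} v≢u ((a , w) ∷ p) | no _ with w ≟ᵐ v
  ... | yes _ = F.+-congˡ (coeff-remove-diff v≢u p)
  ... | no _  = coeff-remove-diff v≢u p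

  -- The instances of Z are "equal to zero" and "not different from zero".
  module _ {z} (Z : Carrier → Set z) (Z-resp : ∀ {x y} → x ≈ y → Z x → Z y)
    (Z-0 : Z 0#) (Z-+ : ∀ {x y} → Z x → Z y → Z (x +ₖ y)) where

    eval-closed : ∀ {n} (g : Mon n → Carrier) p → (∀ v → Z (coeff p v *ₖ g v)) → Z (eval g p)
    eval-closed {n} g p = go _ p ≤-refl
      where
      go : ∀ l p → List.length p ≤ l → (∀ v → Z (coeff p v *ₖ g v)) → Z (eval g p)
      go l [] _ h = Z-0
      go (suc l) ((a , u) ∷ p) (s≤s len) h = Z-resp (F.sym (eval-remove g u ((a , u) ∷ p))) (Z-+ (h u)
        (subst (λ q → Z (eval g q)) (sym (remove-head a u p)) (go l (remove u p) (≤-trans (length-remove u p) len) rest)))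
        where
        rest : ∀ v → Z (coeff (remove u p) v *ₖ g v)
        rest v with v ≟ᵐ u
        ... | yes refl = Z-resp (F.sym (F.trans (F.*-congʳ (coeff-remove-same u p)) (F.zeroˡ _))) Z-0
        ... | no v≢u   = Z-resp (F.*-congʳ (F.trans
            (F.sym (coeff-remove-diff v≢u ((a , u) ∷ p))) (F.reflexive (cong (λ q → coeff q v) (remove-head a u p))))) (h v)

  eval-≈0 : ∀ {n} (g : Mon n → Carrier) p → p ≈ₚ 0ₚ → eval g p ≈ 0#
  eval-≈0 g p h = eval-closed (_≈ 0#) (λ e z → F.trans (F.sym e) z) F.refl
    (λ e e′ → F.trans (F.+-cong e e′) (F.+-identityˡ 0#)) g p
    λ v → F.trans (F.*-congʳ (h v)) (F.zeroˡ (g v))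

  negate : ∀ {n} → Pol n → Pol n
  negate = List.map λ (a , u) → - a , u

  eval-negate : ∀ {n} (g : Mon n → Carrier) p → eval g (negate p) ≈ - eval g p
  eval-negate g []            = F.sym RingP.-0#≈0#
  eval-negate g ((a , u) ∷ p) = F.trans
    (F.+-cong (F.sym (RingP.-‿distribˡ-* a (g u))) (eval-negate g p)) (RingP.-‿+-comm _ _)

  eval-cong : ∀ {n} (g : Mon n → Carrier) p q → p ≈ₚ q → eval g p ≈ eval g q
  eval-cong g p q h = RingP.x∙y⁻¹≈ε⇒x≈y _ _
    (F.trans (F.sym (split g)) (eval-≈0 g (p ++ negate q) λ m → F.trans (coeff≈eval (p ++ negate q) m)
      (F.trans (split (indicator m)) (RingP.x≈y⇒x∙y⁻¹≈ε
        (F.trans (F.sym (coeff≈eval p m)) (F.trans (h m) (coeff≈eval q m)))))))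
    where
    split : ∀ g → eval g (p ++ negate q) ≈ eval g p +ₖ - eval g q
    split g = F.trans (eval-++ g p (negate q)) (F.+-congˡ (eval-negate g q))

  ≈ₚ-by-eval : ∀ {n} {p q : Pol n} → (∀ g → eval g p ≈ eval g q) → p ≈ₚ q
  ≈ₚ-by-eval {p = p} {q} h m = F.trans (coeff≈eval p m) (F.trans (h (indicator m)) (F.sym (coeff≈eval q m)))

  eval-binom : ∀ {n} (g : Mon n → Carrier) u v → eval g (binom u v) ≈ g u +ₖ - g v
  eval-binom g u v = F.+-cong (F.*-identityˡ (g u))
    (F.trans (F.+-identityʳ _) (RingP.-1*x≈-x (g v)))

  -- The cancellation behind both evaluations of an ideal combination: by functionals that factor
  -- through the monomial map, and by those that factor through a choice of representatives.
  eval-term-binom : ∀ {n} (g : Mon n → Carrier) b w x y → g (w ⊞ x) ≈ g (w ⊞ y) →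
    eval g (((b , w) ∷ []) *ₚ binom x y) ≈ 0#
  eval-term-binom g b w x y e = begin
    b *ₖ 1# *ₖ g (w ⊞ x) +ₖ (b *ₖ - 1# *ₖ g (w ⊞ y) +ₖ 0#)
      ≈⟨ F.+-cong (F.*-congˡ e) (F.+-identityʳ _) ⟩
    b *ₖ 1# *ₖ g (w ⊞ y) +ₖ b *ₖ - 1# *ₖ g (w ⊞ y)   ≈⟨ F.distribʳ _ _ _ ⟨
    (b *ₖ 1# +ₖ b *ₖ - 1#) *ₖ g (w ⊞ y)              ≈⟨ F.*-congʳ (F.distribˡ b 1# (- 1#)) ⟨
    b *ₖ (1# +ₖ - 1#) *ₖ g (w ⊞ y)                   ≈⟨ F.*-congʳ (F.*-congˡ (F.-‿inverseʳ 1#)) ⟩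
    b *ₖ 0# *ₖ g (w ⊞ y)                             ≈⟨ F.*-congʳ (F.zeroʳ b) ⟩
    0# *ₖ g (w ⊞ y)                                  ≈⟨ F.zeroˡ _ ⟩
    0#                                               ∎
    where open ≈-Reasoning

  eval-*-binom : ∀ {n} (g : Mon n → Carrier) h x y → (∀ w → g (w ⊞ x) ≈ g (w ⊞ y)) → eval g (h *ₚ binom x y) ≈ 0#
  eval-*-binom g []            x y e = F.refl
  eval-*-binom g ((b , w) ∷ h) x y e = F.trans (eval-++ g (((b , w) ∷ []) *ₚ binom x y) (h *ₚ binom x y))
    (F.trans (F.+-cong (eval-term-binom g b w x y (e w)) (eval-*-binom g h x y e)) (F.+-identityˡ 0#))

  combination : ∀ {n} → List (Pol n × Pol n) → Pol n
  combination = List.foldr (λ hg acc → (proj₁ hg *ₚ proj₂ hg) +ₚ acc) 0ₚ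

  combination-++ : ∀ {n} (hs hs′ : List (Pol n × Pol n)) → combination (hs ++ hs′) ≡ combination hs ++ combination hs′
  combination-++ []             hs′ = refl
  combination-++ ((h , g) ∷ hs) hs′ = trans (cong ((h *ₚ g) ++_) (combination-++ hs hs′))
    (sym (ListP.++-assoc (h *ₚ g) (combination hs) (combination hs′)))

  module _ {n} {G : List (Pol n)} where

    ∈⟨⟩-resp : ∀ {p q} → (∀ g → eval g p ≈ eval g q) → q ∈⟨ G ⟩ → p ∈⟨ G ⟩
    ∈⟨⟩-resp {p} {q} h (hs , all , e) = hs , all ,
      λ m → F.trans (≈ₚ-by-eval {p = p} {q} h m) (e m)

    ∈⟨⟩-0 : [] ∈⟨ G ⟩
    ∈⟨⟩-0 = [] , [] , λ _ → F.refl

    ∈⟨⟩-+ : ∀ {p q} → p ∈⟨ G ⟩ → q ∈⟨ G ⟩ → (p ++ q) ∈⟨ G ⟩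
    ∈⟨⟩-+ {p} {q} (hs , all , e) (hs′ , all′ , e′) = hs ++ hs′ , AllP.++⁺ all all′ ,
      ≈ₚ-by-eval {p = p ++ q} {combination (hs ++ hs′)} λ g → begin
        eval g (p ++ q)                                       ≈⟨ eval-++ g p q ⟩
        eval g p +ₖ eval g q                                  ≈⟨ F.+-cong (eval-cong g p (combination hs) e) (eval-cong g q (combination hs′) e′) ⟩
        eval g (combination hs) +ₖ eval g (combination hs′)   ≈⟨ eval-++ g (combination hs) _ ⟨
        eval g (combination hs ++ combination hs′)            ≡⟨ cong (eval g) (combination-++ hs hs′) ⟨
        eval g (combination (hs ++ hs′))                      ∎
      where open ≈-Reasoning

    ∈⟨⟩-* : ∀ h {g} → g LM.∈ G → (h *ₚ g) ∈⟨ G ⟩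
    ∈⟨⟩-* h {g} m = (h , g) ∷ [] , m ∷ [] , λ k → F.reflexive (cong (λ q → coeff q k) (sym (ListP.++-identityʳ (h *ₚ g))))

    ∈⟨⟩-generator : ∀ {g} → g LM.∈ G → g ∈⟨ G ⟩
    ∈⟨⟩-generator {g} m = ∈⟨⟩-resp {g} {((1# , 𝟎) ∷ []) *ₚ g} (λ f → F.sym (one f g)) (∈⟨⟩-* ((1# , 𝟎) ∷ []) m)
      where
      one : ∀ f g → eval f (((1# , 𝟎) ∷ []) *ₚ g) ≈ eval f g
      one f []            = F.refl
      one f ((a , u) ∷ g) = F.+-cong
        (F.*-cong (F.*-identityˡ a) (F.reflexive (cong f (⊞-identityˡ u)))) (one f g)

Move-sym : ∀ {n} {R : Rel (Mon n) Level.zero} → (∀ {u v} → R u v → R v u) → ∀ {u v} → Move R u v → Move R v u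
Move-sym R-sym (move a i i′ k k′ r eu ev) = move a k k′ i i′ (R-sym r) ev eu

divides : ∀ {n} {u v : Mon n} → Pointwise _≤_ u v → ∃[ a ] v ≡ a ⊞ u
divides []       = [] , refl
divides {u = x ∷ _} {v = y ∷ _} (h ∷ hs) = let a , e = divides hs in y ∸ x ∷ a , cong₂ _∷_ (sym (ℕP.m∸n+n≡m h)) e

⊞-divides : ∀ {n} (a u : Mon n) → Pointwise _≤_ u (a ⊞ u)
⊞-divides []      []      = []
⊞-divides (x ∷ a) (y ∷ u) = ℕP.m≤n+m y x ∷ ⊞-divides a u

unit≢𝟎 : ∀ {n} (i : Fin n) → unit i ≢ 𝟎
unit≢𝟎 zero    ()
unit≢𝟎 (suc i) h = unit≢𝟎 i (VecP.∷-injectiveʳ h)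

deg-⊞ : ∀ {n} (u v : Mon n) → deg (u ⊞ v) ≡ deg u + deg v
deg-⊞ = wt-⊞ _

deg-unit : ∀ {n} (i : Fin n) → deg (unit i) ≡ 1
deg-unit = wt-unit _

deg-units : ∀ {n} (i j : Fin n) → deg (unit i ⊞ unit j) ≡ 2
deg-units = wt-units _

module Toric {a ℓ} (K : Field a ℓ) {N} (M : SetSystem N) where
  open Polynomials K
  private
    module F = Field K
    module RingP = Algebra.Properties.Ring F.ring
    module ≈-Reasoning = Relation.Binary.Reasoning.Setoid F.setoid
  open Field K using (_≈_; 0#; 1#; 0≉1; -_) renaming (_+_ to _+ₖ_; _*_ to _*ₖ_)
  open Poly K using (Pol; 0ₚ; _*ₚ_; binom; _∈⟨_⟩)

  n : ℕ
  n = #bases M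

  image : Mon n → Mon N
  image = Poly.image K M

  private
    lookup-sum : ∀ {l} (h : Fin l → Mon N) e → lookup (Vec.foldr _ _⊞_ 𝟎 (tabulate h)) e ≡ ∑.sum (λ j → lookup (h j) e)
    lookup-sum {zero}  h e = VecP.lookup-replicate e 0
    lookup-sum {suc l} h e = trans (lookup-⊞ e (h zero) _) (cong (lookup (h zero) e +_) (lookup-sum (h ∘ suc) e))

  lookup-image : ∀ u e → lookup (image u) e ≡ multiplicity M u e
  lookup-image u e = trans (lookup-sum {n} _ e) (∑.sum-cong-≗ {n} λ j →
    trans (VecP.lookup-map e (lookup u j *_) (Vec.map _ (basis M j)))
      (cong (lookup u j *_) (VecP.lookup-map e _ (basis M j))))

  image-≡ : ∀ u v → (∀ e → multiplicity M u e ≡ multiplicity M v e) → image u ≡ image v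
  image-≡ u v h = lookup-ext λ e → trans (lookup-image u e) (trans (h e) (sym (lookup-image v e)))

  ≡-image : ∀ u v → image u ≡ image v → ∀ e → multiplicity M u e ≡ multiplicity M v e
  ≡-image u v h e = trans (sym (lookup-image u e)) (trans (cong (λ w → lookup w e) h) (lookup-image v e))

  image-⊞ : ∀ u v → image (u ⊞ v) ≡ image u ⊞ image v
  image-⊞ u v = lookup-ext λ e → trans (lookup-image (u ⊞ v) e) (trans (wt-⊞ _ u v)
    (trans (sym (cong₂ _+_ (lookup-image u e) (lookup-image v e))) (sym (lookup-⊞ e (image u) _))))

  image-cong : ∀ w {u v} → image u ≡ image v → image (w ⊞ u) ≡ image (w ⊞ v)
  image-cong w {u} {v} h = trans (image-⊞ w u) (trans (cong (image w ⊞_) h) (sym (image-⊞ w v)))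

  Fibre⇒image : ∀ {u v} → Fibre M u v → image u ≡ image v
  Fibre⇒image {u} {v} (fibre _ h) = image-≡ u v h

  Fibre-sym : ∀ {u v} → Fibre M u v → Fibre M v u
  Fibre-sym (fibre d h) = fibre (sym d) λ e → sym (h e)

  -- The total exponent of the image is the rank times the degree, and a positive rank can be
  -- cancelled.
  image⇒Fibre : IsMatroid M → (∀ {X} → IsBasis M X → 1 ≤ size X) → ∀ {u v} → image u ≡ image v → Fibre M u v
  image⇒Fibre mat pos {u} {v} h = let B , b = IsMatroid.nonempty mat in fibre (cancel (size B) (pos b) (begin
    size B * deg u               ≡⟨ sum-multiplicity-const mat b u ⟨
    ∑.sum (multiplicity M u)     ≡⟨ ∑.sum-cong-≗ (≡-image u v h) ⟩
    ∑.sum (multiplicity M v)     ≡⟨ sum-multiplicity-const mat b v ⟩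
    size B * deg v               ∎)) (≡-image u v h)
    where
    open ≡-Reasoning
    cancel : ∀ r → 1 ≤ r → ∀ {x y} → r * x ≡ r * y → x ≡ y
    cancel (suc r) _ = ℕP.*-cancelˡ-≡ _ _ (suc r)

  -- A basis of size zero would be a variable with the same image as 1.
  positive-rank : (∀ {u v} → image u ≡ image v → deg u ≡ deg v) → ∀ {X} → IsBasis M X → 1 ≤ size X
  positive-rank h {X} x with size X in eq
  ... | suc _ = s≤s z≤n
  ... | zero  =
    let j , e = basis-index M x
        trivial-image = image-≡ (unit j) 𝟎 λ i → trans (wt-unit (λ j → bit (lookup (basis M j) i)) j) (trans
          (trans (cong (λ X → bit (lookup X i)) e) (sum≡0 _ eq i)) (sym (wt-𝟎 (λ j → bit (lookup (basis M j) i)))))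
    in contradiction (trans (sym (deg-unit j)) (trans (h {unit j} {𝟎} trivial-image) (wt-𝟎 {n} λ _ → 1))) λ ()

  binom∈J : ∀ {u v} → image u ≡ image v → Poly._∈J K M (binom u v)
  binom∈J {u} {v} h = ≈ₚ-by-eval {p = relabel image (binom u v)} {0ₚ} λ g →
    F.trans (eval-relabel image g (binom u v)) (F.trans (eval-binom (g ∘ image) u v)
      (F.trans (F.+-congˡ (F.-‿cong (F.reflexive (cong g (sym h))))) (F.-‿inverseʳ _)))

  -- If the images differed, the image of the binomial would have coefficient 1 at `image u`.
  binom∈J⁻ : ∀ {u v} → Poly._∈J K M (binom u v) → image u ≡ image v
  binom∈J⁻ {u} {v} h with image v ≟ᵐ image u
  ... | yes e = sym e
  ... | no ¬e = contradiction (begin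
    0#                                             ≈⟨ eval-≈0 g (relabel image (binom u v)) h ⟨
    eval g (relabel image (binom u v))             ≈⟨ eval-relabel image g (binom u v) ⟩
    eval (g ∘ image) (binom u v)                   ≈⟨ eval-binom (g ∘ image) u v ⟩
    g (image u) +ₖ - g (image v)                   ≡⟨ cong₂ (λ a b → a +ₖ - b) (indicator-same {m = image u} refl) (indicator-diff ¬e) ⟩
    1# +ₖ - 0#                                     ≈⟨ F.+-congˡ RingP.-0#≈0# ⟩
    1# +ₖ 0#                                       ≈⟨ F.+-identityʳ 1# ⟩
    1#                                             ∎) 0≉1
    where
    open ≈-Reasoning
    g = indicator (image u)

  -- All quadratic binomials of the ideal at once, so that no generators have to be chosen; the same
  -- list serves as generating set and, for a suitable order, as Gröbner basis.
  quadraticPairs : Poly.QuadraticPairs K M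
  quadraticPairs = List.filter (λ (x , y) → image x ≟ᵐ image y) (List.cartesianProduct quadrics quadrics)
    where
    quadrics : List (Mon n)
    quadrics = List.cartesianProductWith (λ i j → unit i ⊞ unit j) (List.allFin n) (List.allFin n)

  ∈-quadraticPairs : ∀ {i i′ k k′} → image (unit i ⊞ unit i′) ≡ image (unit k ⊞ unit k′) →
    (unit i ⊞ unit i′ , unit k ⊞ unit k′) LM.∈ quadraticPairs
  ∈-quadraticPairs h = LMP.∈-filter⁺ (λ (x , y) → image x ≟ᵐ image y)
    (LMP.∈-cartesianProduct⁺ (quadric _ _) (quadric _ _)) h
    where
    quadric : ∀ (i j : Fin n) → (unit i ⊞ unit j) LM.∈
      List.cartesianProductWith (λ i j → unit i ⊞ unit j) (List.allFin n) (List.allFin n)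
    quadric i j = LMP.∈-cartesianProductWith⁺ (λ i j → unit i ⊞ unit j) (LMP.∈-allFin i) (LMP.∈-allFin j)

  ∈-quadraticPairs⁻ : ∀ {x y} → (x , y) LM.∈ quadraticPairs → (deg x ≡ 2 × deg y ≡ 2) × image x ≡ image y
  ∈-quadraticPairs⁻ {x} {y} m =
    let m′ , e = LMP.∈-filter⁻ (λ (x , y) → image x ≟ᵐ image y) m
        mx , my = LMP.∈-cartesianProduct⁻ _ _ m′
    in (degree mx , degree my) , e
    where
    degree : ∀ {x} → x LM.∈ List.cartesianProductWith (λ i j → unit i ⊞ unit j) (List.allFin n) (List.allFin n) → deg x ≡ 2
    degree {x} m = let i , j , _ , _ , e = LMP.∈-cartesianProductWith⁻ (λ i j → unit i ⊞ unit j) (List.allFin n) (List.allFin n) m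
               in trans (cong deg e) (deg-units i j)

  private
    to-sum : ∀ (u : Mon n) → deg u ≡ 2 → Vec.sum u ≡ 2
    to-sum u h = trans (sym (deg≡sum u)) h

    from-sum : ∀ (u : Mon n) → Vec.sum u ≡ 2 → deg u ≡ 2
    from-sum u h = trans (deg≡sum u) h

  quadraticPairs-quadratic : Poly.IsQuadratic K M quadraticPairs
  quadraticPairs-quadratic = All.tabulate λ {(x , y)} m →
    let (dx , dy) , _ = ∈-quadraticPairs⁻ m in to-sum x dx , to-sum y dy

  degrees-of : ∀ {G} → Poly.IsQuadratic K M G → ∀ {x y} → (x , y) LM.∈ G → deg x ≡ 2 × deg y ≡ 2
  degrees-of quad {x} {y} m = let dx , dy = All.lookup quad m in from-sum x dx , from-sum y dy

  Connected : Rel (Mon n) Level.zero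
  Connected = Star (Move (Fibre M))

  Connected-sym : ∀ {u v} → Connected u v → Connected v u
  Connected-sym = Star.reverse (Move-sym Fibre-sym)

  Connected⇒deg : ∀ {u v} → Connected u v → deg u ≡ deg v
  Connected⇒deg ε = refl
  Connected⇒deg (move a i i′ k k′ _ refl refl ◅ ms) =
    trans (trans (deg-⊞ a _) (trans (cong (deg a +_) (trans (deg-units i i′) (sym (deg-units k k′)))) (sym (deg-⊞ a _))))
      (Connected⇒deg ms)

  quadratic-move : ∀ {x y} → deg x ≡ 2 × deg y ≡ 2 → image x ≡ image y → ∀ w → Connected (w ⊞ x) (w ⊞ y)
  quadratic-move {x} {y} (dx , dy) h w with deg-two x dx | deg-two y dy
  ... | i , i′ , refl | k , k′ , refl = move w i i′ k k′ (fibre (trans dx (sym dy)) (≡-image (unit i ⊞ unit i′) (unit k ⊞ unit k′) h)) refl refl ◅ ε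

  -- Union–find along the edges w x — w y that occur in an ideal combination: ρ maps each monomial to a
  -- representative connected to it, so that relabelling along ρ annihilates the combination.
  module _ {G} (quad : Poly.IsQuadratic K M G) (G⊆J : ∀ {x y} → (x , y) LM.∈ G → image x ≡ image y) where

    Annihilated : (Mon n → Mon n) → Pol n → Set _
    Annihilated ρ p = ∀ g → eval (g ∘ ρ) p ≈ 0#

    Retraction : (Mon n → Mon n) → Set
    Retraction ρ = ∀ u → Connected u (ρ u)

    refine : ∀ {ρ x y} → Retraction ρ → Connected x y →
      ∃[ σ ] (Retraction (σ ∘ ρ) × σ (ρ x) ≡ σ (ρ y))
    refine {ρ} {x} {y} ret x~y = σ , σ-ret , trans (σ-on refl) (sym (σ-fix))
      where
      σ : Mon n → Mon n
      σ z with z ≟ᵐ ρ x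
      ... | yes _ = ρ y
      ... | no _  = z
      σ-on : ∀ {z} → z ≡ ρ x → σ z ≡ ρ y
      σ-on {z} h with z ≟ᵐ ρ x
      ... | yes _ = refl
      ... | no ¬h = contradiction h ¬h
      σ-fix : σ (ρ y) ≡ ρ y
      σ-fix with ρ y ≟ᵐ ρ x
      ... | yes _ = refl
      ... | no _  = refl
      σ-ret : ∀ u → Connected u (σ (ρ u))
      σ-ret u with ρ u ≟ᵐ ρ x
      ... | no _  = ret u
      ... | yes e = subst (Connected u) e (ret u) ◅◅ Connected-sym (ret x) ◅◅ x~y ◅◅ ret y

    annihilate-product : ∀ {x y ρ} → (x , y) LM.∈ G → Retraction ρ → ∀ h →
      ∃[ σ ] (Retraction (σ ∘ ρ) × Annihilated (σ ∘ ρ) (h *ₚ binom x y))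
    annihilate-product m ret [] = id , ret , λ _ → F.refl
    annihilate-product {x} {y} {ρ} m ret ((b , w) ∷ h) =
      let σ , ret′ , ann = annihilate-product m ret h
          τ , ret″ , e = refine {ρ = σ ∘ ρ} ret′ (quadratic-move (degrees-of quad m) (G⊆J m) w)
      -- Annihilation is stated for all functionals, so what `σ` achieved survives the further
      -- relabelling `τ`, as the instance `g ∘ τ`.
      in τ ∘ σ , ret″ , λ g → F.trans (eval-++ (g ∘ τ ∘ σ ∘ ρ) (((b , w) ∷ []) *ₚ binom x y) (h *ₚ binom x y))
           (F.trans (F.+-cong (eval-term-binom (g ∘ τ ∘ σ ∘ ρ) b w x y (F.reflexive (cong g e))) (ann (g ∘ τ))) (F.+-identityˡ 0#))

    annihilate : ∀ hs → All (λ hg → proj₂ hg LM.∈ Poly.binoms K M G) hs →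
      ∃[ ρ ] (Retraction ρ × Annihilated ρ (combination hs))
    annihilate [] [] = id , (λ _ → ε) , λ _ → F.refl
    annihilate ((h , b) ∷ hs) (m ∷ ms) with LMP.∈-map⁻ _ m
    ... | (x , y) , xy∈G , refl =
      let ρ , ret , ann = annihilate hs ms
          σ , ret′ , ann′ = annihilate-product {x} {y} {ρ} xy∈G ret h
      in σ ∘ ρ , ret′ , λ g → F.trans (eval-++ (g ∘ σ ∘ ρ) (h *ₚ b) (combination hs))
           (F.trans (F.+-cong (ann′ g) (ann (g ∘ σ))) (F.+-identityˡ 0#))

    -- If `ρ` separated `u` from `v`, the functional that is 1 exactly over `ρ u` would be 1 on the
    -- binomial and 0 on the combination.
    binom∈⟨⟩⇒Connected : ∀ {u v} → binom u v ∈⟨ Poly.binoms K M G ⟩ → Connected u v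
    binom∈⟨⟩⇒Connected {u} {v} (hs , ms , e) with annihilate hs ms
    ... | ρ , ret , ann with ρ v ≟ᵐ ρ u
    ... | yes h = ret u ◅◅ subst (λ w → Connected w v) h (Connected-sym (ret v))
    ... | no ¬h = contradiction (begin
      0#                                 ≈⟨ ann g ⟨
      eval (g ∘ ρ) (combination hs)      ≈⟨ eval-cong (g ∘ ρ) (binom u v) (combination hs) e ⟨
      eval (g ∘ ρ) (binom u v)           ≈⟨ eval-binom (g ∘ ρ) u v ⟩
      g (ρ u) +ₖ - g (ρ v)               ≡⟨ cong₂ (λ a b → a +ₖ - b) (indicator-same {m = ρ u} refl) (indicator-diff ¬h) ⟩
      1# +ₖ - 0#                         ≈⟨ F.+-congˡ RingP.-0#≈0# ⟩
      1# +ₖ 0#                           ≈⟨ F.+-identityʳ 1# ⟩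
      1#                                 ∎) 0≉1
      where
      open ≈-Reasoning
      g = indicator (ρ u)

    ⟨⟩⊆J : ∀ {p} → p ∈⟨ Poly.binoms K M G ⟩ → Poly._∈J K M p
    ⟨⟩⊆J {p} (hs , ms , e) = ≈ₚ-by-eval {p = relabel image p} {0ₚ} λ g →
      F.trans (eval-relabel image g p) (F.trans (eval-cong (g ∘ image) p (combination hs) e) (vanish g hs ms))
      where
      vanish : ∀ g hs → All (λ hg → proj₂ hg LM.∈ Poly.binoms K M G) hs → eval (g ∘ image) (combination hs) ≈ 0#
      vanish g [] [] = F.refl
      vanish g ((h , b) ∷ hs) (m ∷ ms) with LMP.∈-map⁻ _ m
      ... | (x , y) , xy∈G , refl = F.trans (eval-++ (g ∘ image) (h *ₚ b) (combination hs))
        (F.trans (F.+-cong (eval-*-binom (g ∘ image) h x y λ w → F.reflexive (cong g (image-cong w (G⊆J xy∈G))))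
          (vanish g hs ms)) (F.+-identityˡ 0#))

  InMQ⇒ : Poly.InMQ K M → ∀ {u v} → image u ≡ image v → Connected u v
  InMQ⇒ (G , quad , h) {u} {v} e = binom∈⟨⟩⇒Connected quad
    (λ {x} {y} m → binom∈J⁻ {x} {y} (proj₂ (h (binom x y)) (∈⟨⟩-generator (LMP.∈-map⁺ (λ (x , y) → binom x y) m))))
    (proj₁ (h (binom u v)) (binom∈J {u} {v} e))

  private
    ⟨Q⟩ : List (Pol n)
    ⟨Q⟩ = Poly.binoms K M quadraticPairs

  -- Telescoping along the path: the first edge contributes `b w (x - y)`, and `b (w y - v)` is left
  -- for the rest.
  difference∈ : ∀ b {u v} → Connected u v → ((b , u) ∷ (- b , v) ∷ []) ∈⟨ ⟨Q⟩ ⟩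
  difference∈ b {u} ε = ∈⟨⟩-resp {p = (b , u) ∷ (- b , u) ∷ []} {[]} (λ g → F.trans (F.+-congˡ (F.+-identityʳ _))
    (F.trans (F.sym (F.distribʳ _ b (- b))) (F.trans (F.*-congʳ (F.-‿inverseʳ b)) (F.zeroˡ _)))) ∈⟨⟩-0
  difference∈ b {v = v} (move w i i′ k k′ r refl refl ◅ ms) =
    ∈⟨⟩-resp {p = (b , w ⊞ (unit i ⊞ unit i′)) ∷ (- b , v) ∷ []} {single ++ rest} same
    (∈⟨⟩-+ {p = single} {rest} (∈⟨⟩-* ((b , w) ∷ []) (LMP.∈-map⁺ (λ (x , y) → binom x y) (∈-quadraticPairs (Fibre⇒image r)))) (difference∈ b ms))
    where
    open ≈-Reasoning
    x = unit i ⊞ unit i′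
    y = unit k ⊞ unit k′
    single = ((b , w) ∷ []) *ₚ binom x y
    rest = (b , w ⊞ y) ∷ (- b , v) ∷ []
    same : ∀ g → eval g ((b , w ⊞ x) ∷ (- b , v) ∷ []) ≈ eval g (single ++ rest)
    same g = F.sym (begin
      b *ₖ 1# *ₖ g (w ⊞ x) +ₖ (b *ₖ - 1# *ₖ g (w ⊞ y) +ₖ (b *ₖ g (w ⊞ y) +ₖ t))
        ≈⟨ F.+-cong (F.*-congʳ (F.*-identityʳ b)) (F.sym (F.+-assoc _ _ _)) ⟩
      b *ₖ g (w ⊞ x) +ₖ (b *ₖ - 1# *ₖ g (w ⊞ y) +ₖ b *ₖ g (w ⊞ y) +ₖ t)
        ≈⟨ F.+-congˡ (F.trans (F.+-congʳ cancel) (F.+-identityˡ t)) ⟩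
      b *ₖ g (w ⊞ x) +ₖ t ∎)
      where
      t = - b *ₖ g v +ₖ 0#
      cancel : b *ₖ - 1# *ₖ g (w ⊞ y) +ₖ b *ₖ g (w ⊞ y) ≈ 0#
      cancel = begin
        b *ₖ - 1# *ₖ g (w ⊞ y) +ₖ b *ₖ g (w ⊞ y) ≈⟨ F.distribʳ _ _ _ ⟨
        (b *ₖ - 1# +ₖ b) *ₖ g (w ⊞ y)            ≈⟨ F.*-congʳ (F.+-congʳ
                                                     (F.trans (F.sym (RingP.-‿distribʳ-* b 1#)) (F.-‿cong (F.*-identityʳ b)))) ⟩
        (- b +ₖ b) *ₖ g (w ⊞ y)                  ≈⟨ F.*-congʳ (F.-‿inverseˡ b) ⟩
        0# *ₖ g (w ⊞ y)                          ≈⟨ F.zeroˡ _ ⟩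
        0#                                       ∎

  -- The first monomial of p with a given image, so that relabelling p along it factors through φ.
  first : Pol n → Mon N → Mon n
  first [] m = 𝟎
  first ((b , v) ∷ p) m with image v ≟ᵐ m
  ... | yes _ = v
  ... | no _  = first p m

  image-first : ∀ p {b u} → (b , u) LM.∈ p → image (first p (image u)) ≡ image u
  image-first ((c , v) ∷ p) {u = u} m with image v ≟ᵐ image u
  ... | yes e = e
  image-first ((c , v) ∷ p) (here refl) | no ¬e = contradiction refl ¬e
  image-first ((c , v) ∷ p) (there m)   | no _  = image-first p m

  -- Each term `b u` is replaced by `b (u - r u)`, with `r u` the representative of its fibre. The
  -- subtracted terms form a relabelling of the image of `p`, which is 0, so the differences still
  -- add up to `p`.
  ⇒InMQ : (∀ {u v} → image u ≡ image v → Connected u v) → Poly.InMQ K M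
  ⇒InMQ conn = quadraticPairs , quadraticPairs-quadratic , λ p →
    (λ p∈J → ∈⟨⟩-resp {p = p} {differences (first p) p} (λ g → F.sym (F.trans (eval-differences (first p) g p) (begin
        eval g p +ₖ - eval (g ∘ first p ∘ image) p
          ≈⟨ F.+-congˡ (F.-‿cong (F.trans (F.sym (eval-relabel image (g ∘ first p) p)) (eval-≈0 (g ∘ first p) (relabel image p) p∈J))) ⟩
        eval g p +ₖ - 0#  ≈⟨ F.+-congˡ RingP.-0#≈0# ⟩
        eval g p +ₖ 0#    ≈⟨ F.+-identityʳ _ ⟩
        eval g p          ∎)))
      (differences∈ (first p) p λ m → sym (image-first p m))) ,
    ⟨⟩⊆J quadraticPairs-quadratic (λ m → proj₂ (∈-quadraticPairs⁻ m)) {p}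
    where
    open ≈-Reasoning
    differences : (Mon N → Mon n) → Pol n → Pol n
    differences r []            = []
    differences r ((b , u) ∷ p) = (b , u) ∷ (- b , r (image u)) ∷ differences r p
    differences∈ : ∀ r p → (∀ {b u} → (b , u) LM.∈ p → image u ≡ image (r (image u))) → differences r p ∈⟨ ⟨Q⟩ ⟩
    differences∈ r []            h = ∈⟨⟩-0
    differences∈ r ((b , u) ∷ p) h = ∈⟨⟩-+ {p = (b , u) ∷ (- b , r (image u)) ∷ []} {differences r p}
      (difference∈ b {u} {r (image u)} (conn {u} {r (image u)} (h (here refl)))) (differences∈ r p (λ m → h (there m)))
    eval-differences : ∀ r g p → eval g (differences r p) ≈ eval g p +ₖ - eval (g ∘ r ∘ image) p
    eval-differences r g [] = F.sym (F.trans (F.+-identityˡ _) RingP.-0#≈0#)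
    eval-differences r g ((b , u) ∷ p) = begin
      s +ₖ (- b *ₖ g (r (image u)) +ₖ eval g (differences r p))
        ≈⟨ F.+-congˡ (F.+-cong (F.sym (RingP.-‿distribˡ-* b _)) (eval-differences r g p)) ⟩
      s +ₖ (- t +ₖ (S +ₖ - T))    ≈⟨ F.+-congˡ (F.sym (F.+-assoc _ _ _)) ⟩
      s +ₖ (- t +ₖ S +ₖ - T)      ≈⟨ F.+-congˡ (F.+-congʳ (F.+-comm _ _)) ⟩
      s +ₖ (S +ₖ - t +ₖ - T)      ≈⟨ F.+-congˡ (F.+-assoc _ _ _) ⟩
      s +ₖ (S +ₖ (- t +ₖ - T))    ≈⟨ F.+-assoc _ _ _ ⟨
      s +ₖ S +ₖ (- t +ₖ - T)      ≈⟨ F.+-congˡ (RingP.-‿+-comm t T) ⟩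
      s +ₖ S +ₖ - (t +ₖ T)        ∎
      where
      s = b *ₖ g u
      t = b *ₖ g (r (image u))
      S = eval g p
      T = eval (g ∘ r ∘ image) p

-- Gröbner bases

module Groebner {a ℓ} (K : Field a ℓ) {N} (M : SetSystem N) where
  open Orders K
  open Polynomials K
  open Toric K M
  private
    module F = Field K
    module RingP = Algebra.Properties.Ring F.ring
  open Field K using (Carrier; _≈_; 0#; 1#; 0≉1; -_) renaming (_+_ to _+ₖ_; _*_ to _*ₖ_)
  open Poly K using (coeff; binom; IsLeading; _∣ᵐ_)

  module _ {u v : Mon n} (u≢v : u ≢ v) where

    coeff-binom-first : coeff (binom u v) u ≈ 1#
    coeff-binom-first = F.trans (coeff≈eval (binom u v) u) (F.trans (eval-binom (indicator u) u v)
      (F.trans (F.reflexive (cong₂ (λ a b → a +ₖ - b) (indicator-same {m = u} refl) (indicator-diff (u≢v ∘ sym))))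
        (F.trans (F.+-congˡ RingP.-0#≈0#) (F.+-identityʳ 1#))))

    coeff-binom-second : coeff (binom u v) v ≈ - 1#
    coeff-binom-second = F.trans (coeff≈eval (binom u v) v) (F.trans (eval-binom (indicator v) u v)
      (F.trans (F.reflexive (cong₂ (λ a b → a +ₖ - b) (indicator-diff u≢v) (indicator-same {m = v} refl)))
        (F.+-identityˡ (- 1#))))

  -1≉0 : ¬ (- 1# ≈ 0#)
  -1≉0 h = 0≉1 (F.trans (F.sym (F.-‿inverseʳ 1#)) (F.trans (F.+-congˡ h) (F.+-identityʳ 1#)))

  coeff-binom-other : ∀ {u v m : Mon n} → m ≢ u → m ≢ v → coeff (binom u v) m ≈ 0#
  coeff-binom-other {u} {v} {m} m≢u m≢v = F.trans (coeff≈eval (binom u v) m) (F.trans (eval-binom (indicator m) u v)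
    (F.trans (F.reflexive (cong₂ (λ a b → a +ₖ - b) (indicator-diff (m≢u ∘ sym)) (indicator-diff (m≢v ∘ sym))))
      (F.-‿inverseʳ 0#)))

  coeff-binom-trivial : ∀ (u m : Mon n) → coeff (binom u u) m ≈ 0#
  coeff-binom-trivial u m = F.trans (coeff≈eval (binom u u) m) (F.trans (eval-binom (indicator m) u u) (F.-‿inverseʳ _))

  support-binom : ∀ (u v m : Mon n) → ¬ (coeff (binom u v) m ≈ 0#) → m ≡ u ⊎ m ≡ v
  support-binom u v m h with m ≟ᵐ u | m ≟ᵐ v
  ... | yes e | _     = inj₁ e
  ... | no _  | yes e = inj₂ e
  ... | no ¬u | no ¬v = ⊥-elim (h (coeff-binom-other ¬u ¬v))

  module _ (O : MonomialOrder n) where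
    open MonomialOrder O
    private
      module S = IsStrictTotalOrder isSTO

    binom-leading : ∀ {u v} → v ≺ u → IsLeading O (binom u v) u
    binom-leading {u} {v} lt =
      (λ z → 0≉1 (F.trans (F.sym z) (coeff-binom-first u≢v))) ,
      λ m h → Sum.map₂ (λ { refl → lt }) (support-binom u v m h)
      where
      u≢v : u ≢ v
      u≢v e = S.irrefl (sym e) lt

    binom-leading⁻ : ∀ u v m → IsLeading O (binom u v) m → (m ≡ u × v ≺ u) ⊎ (m ≡ v × u ≺ v)
    binom-leading⁻ u v m (h , top) with u ≟ᵐ v
    ... | yes refl = ⊥-elim (h (coeff-binom-trivial u m))
    ... | no u≢v with support-binom u v m h
    ... | inj₁ refl = inj₁ (refl , [ (λ e → ⊥-elim (u≢v (sym e))) , id ]′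
      (top v λ z → -1≉0 (F.trans (F.sym (coeff-binom-second u≢v)) z)))
    ... | inj₂ refl = inj₂ (refl , [ (λ e → ⊥-elim (u≢v e)) , id ]′
      (top u λ z → 0≉1 (F.trans (F.sym z) (coeff-binom-first u≢v))))

    -- The test element is the binomial `u - v`, whose leading monomial is `u`. Either term of the
    -- basis element found may be its larger one, hence two cases.
    Groebner⇒ : ∀ G → Poly.IsQuadratic K M G → Poly.IsGroebner K M O (Poly.binoms K M G) →
      ∀ {u v} → image u ≡ image v → v ≺ u → Reducible _≺_ (Fibre M) u
    Groebner⇒ G quad (G⊆J , gb) {u} {v} e lt with gb (binom u v) (binom∈J {u} {v} e) u (binom-leading lt)
    ... | g , g∈ , m , lead , m∣u with LMP.∈-map⁻ _ g∈
    ... | (x , y) , xy∈ , refl with degrees-of quad xy∈ | binom∈J⁻ {x} {y} (All.lookup G⊆J g∈) | divides m∣u | binom-leading⁻ x y m lead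
    ... | dx , dy | im | w , eu | inj₁ (refl , y≺x) with deg-two x dx | deg-two y dy
    ... | i , i′ , refl | k , k′ , refl =
      reduce w i i′ k k′ (fibre (trans dx (sym dy)) (≡-image (unit i ⊞ unit i′) (unit k ⊞ unit k′) im)) y≺x eu
    Groebner⇒ G quad (G⊆J , gb) {u} {v} e lt
      | g , g∈ , m , lead , m∣u | (x , y) , xy∈ , refl | dx , dy | im | w , eu | inj₂ (refl , x≺y) with deg-two x dx | deg-two y dy
    ... | i , i′ , refl | k , k′ , refl =
      reduce w k k′ i i′ (fibre (trans dy (sym dx)) (≡-image (unit k ⊞ unit k′) (unit i ⊞ unit i′) (sym im))) x≺y eu

    -- If no pair reduces m, then m is alone in its fibre within the support of f, which contradicts f ∈ J.  Equality
    -- in K need not be decidable, so this is argued under a double negation; reducibility of m is decidable.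
    ⇒Groebner : (∀ {u v} → image u ≡ image v → v ≺ u → Reducible _≺_ (Fibre M) u) →
      Poly.IsGroebner K M O (Poly.binoms K M quadraticPairs)
    ⇒Groebner red = AllP.map⁺ (All.tabulate λ {(x , y)} m → binom∈J {x} {y} (proj₂ (∈-quadraticPairs⁻ m))) , gb
      where
      Reduces : Mon n → Mon n × Mon n → Set
      Reduces m (x , y) = y ≺ x × x ∣ᵐ m

      reduces? : ∀ m xy → Dec (Reduces m xy)
      reduces? m (x , y) = (y S.<? x) ×-dec PW.decidable ℕP._≤?_ x m

      reducing : ∀ {m} → Reducible _≺_ (Fibre M) m → Any (Reduces m) quadraticPairs
      reducing (reduce w i i′ k k′ r lt refl) = LM.lose (∈-quadraticPairs (Fibre⇒image r)) (lt , ⊞-divides w _)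

      gb : ∀ f → Poly._∈J K M f → ∀ m → IsLeading O f m →
        ∃[ g ] (g LM.∈ Poly.binoms K M quadraticPairs × ∃[ m′ ] (IsLeading O g m′ × m′ ∣ᵐ m))
      gb f f∈J m (f≉0 , top) with Any.any? (reduces? m) quadraticPairs
      ... | yes found = let (x , y) , xy∈ , lt , x∣m = LM.find found in
        binom x y , LMP.∈-map⁺ _ xy∈ , x , binom-leading lt , x∣m
      ... | no irreducible = ⊥-elim (rest≈0 λ z → f≉0 (F.trans (F.sym (begin
          eval g f                                      ≈⟨ eval-remove g m f ⟩
          coeff f m *ₖ g m +ₖ eval g (remove m f)       ≈⟨ F.+-cong (F.*-congˡ (F.reflexive (indicator-same {m = image m} refl))) z ⟩
          coeff f m *ₖ 1# +ₖ 0#                         ≈⟨ F.+-identityʳ _ ⟩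
          coeff f m *ₖ 1#                               ≈⟨ F.*-identityʳ _ ⟩
          coeff f m                                     ∎))
          (F.trans (F.sym (eval-relabel image (indicator (image m)) f)) (eval-≈0 (indicator (image m)) (relabel image f) f∈J))))
        where
        open Relation.Binary.Reasoning.Setoid F.setoid
        -- This functional factors through the monomial map and so vanishes on `f`; it is 1 on the
        -- monomials with the image of `m` and 0 elsewhere.
        g : Mon n → Carrier
        g = indicator (image m) ∘ image
        vanishing : ∀ v → ¬ ¬ (coeff (remove m f) v *ₖ g v ≈ 0#)
        vanishing v = cases (v ≟ᵐ m) (image v ≟ᵐ image m)
          where
          cases : Dec (v ≡ m) → Dec (image v ≡ image m) → ¬ ¬ (coeff (remove m f) v *ₖ g v ≈ 0#)
          cases (yes refl) _ k = k (F.trans (F.*-congʳ (coeff-remove-same m f)) (F.zeroˡ _))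
          cases (no _) (no ¬e) k = k (F.trans (F.*-congˡ (F.reflexive (indicator-diff ¬e))) (F.zeroʳ _))
          -- Another monomial `v` of the fibre with nonzero coefficient would lie below the leading
          -- monomial `m` and make `m` reducible.
          cases (no v≢m) (yes e) k = irreducible (reducing (red (sym e)
            ([ (λ v≡m → ⊥-elim (v≢m v≡m)) , id ]′
              (top v λ z → k (F.trans (F.*-congʳ (F.trans (coeff-remove-diff v≢m f) z)) (F.zeroˡ _))))))
        rest≈0 : ¬ ¬ (eval g (remove m f) ≈ 0#)
        rest≈0 = eval-closed (λ x → ¬ ¬ (x ≈ 0#)) (λ e k k′ → k λ z → k′ (F.trans (F.sym e) z)) (λ k → k F.refl)
          (λ k k′ h → k λ z → k′ λ z′ → h (F.trans (F.+-cong z z′) (F.+-identityˡ 0#))) g (remove m f) vanishing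

    -- The variable of an empty basis would be a linear leading monomial.
    reducible⇒positive-rank : (∀ {u v} → image u ≡ image v → v ≺ u → Reducible _≺_ (Fibre M) u) →
      ∀ {X} → IsBasis M X → 1 ≤ size X
    reducible⇒positive-rank red {X} x with size X in eq
    ... | suc _ = s≤s z≤n
    ... | zero with basis-index M x
    ... | j , refl = ⊥-elim (impossible (red {unit j} {𝟎} trivial-image
        ([ (λ e → ⊥-elim (unit≢𝟎 j e)) , id ]′ (one-least (unit j)))))
      where
      trivial-image : image (unit j) ≡ image 𝟎
      trivial-image = image-≡ (unit j) 𝟎 λ i → trans (wt-unit (λ j → bit (lookup (basis M j) i)) j)
        (trans (sum≡0 _ eq i) (sym (wt-𝟎 (λ j → bit (lookup (basis M j) i)))))
      impossible : ¬ Reducible _≺_ (Fibre M) (unit j)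
      impossible (reduce w i i′ _ _ _ _ e) = contradiction
        (trans (sym (deg-unit j)) (trans (cong deg e) (trans (deg-⊞ w _)
          (trans (cong (deg w +_) (deg-units i i′)) (+-comm (deg w) 2))))) λ ()

-- A single basis means a single variable, and then the degree determines the monomial.
trivial-fibre : ∀ {N} {u v : Mon (#bases (trivial {N}))} → Fibre (trivial {N}) u v → u ≡ v
trivial-fibre {N} {u} {v} (fibre d _) = deg-injective at-most-one u v d
  where
  M : SetSystem N
  M = trivial
  at-most-one : ∀ (i j : Fin (#bases M)) → i ≡ j
  at-most-one i j = basis-inj M i j (trans (trivial-basis⁻ (basis-isBasis M i)) (sym (trivial-basis⁻ (basis-isBasis M j))))
  deg-injective : ∀ {n} → (∀ (i j : Fin n) → i ≡ j) → ∀ (u v : Mon n) → deg u ≡ deg v → u ≡ v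
  deg-injective {zero}        _ []       []       _ = refl
  deg-injective {suc zero}    _ (x ∷ []) (y ∷ []) h = cong (_∷ []) (ℕP.*-cancelʳ-≡ x y 1 (+-cancelʳ-≡ 0 _ _ h))
  deg-injective {suc (suc n)} h _        _        _ = contradiction (h zero (suc zero)) λ ()

-- The two classes

QuadraticallyGenerated : ∀ {N} → SetSystem N → Set
QuadraticallyGenerated M = QuadraticallyConnected (Fibre M)

trivial-generated : ∀ {N} → QuadraticallyGenerated (trivial {N})
trivial-generated {N} u v r = subst (Star (Move (Fibre (trivial {N}))) u) (trivial-fibre {N} {u} {v} r) ε

composite-generated : ∀ {N} {M M₁ M₂ : SetSystem N} {c} → Composite M M₁ M₂ c → IsMatroid M₁ → IsMatroid M₂ →
  QuadraticallyGenerated M₁ → QuadraticallyGenerated M₂ → QuadraticallyGenerated M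
composite-generated C mat₁ mat₂ = FibreProduct.quadraticallyConnected (CompositeFibre.fibreProduct C mat₁ mat₂)

module QuadraticGenerators = Closure QuadraticallyGenerated trivial-generated composite-generated

module QuadraticGroebner {a ℓ} (K : Field a ℓ) where
  open Orders K

  QuadraticallyReducible : ∀ {N} → SetSystem N → Set₁
  QuadraticallyReducible M = ∃[ O ] ReducesFibres O (Fibre M)

  trivial-reducible : ∀ {N} → QuadraticallyReducible (trivial {N})
  trivial-reducible {N} = O , λ u v r lt → ⊥-elim (IsStrictTotalOrder.irrefl (MonomialOrder.isSTO O) (sym (trivial-fibre {N} {u} {v} r)) lt)
    where O = lex (#bases (trivial {N}))

  composite-reducible : ∀ {N} {M M₁ M₂ : SetSystem N} {c} → Composite M M₁ M₂ c → IsMatroid M₁ → IsMatroid M₂ →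
    QuadraticallyReducible M₁ → QuadraticallyReducible M₂ → QuadraticallyReducible M
  composite-reducible C mat₁ mat₂ (O₁ , red₁) (O₂ , red₂) =
    let FP = CompositeFibre.fibreProduct C mat₁ mat₂ in glueOrder FP O₁ O₂ , reducesFibres FP O₁ O₂ red₁ red₂

  open Closure QuadraticallyReducible trivial-reducible composite-reducible public

module _ {a ℓ} (K : Field a ℓ) where

  closed : ∀ {p q} (𝓒 : ∀ {N} → SetSystem N → Set p) (Good : ∀ {N} → SetSystem N → Set q) →
    (∀ {N} {M : SetSystem N} → IsMatroid M → 𝓒 M → Good M) →
    (∀ {N} {M : SetSystem N} → Good M → IsMatroid M × 𝓒 M) →
    (∀ {N} {M₁ M₂ : SetSystem N} {c} → E M₁ ∩ E M₂ ≡ ⁅ c ⁆ → Good M₁ → Good M₂ →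
      Good (series M₁ M₂ c) × Good (parallel M₁ M₂ c) ×
      (¬ IsLoop M₁ c → ¬ IsColoop M₁ c → ¬ IsLoop M₂ c → ¬ IsColoop M₂ c → Good (twoSum M₁ M₂ c))) →
    ClosedUnderConnections 𝓒
  closed 𝓒 Good to from connections M₁ M₂ c mat₁ mat₂ E∩E c₁ c₂ =
    let s , p , t = connections E∩E (to mat₁ c₁) (to mat₂ c₂)
    in from s , from p , λ l₁ k₁ l₂ k₂ → from (t l₁ k₁ l₂ k₂)

  -- Positive rank comes from the quadrics: their moves preserve the degree, so equal images imply
  -- equal degrees, which rules out a variable with image 1.
  closed-Q : ClosedUnderConnections (Poly.InMQ K)
  closed-Q = closed (Poly.InMQ K) (Good 1)
    (λ {_} {M} mat q → good mat
      (λ u v r → Toric.InMQ⇒ K M q (Toric.Fibre⇒image K M r))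
      (Toric.positive-rank K M λ {u} {v} e → Toric.Connected⇒deg K M (Toric.InMQ⇒ K M q {u} {v} e)))
    (λ {_} {M} (good mat conn rank) → mat ,
      Toric.⇒InMQ K M λ e → conn _ _ (Toric.image⇒Fibre K M mat rank e))
    λ E∩E g₁ g₂ → good-series E∩E g₁ g₂ ≤-refl ≤-refl , good-parallel E∩E g₁ g₂ ≤-refl ≤-refl ,
      good-twoSum E∩E g₁ g₂ ≤-refl ≤-refl
    where open QuadraticGenerators

  -- A given Gröbner basis enters through its order and the reductions it provides; the one returned
  -- consists of all quadratic pairs, for the order obtained by gluing.
  closed-QG : ClosedUnderConnections (Poly.InMQG K)
  closed-QG = closed (Poly.InMQG K) (Good 1)
    (λ {_} {M} mat (O , G , quad , gb) →
      let red = λ {u} {v} → Groebner.Groebner⇒ K M O G quad gb {u} {v}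
      in good mat (O , λ u v r → red (Toric.Fibre⇒image K M r)) (Groebner.reducible⇒positive-rank K M O red))
    (λ {_} {M} (good mat (O , red) rank) → mat , O , Toric.quadraticPairs K M , Toric.quadraticPairs-quadratic K M ,
      Groebner.⇒Groebner K M O λ e lt → red _ _ (Toric.image⇒Fibre K M mat rank e) lt)
    λ E∩E g₁ g₂ → good-series E∩E g₁ g₂ ≤-refl ≤-refl , good-parallel E∩E g₁ g₂ ≤-refl ≤-refl ,
      good-twoSum E∩E g₁ g₂ ≤-refl ≤-refl
    where open QuadraticGroebner K

theorem3p3 : ∀ {a ℓ} (K : Field a ℓ) →
    ClosedUnderConnections (Poly.InMQG K) × ClosedUnderConnections (Poly.InMQ K)
theorem3p3 K = closed-QG K , closed-Q K
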